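{- Let $k=3$, $l=2$ and let $X\subset\mathcal{C}_3$ be an ideal of colorings. Then there is a constant $c>0$ such that either $|X_n|\le n^c$ for every $n\in\mathbb{N}$, or $|X_n|\ge G_n$ for every $n\ge 23$.
   Context: $\mathbb{N}=\{1,2,\dots\}$ and $[n]=\{1,2,\dots,n\}$; $\binom{A}{3}$ is the set of $3$-element subsets of $A$. A coloring is a pair $(n,\chi)$ with $n\in\mathbb{N}$ and $\chi:\binom{[n]}{3}\to[2]$ any map (the empty map for $n<3$); $\mathcal{C}_3$ is the set of all colorings. For colorings, $(m,\phi)\preceq(n,\chi)$ means that there is an increasing injection $f:[m]\to[n]$ such that $\phi(E)=\chi(f(E))$ for every $E\in\binom{[m]}{3}$. A set $X\subset\mathcal{C}_3$ is an ideal if $K\preceq L\in X$ implies $K\in X$. $X_n$ is the set of those colorings in $X$ that have the vertex set $[n]$. The sequence $(G_n)_{n\ge1}$ is defined by $G_1=G_2=1$, $G_3=2$ and $G_n=G_{n-1}+G_{n-3}$ for $n\ge4$. -}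

module Defs where

open import Level using (Level; _⊔_)
open import Data.Nat using (ℕ; suc; _+_; NonZero)
open import Data.Fin using (Fin; _<_)
open import Data.Product using (Σ; ∃-syntax; _×_; proj₁)
open import Function using (_∘_)
open import Function.Bundles using (Bijection)
open import Relation.Binary using (Setoid; _Preserves_⟶_)
import Relation.Binary.Construct.On as On
open import Relation.Binary.PropositionalEquality using (_≗_; _→-setoid_; setoid)
open import Relation.Unary using (Pred)

private
  variable
    a e ℓ : Level
    m n : ℕ

-- A 3-element subset {x < y < z} of the linearly ordered set Fin n, listed in
-- increasing order.  The order proofs are irrelevant, so that two triples with
-- the same elements are definitionally equal.
record Triple (n : ℕ) : Set where
  constructor triple
  field
    x y z : Fin n
    .x<y  : x < y
    .y<z  : y < z

-- The image f(E); listing it in increasing order uses that f is increasing.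
image : (f : Fin m → Fin n) → .(f Preserves _<_ ⟶ _<_) → Triple m → Triple n
image f f-mono (triple x y z x<y y<z) =
  triple (f x) (f y) (f z) (f-mono x<y) (f-mono y<z)

ColoringOn : ℕ → Set
ColoringOn n = Triple n → Fin 2

record 𝒞₃ : Set where
  constructor coloring
  field
    size         : ℕ
    .{{size≢0}}  : NonZero size
    χ            : ColoringOn size

open 𝒞₃ public using (size; χ)

infix 4 _⪯_

-- Preserving the strict order makes f injective.
_⪯_ : 𝒞₃ → 𝒞₃ → Set
K ⪯ L = ∃[ f ] Σ (f Preserves _<_ ⟶ _<_) λ f-mono →
          χ K ≗ χ L ∘ image {size K} {size L} f f-mono

-- Taking f to be the identity shows that an ideal does not distinguish
-- pointwise equal colorings.
IsIdeal : Pred 𝒞₃ ℓ → Set ℓ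
IsIdeal X = ∀ {K L} → K ⪯ L → X L → X K

infix 9 _↾_

-- X ↾ n is X_n: its elements are colorings, compared pointwise as maps; the
-- proofs of membership in X play no role in the equality.
_↾_ : Pred 𝒞₃ ℓ → (n : ℕ) → .{{NonZero n}} → Setoid ℓ _
X ↾ n = On.setoid (Triple n →-setoid Fin 2)
          (proj₁ {B = λ φ → X (coloring n φ)})

infix 4 _HasCardinality_

_HasCardinality_ : Setoid a e → ℕ → Set (a ⊔ e)
S HasCardinality k = Bijection (setoid (Fin k)) S

-- The sequence starts at index 1; the value at 0 is never used.
G : ℕ → ℕ
G 0 = 0
G 1 = 1
G 2 = 1
G 3 = 2
G (suc (suc (suc (suc n)))) = G (suc (suc (suc n))) + G (suc n)

{-# OPTIONS --safe --termination-depth=4 #-}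

-- Call i a break of a coloring if some pair {u,v} tells the vertices i and i+1
-- apart.  A coloring with at most r breaks is determined by their positions and
-- by the colours of the types of triples with respect to the intervals they cut
-- out (move the vertices of a triple within unbroken intervals), so boundedly
-- many breaks give polynomial growth.  Otherwise fix n ≥ 23 with |X_n| < G_n.
-- Applied to the quadruples (i,i+1,u,v) of many breaks, Ramsey's theorem gives
-- sequences on which order and colour depend only on the order of the indices.
-- Seen from two fixed points, interleaved sequences have the same colour, since
-- an alternation gives 2^(n-2) colorings.  Seen from one fixed point, the colour
-- of p_i, q_j depends neither on i nor on j: for interleaved sequences an
-- exception at i = j is counted by words with letters of length 1 and 2, and for
-- separated ones each group of two p's and two q's takes six patterns, which
-- yields 6^⌊(n-1)/4⌋ ≥ G_n colorings.  Taking the vertex of least or greatest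
-- index as the fixed point, one sees that the colour of a triple depends only on
-- the sequences its vertices come from, unless all three indices agree.  There
-- too: an exception is counted by words with letters of length 1 and 3, of which
-- there are G_n.  Hence (i,u,v) and (i+1,u,v) have the same colour after all.

module Submission where

open import Defs
open import Axiom.ExcludedMiddle using (ExcludedMiddle)
open import Data.Bool.Base using (Bool; true; false; T; if_then_else_)
open import Data.Bool.Properties using (T-≡)
open import Data.Empty using (⊥; ⊥-elim)
open import Data.Fin.Base as Fin using (Fin; toℕ; fromℕ<; funToFin; finToFun) renaming (zero to fz; suc to fs)
open import Data.Fin.Patterns using (0F; 1F; 2F; 3F)
import Data.Fin.Properties as Finₚ
open import Data.List.Base as List using (List; []; _∷_; _++_; length; map)
import Data.List.Properties as Listₚ
open import Data.List.Membership.Propositional using (_∈_)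
open import Data.List.Membership.Propositional.Properties using (∈-++⁺ˡ; ∈-++⁺ʳ; ∈-++⁻; ∈-map⁻; ∈-allFin; ∈-cartesianProduct⁺)
open import Data.List.Relation.Binary.Sublist.Propositional as Sublist using (_⊆_; []; _∷_; _∷ʳ_; ⊆-refl; ⊆-trans; minimum; to∈)
open import Data.List.Relation.Unary.All as All using (All; []; _∷_)
import Data.List.Relation.Unary.All.Properties as Allₚ
open import Data.List.Relation.Unary.AllPairs as AllPairs using (AllPairs; []; _∷_)
open import Data.List.Relation.Unary.Any using (here; there)
open import Data.Nat using (ℕ; NonZero; zero; suc; pred; _+_; _*_; _∸_; _^_; _≤_; _<_; _<ᵇ_; _⊓_; z≤n; s≤s; z<s; _≤?_; _<?_; _≟_; >-nonZero; >-nonZero⁻¹)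
open import Data.List.Membership.DecPropositional _≟_ using (_∈?_)
open import Data.Nat.Properties as ℕₚ using (≤-trans; <-trans; ≤-refl; ≤-reflexive; <⇒≢; >⇒≢; n≤1+n; m≤m+n; m≤n+m; <-cmp; ≤-total; suc-injective; +-suc; <⇒≤)
open import Data.Product using (Σ; ∃; ∃₂; ∃-syntax; _×_; _,_; proj₁; proj₂)
open import Data.Sum using (_⊎_; inj₁; inj₂; [_,_]′)
open import Data.Vec.Base as Vec using (Vec; []; _∷_)
import Data.Vec.Properties as Vecₚ
open import Data.Nat.Solver using (module +-*-Solver)
open import Function using (_∘_; id)
open import Function.Bundles using (Bijection; Equivalence)
open import Relation.Binary using (Setoid; tri<; tri≈; tri>)
open import Relation.Binary.PropositionalEquality using (_≡_; _≢_; _≗_; refl; sym; trans; cong; cong₂; subst; subst₂)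
open import Relation.Nullary using (¬_; Dec; yes; no; contradiction; recompute)
open import Relation.Nullary.Decidable using (¬?; True; toWitness; _×-dec_; _→-dec_)
open import Relation.Unary using (Pred)

-- Ramsey's theorem for k-element sublists

-- The Ramsey bound is chosen before the coloring, so a single n with few members bounds the breaks
-- in all colorings of X, of whatever size. The vertices u, v of a break are not under control. On a
-- canonical choice of breaks each either runs through distinct vertices or stays constant. A
-- constant one is itself used as a fixed point, and only four injective sequences need the full
-- analysis. All lower bounds follow one scheme: lists of n points are indexed by words, and the
-- first letter where two words differ must show in the colours of facing points. Sorting preserves
-- facing points only between order isomorphic lists. This is the obstacle for letters of length 1
-- and 3: if some of the three sequences lie beside the others, words with different numbers of long
-- letters put different numbers of points there, and the lists are shifted against each other. The
-- shift itself is then used: under it, a colour cannot depend on whether three indices agree. The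
-- base 6 suffices because G_n grows like 1.4656^n, hence by a factor of about 4.61 over four steps.

module _ {A : Set} where

  Hom : ℕ → (List A → Bool) → Bool → List A → Set
  Hom k f c ys = ∀ {t} → t ⊆ ys → length t ≡ k → f t ≡ c

  -- The intermediate stage of the classical proof: the colour of a sublist of length `k + 1`
  -- depends on its first entry only.
  data MinHom (k : ℕ) (f : List A → Bool) : List A → Set where
    []  : MinHom k f []
    _∷_ : ∀ {y ys} → ∃ (λ c → Hom k (f ∘ (y ∷_)) c ys) → MinHom k f ys → MinHom k f (y ∷ ys)

  Hom-∷ : ∀ {k f c y ys} → Hom k (f ∘ (y ∷_)) c ys → Hom (suc k) f c ys → Hom (suc k) f c (y ∷ ys)
  Hom-∷ h₁ h₂ (_ ∷ʳ t⊆)   e = h₂ t⊆ e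
  Hom-∷ h₁ h₂ (refl ∷ t⊆) e = h₁ t⊆ (suc-injective e)

  Hom-[] : ∀ {k f c} → Hom (suc k) f c []
  Hom-[] [] ()

  Hom-⊆ : ∀ {k f c ys zs} → zs ⊆ ys → Hom k f c ys → Hom k f c zs
  Hom-⊆ zs⊆ h t⊆ = h (⊆-trans t⊆ zs⊆)

  -- Pigeonhole: each entry carries the colour of the sublists that begin with it, and the entries
  -- carrying one colour form a homogeneous sublist.
  minHom⇒hom : ∀ {k f} a b ys → MinHom k f ys → a + b ≤ length ys →
    (∃ λ zs → zs ⊆ ys × a ≤ length zs × Hom (suc k) f true zs) ⊎
    (∃ λ zs → zs ⊆ ys × b ≤ length zs × Hom (suc k) f false zs)
  minHom⇒hom {f = f} zero    b    ys _ _ = inj₁ ([] , minimum ys , z≤n , Hom-[] {f = f})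
  minHom⇒hom {f = f} (suc a) zero ys _ _ = inj₂ ([] , minimum ys , z≤n , Hom-[] {f = f})
  minHom⇒hom {f = f} (suc a) (suc b) (y ∷ ys) ((true , h) ∷ mh) (s≤s le)
    with minHom⇒hom a (suc b) ys mh le
  ... | inj₁ (zs , zs⊆ , l , hz) = inj₁ (y ∷ zs , refl ∷ zs⊆ , s≤s l , Hom-∷ {f = f} (Hom-⊆ {f = f ∘ (y ∷_)} zs⊆ h) hz)
  ... | inj₂ (zs , zs⊆ , l , hz) = inj₂ (zs , y ∷ʳ zs⊆ , l , hz)
  minHom⇒hom {f = f} (suc a) (suc b) (y ∷ ys) ((false , h) ∷ mh) (s≤s le)
    with minHom⇒hom (suc a) b ys mh (≤-trans (≤-reflexive (sym (+-suc a b))) le)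
  ... | inj₁ (zs , zs⊆ , l , hz) = inj₁ (zs , y ∷ʳ zs⊆ , l , hz)
  ... | inj₂ (zs , zs⊆ , l , hz) = inj₂ (y ∷ zs , refl ∷ zs⊆ , s≤s l , Hom-∷ {f = f} (Hom-⊆ {f = f ∘ (y ∷_)} zs⊆ h) hz)

  Ramsey : ℕ → Set
  Ramsey k = ∀ m → ∃ λ N → ∀ f xs → N ≤ length xs →
    ∃ λ ys → ys ⊆ xs × m ≤ length ys × ∃ λ c → Hom k f c ys

  minHomogeneous : ∀ {k} → Ramsey k → ∀ m → ∃ λ N → ∀ f xs → N ≤ length xs →
    ∃ λ ys → ys ⊆ xs × m ≤ length ys × MinHom k f ys
  minHomogeneous R zero = 0 , λ f xs _ → [] , minimum xs , z≤n , []
  minHomogeneous {k} R (suc m) = suc N , go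
    where
    N′ = proj₁ (minHomogeneous R m)
    N  = proj₁ (R N′)
    go : ∀ f xs → suc N ≤ length xs → ∃ λ ys → ys ⊆ xs × suc m ≤ length ys × MinHom k f ys
    go f (x ∷ xs) (s≤s le) with proj₂ (R N′) (f ∘ (x ∷_)) xs le
    ... | ys , ys⊆ , l , c , h with proj₂ (minHomogeneous R m) f ys l
    ... | zs , zs⊆ , l′ , mh =
      x ∷ zs , refl ∷ ⊆-trans zs⊆ ys⊆ , s≤s l′ , (c , Hom-⊆ {f = f ∘ (x ∷_)} zs⊆ h) ∷ mh

  ramsey : ∀ k → Ramsey k
  ramsey zero m = m , λ f xs le → xs , ⊆-refl , le , f [] , λ { {[]} _ _ → refl }
  ramsey (suc k) m with minHomogeneous (ramsey k) (m + m)
  ... | N , min = N , λ f xs le → conclude f xs (min f xs le)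
    where
    conclude : ∀ f xs → (∃ λ ys → ys ⊆ xs × m + m ≤ length ys × MinHom k f ys) →
      ∃ λ ys → ys ⊆ xs × m ≤ length ys × ∃ λ c → Hom (suc k) f c ys
    conclude f xs (ys , ys⊆ , l , mh) with minHom⇒hom m m ys mh l
    ... | inj₁ (zs , zs⊆ , l′ , h) = zs , ⊆-trans zs⊆ ys⊆ , l′ , true , h
    ... | inj₂ (zs , zs⊆ , l′ , h) = zs , ⊆-trans zs⊆ ys⊆ , l′ , false , h

  -- Passing to a sublist once per colouring keeps the homogeneity already gained. `N` precedes `F`,
  -- so that one bound will serve all colorings in the ideal.
  ramsey-family : {I : Set} (is : List I) → ∀ k m → ∃ λ N → ∀ (F : I → List A → Bool) xs → N ≤ length xs →
    ∃ λ ys → ys ⊆ xs × m ≤ length ys × (∀ {i} → i ∈ is → ∃ λ c → Hom k (F i) c ys)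
  ramsey-family []       k m = m , λ F xs le → xs , ⊆-refl , le , λ ()
  ramsey-family (i ∷ is) k m with ramsey-family is k m
  ... | N′ , r′ with ramsey k N′
  ... | N , r = N , λ F xs le → conclude F xs (r (F i) xs le)
    where
    conclude : ∀ F xs → (∃ λ ys → ys ⊆ xs × N′ ≤ length ys × ∃ λ c → Hom k (F i) c ys) →
      ∃ λ ys → ys ⊆ xs × m ≤ length ys × (∀ {j} → j ∈ i ∷ is → ∃ λ c → Hom k (F j) c ys)
    conclude F xs (ys , ys⊆ , l , c , h) with r′ F ys l
    ... | zs , zs⊆ , l′ , hs = zs , ⊆-trans zs⊆ ys⊆ , l′ ,
      λ { (here refl) → c , Hom-⊆ {f = F i} zs⊆ h ; (there j∈) → hs j∈ }

-- Positions in lists and facing entries of two lists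

module _ {A : Set} (d : A) where

  at : List A → ℕ → A
  at []       _       = d
  at (x ∷ xs) zero    = x
  at (x ∷ xs) (suc i) = at xs i

  at-∈ : ∀ xs {i} → i < length xs → at xs i ∈ xs
  at-∈ (x ∷ xs) {zero}  _        = here refl
  at-∈ (x ∷ xs) {suc i} (s≤s lt) = there (at-∈ xs lt)

  at-⊆₁ : ∀ xs {i} → i < length xs → (at xs i ∷ []) ⊆ xs
  at-⊆₁ (x ∷ xs) {zero}  _        = refl ∷ minimum xs
  at-⊆₁ (x ∷ xs) {suc i} (s≤s lt) = x ∷ʳ at-⊆₁ xs lt

  at-⊆₂ : ∀ xs {i j} → i < j → j < length xs → (at xs i ∷ at xs j ∷ []) ⊆ xs
  at-⊆₂ (x ∷ xs) {zero}  {suc j} _         (s≤s lt) = refl ∷ at-⊆₁ xs lt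
  at-⊆₂ (x ∷ xs) {suc i} {suc j} (s≤s i<j) (s≤s lt) = x ∷ʳ at-⊆₂ xs i<j lt

  at-⊆₃ : ∀ xs {i j k} → i < j → j < k → k < length xs → (at xs i ∷ at xs j ∷ at xs k ∷ []) ⊆ xs
  at-⊆₃ (x ∷ xs) {zero}  {suc j} {suc k} _         (s≤s j<k) (s≤s lt) = refl ∷ at-⊆₂ xs j<k lt
  at-⊆₃ (x ∷ xs) {suc i} {suc j} {suc k} (s≤s i<j) (s≤s j<k) (s≤s lt) = x ∷ʳ at-⊆₃ xs i<j j<k lt

-- The entries `a` and `b` face each other, standing at the same position. The lists may differ in
-- length; an entry beyond the end of the shorter one faces nothing.
data Zip {A : Set} : List A → List A → A → A → Set where
  here  : ∀ {x y xs ys} → Zip (x ∷ xs) (y ∷ ys) x y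
  there : ∀ {x y xs ys a b} → Zip xs ys a b → Zip (x ∷ xs) (y ∷ ys) a b

module _ {A : Set} where

  Zip-∈ˡ : ∀ {xs ys : List A} {a b} → Zip xs ys a b → a ∈ xs
  Zip-∈ˡ here      = here refl
  Zip-∈ˡ (there z) = there (Zip-∈ˡ z)

  Zip-∈ʳ : ∀ {xs ys : List A} {a b} → Zip xs ys a b → b ∈ ys
  Zip-∈ʳ here      = here refl
  Zip-∈ʳ (there z) = there (Zip-∈ʳ z)

  Zip-sym : ∀ {xs ys : List A} {a b} → Zip xs ys a b → Zip ys xs b a
  Zip-sym here      = here
  Zip-sym (there z) = there (Zip-sym z)

  Zip-refl : ∀ {xs : List A} {a} → a ∈ xs → Zip xs xs a a
  Zip-refl (here refl) = here
  Zip-refl (there a∈)  = there (Zip-refl a∈)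

  Zip-++ˡ : ∀ {xs ys us vs : List A} {a b} → Zip xs ys a b → Zip (xs ++ us) (ys ++ vs) a b
  Zip-++ˡ here      = here
  Zip-++ˡ (there z) = there (Zip-++ˡ z)

  Zip-++ʳ : ∀ (xs ys : List A) {us vs a b} → length xs ≡ length ys → Zip us vs a b → Zip (xs ++ us) (ys ++ vs) a b
  Zip-++ʳ []       []       _ z = z
  Zip-++ʳ (x ∷ xs) (y ∷ ys) e z = there (Zip-++ʳ xs ys (suc-injective e) z)

  Zip-++⁻ : ∀ (xs ys : List A) {us vs a b} → length xs ≡ length ys →
    Zip (xs ++ us) (ys ++ vs) a b → Zip xs ys a b ⊎ Zip us vs a b
  Zip-++⁻ []       []       _ z         = inj₂ z
  Zip-++⁻ (x ∷ xs) (y ∷ ys) e here      = inj₁ here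
  Zip-++⁻ (x ∷ xs) (y ∷ ys) e (there z) with Zip-++⁻ xs ys (suc-injective e) z
  ... | inj₁ z′ = inj₁ (there z′)
  ... | inj₂ z′ = inj₂ z′

  Zip-preimage : ∀ {xs ys : List A} {b} → length ys ≤ length xs → b ∈ ys → ∃ λ a → Zip xs ys a b
  Zip-preimage {x ∷ xs} _        (here refl) = x , here
  Zip-preimage {x ∷ xs} (s≤s le) (there b∈)  with Zip-preimage le b∈
  ... | a , z = a , there z

  Zip-image : ∀ {xs ys : List A} {a} → length xs ≤ length ys → a ∈ xs → ∃ λ b → Zip xs ys a b
  Zip-image le a∈ with Zip-preimage le a∈
  ... | b , z = b , Zip-sym z

  -- Of two equally long lists, divided into `S`, `T` and `S′`, `T′`, let the first have the longer
  -- part `S`: it covers `S′` and reaches into `T′`. This arises when two words put different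
  -- numbers of points on the two sides.
  record LongerPart (S S′ T′ : List A) (L L′ : List A) : Set where
    field
      within   : ∀ {b} → b ∈ S′ → ∃ λ a → a ∈ S × Zip L L′ a b
      overhang : ∃ λ b → b ∈ T′ × ∃ λ a → a ∈ S × Zip L L′ a b

  longerPrefix : ∀ S T S′ T′ → length (S ++ T) ≡ length (S′ ++ T′) → length S′ < length S →
    LongerPart S S′ T′ (S ++ T) (S′ ++ T′)
  longerPrefix (s ∷ S) T [] (t′ ∷ T′) e lt = record
    { within = λ () ; overhang = t′ , here refl , s , here refl , here }
  longerPrefix (s ∷ S) T (s′ ∷ S′) T′ e (s≤s lt) = record
    { within   = λ { (here refl) → s , here refl , here
                   ; (there b∈)  → let a , a∈ , z = within b∈ in a , there a∈ , there z }
    ; overhang = let b , b∈ , a , a∈ , z = overhang in b , b∈ , a , there a∈ , there z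
    }
    where open LongerPart (longerPrefix S T S′ T′ (suc-injective e) lt)

  longerSuffix : ∀ S T S′ T′ → length (T ++ S) ≡ length (T′ ++ S′) → length T < length T′ →
    LongerPart S S′ T′ (T ++ S) (T′ ++ S′)
  longerSuffix (s ∷ S) [] S′ (t′ ∷ T′) e lt = record
    { within   = λ b∈ → let a , z = Zip-preimage (≤-reflexive (sym e)) (there (∈-++⁺ʳ T′ b∈)) in a , Zip-∈ˡ z , z
    ; overhang = t′ , here refl , s , here refl , here
    }
  longerSuffix S (t ∷ T) S′ (t′ ∷ T′) e (s≤s lt) = record
    { within   = λ b∈ → let a , a∈ , z = within b∈ in a , a∈ , there z
    ; overhang = let b , b∈ , a , a∈ , z = overhang in b , there b∈ , a , a∈ , there z
    }
    where open LongerPart (longerSuffix S T S′ T′ (suc-injective e) lt)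

-- Sorting and order isomorphisms of point lists

insert : ℕ → List ℕ → List ℕ
insert a []      = a ∷ []
insert a (b ∷ l) with a ≤? b
... | yes _ = a ∷ b ∷ l
... | no  _ = b ∷ insert a l

sort : List ℕ → List ℕ
sort []      = []
sort (a ∷ l) = insert a (sort l)

insert-≤ : ∀ {a b l} → a ≤ b → insert a (b ∷ l) ≡ a ∷ b ∷ l
insert-≤ {a} {b} a≤b with a ≤? b
... | yes _   = refl
... | no  a≰b = contradiction a≤b a≰b

insert-> : ∀ {a b l} → b < a → insert a (b ∷ l) ≡ b ∷ insert a l
insert-> {a} {b} b<a with a ≤? b
... | yes a≤b = contradiction a≤b (ℕₚ.<⇒≱ b<a)
... | no  _   = refl

insert-insert-≤ : ∀ {a b} l → a ≤ b → insert a (insert b l) ≡ insert b (insert a l)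
insert-insert-≤ {a} {b} l a≤b with ℕₚ.m≤n⇒m<n∨m≡n a≤b
... | inj₂ refl = refl
insert-insert-≤ {a} {b} [] a≤b | inj₁ a<b = trans (insert-≤ a≤b) (sym (insert-> a<b))
insert-insert-≤ {a} {b} (c ∷ l) a≤b | inj₁ a<b with a ≤? c | b ≤? c
... | yes a≤c | yes b≤c = trans (insert-≤ a≤b) (sym (trans (insert-> a<b) (cong (a ∷_) (insert-≤ b≤c))))
... | yes a≤c | no  b≰c = trans (insert-≤ a≤c) (sym (trans (insert-> a<b) (cong (a ∷_) (insert-> (ℕₚ.≰⇒> b≰c)))))
... | no  a≰c | yes b≤c = contradiction (≤-trans a≤b b≤c) a≰c
... | no  a≰c | no  b≰c = trans (insert-> (ℕₚ.≰⇒> a≰c))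
  (trans (cong (c ∷_) (insert-insert-≤ l a≤b)) (sym (insert-> (ℕₚ.≰⇒> b≰c))))

-- The symmetry of `col` in its three arguments rests on this.
insert-comm : ∀ a b l → insert a (insert b l) ≡ insert b (insert a l)
insert-comm a b l with ≤-total a b
... | inj₁ a≤b = insert-insert-≤ l a≤b
... | inj₂ b≤a = sym (insert-insert-≤ l b≤a)

length-insert : ∀ a l → length (insert a l) ≡ suc (length l)
length-insert a []      = refl
length-insert a (b ∷ l) with a ≤? b
... | yes _ = refl
... | no  _ = cong suc (length-insert a l)

length-sort : ∀ l → length (sort l) ≡ length l
length-sort []      = refl
length-sort (a ∷ l) = trans (length-insert a (sort l)) (cong suc (length-sort l))

∈-insert⁻ : ∀ {x} a l → x ∈ insert a l → x ∈ a ∷ l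
∈-insert⁻ a []      x∈ = x∈
∈-insert⁻ a (b ∷ l) x∈ with a ≤? b
... | yes _ = x∈
∈-insert⁻ a (b ∷ l) (here refl) | no _ = there (here refl)
∈-insert⁻ a (b ∷ l) (there x∈)  | no _ with ∈-insert⁻ a l x∈
... | here refl = here refl
... | there x∈l = there (there x∈l)

∈-insert⁺ : ∀ {x} a l → x ∈ a ∷ l → x ∈ insert a l
∈-insert⁺ a []      x∈ = x∈
∈-insert⁺ a (b ∷ l) x∈ with a ≤? b
... | yes _ = x∈
∈-insert⁺ a (b ∷ l) (here refl)         | no _ = there (∈-insert⁺ a l (here refl))
∈-insert⁺ a (b ∷ l) (there (here refl)) | no _ = here refl
∈-insert⁺ a (b ∷ l) (there (there x∈))  | no _ = there (∈-insert⁺ a l (there x∈))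

∈-sort⁻ : ∀ {x} l → x ∈ sort l → x ∈ l
∈-sort⁻ (a ∷ l) x∈ with ∈-insert⁻ a (sort l) x∈
... | here refl = here refl
... | there x∈s = there (∈-sort⁻ l x∈s)

∈-sort⁺ : ∀ {x} l → x ∈ l → x ∈ sort l
∈-sort⁺ (a ∷ l) (here refl) = ∈-insert⁺ a (sort l) (here refl)
∈-sort⁺ (a ∷ l) (there x∈)  = ∈-insert⁺ a (sort l) (there (∈-sort⁺ l x∈))

insert-sorted : ∀ a l → All (a ≢_) l → AllPairs _<_ l → AllPairs _<_ (insert a l)
insert-sorted a []      _          _        = [] ∷ []
insert-sorted a (b ∷ l) (a≢b ∷ a≢) (b< ∷ s) with a ≤? b
... | yes a≤b = (a<b ∷ All.map (<-trans a<b) b<) ∷ b< ∷ s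
  where a<b = ℕₚ.≤∧≢⇒< a≤b a≢b
... | no  a≰b = All.tabulate (λ x∈ → below (∈-insert⁻ a l x∈)) ∷ insert-sorted a l a≢ s
  where
  below : ∀ {x} → x ∈ a ∷ l → b < x
  below (here refl) = ℕₚ.≰⇒> a≰b
  below (there x∈)  = All.lookup b< x∈

sort-sorted : ∀ l → AllPairs _≢_ l → AllPairs _<_ (sort l)
sort-sorted []      _         = []
sort-sorted (a ∷ l) (a≢ ∷ ds) =
  insert-sorted a (sort l) (All.tabulate (λ x∈ → All.lookup a≢ (∈-sort⁻ l x∈))) (sort-sorted l ds)

insert-++ : ∀ a S T → (∀ {b} → b ∈ T → a < b) → insert a (S ++ T) ≡ insert a S ++ T
insert-++ a []      []      _   = refl
insert-++ a []      (b ∷ T) a<  = insert-≤ (<⇒≤ (a< (here refl)))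
insert-++ a (s ∷ S) T       a<  with a ≤? s
... | yes _ = refl
... | no  _ = cong (s ∷_) (insert-++ a S T a<)

sort-++ : ∀ S T → (∀ {a b} → a ∈ S → b ∈ T → a < b) → sort (S ++ T) ≡ sort S ++ sort T
sort-++ []      T lt = refl
sort-++ (a ∷ S) T lt = trans (cong (insert a) (sort-++ S T (λ a∈ → lt (there a∈))))
  (insert-++ a (sort S) (sort T) (λ b∈ → lt (here refl) (∈-sort⁻ T b∈)))

SameOrder : ℕ → ℕ → ℕ → ℕ → Set
SameOrder a a′ b b′ = (a < b × a′ < b′) ⊎ (b < a × b′ < a′)

SameOrder-sym : ∀ {a a′ b b′} → SameOrder a a′ b b′ → SameOrder b b′ a a′
SameOrder-sym (inj₁ x) = inj₂ x
SameOrder-sym (inj₂ x) = inj₁ x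

data OrderIso : List ℕ → List ℕ → Set where
  []  : OrderIso [] []
  _∷_ : ∀ {a a′ l l′} → (∀ {b b′} → Zip l l′ b b′ → SameOrder a a′ b b′) →
        OrderIso l l′ → OrderIso (a ∷ l) (a′ ∷ l′)

OrderIso-length : ∀ {l l′} → OrderIso l l′ → length l ≡ length l′
OrderIso-length []      = refl
OrderIso-length (_ ∷ o) = cong suc (OrderIso-length o)

-- `SameOrder` is strict, so an order isomorphism of a list with itself expresses distinctness. The
-- point lists below get their distinctness in this way.
OrderIso-distinct : ∀ {l} → OrderIso l l → AllPairs _≢_ l
OrderIso-distinct []      = []
OrderIso-distinct (c ∷ o) = All.tabulate (λ b∈ a≡b → differ (c (Zip-refl b∈)) a≡b) ∷ OrderIso-distinct o
  where
  differ : ∀ {a b} → SameOrder a a b b → a ≢ b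
  differ (inj₁ (lt , _)) = <⇒≢ lt
  differ (inj₂ (lt , _)) = >⇒≢ lt

OrderIso-++ : ∀ {xs ys us vs} → OrderIso xs ys → OrderIso us vs →
  (∀ {a a′ b b′} → Zip xs ys a a′ → Zip us vs b b′ → SameOrder a a′ b b′) → OrderIso (xs ++ us) (ys ++ vs)
OrderIso-++ [] o _ = o
OrderIso-++ (c ∷ o₁) o₂ x =
  (λ z → [ c , x here ]′ (Zip-++⁻ _ _ (OrderIso-length o₁) z)) ∷ OrderIso-++ o₁ o₂ (λ z → x (there z))

insert-zip : ∀ {a a′} s s′ → length s ≡ length s′ → (∀ {b b′} → Zip s s′ b b′ → SameOrder a a′ b b′) →
  (∀ {p q} → Zip (a ∷ s) (a′ ∷ s′) p q → Zip (insert a s) (insert a′ s′) p q) ×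
  (∀ {p q} → Zip (insert a s) (insert a′ s′) p q → Zip (a ∷ s) (a′ ∷ s′) p q)
insert-zip [] [] _ _ = id , id
insert-zip {a} {a′} (b ∷ s) (b′ ∷ s′) e c with c here
... | inj₁ (a<b , a′<b′)
  rewrite insert-≤ {l = s} (<⇒≤ a<b) | insert-≤ {l = s′} (<⇒≤ a′<b′) = id , id
... | inj₂ (b<a , b′<a′)
  rewrite insert-> {l = s} b<a | insert-> {l = s′} b′<a′ = fwd , bwd
  where
  ih = insert-zip {a} {a′} s s′ (suc-injective e) (λ z → c (there z))
  fwd : ∀ {p q} → Zip (a ∷ b ∷ s) (a′ ∷ b′ ∷ s′) p q → Zip (b ∷ insert a s) (b′ ∷ insert a′ s′) p q
  fwd here              = there (proj₁ ih here)
  fwd (there here)      = here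
  fwd (there (there z)) = there (proj₁ ih (there z))
  bwd : ∀ {p q} → Zip (b ∷ insert a s) (b′ ∷ insert a′ s′) p q → Zip (a ∷ b ∷ s) (a′ ∷ b′ ∷ s′) p q
  bwd here      = there here
  bwd (there z) with proj₂ ih z
  ... | here     = here
  ... | there z′ = there (there z′)

-- Sorting applies the same permutation to order isomorphic lists, so facing entries remain facing.
sort-zip : ∀ {l l′} → OrderIso l l′ →
  (∀ {p q} → Zip l l′ p q → Zip (sort l) (sort l′) p q) ×
  (∀ {p q} → Zip (sort l) (sort l′) p q → Zip l l′ p q)
sort-zip [] = id , id
sort-zip {a ∷ l} {a′ ∷ l′} (c ∷ o) = fwd , bwd
  where
  ih  = sort-zip o
  len = trans (length-sort l) (trans (OrderIso-length o) (sym (length-sort l′)))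
  ins = insert-zip (sort l) (sort l′) len (λ z → c (proj₂ ih z))
  fwd : ∀ {p q} → Zip (a ∷ l) (a′ ∷ l′) p q → Zip (sort (a ∷ l)) (sort (a′ ∷ l′)) p q
  fwd here      = proj₁ ins here
  fwd (there z) = proj₁ ins (there (proj₁ ih z))
  bwd : ∀ {p q} → Zip (sort (a ∷ l)) (sort (a′ ∷ l′)) p q → Zip (a ∷ l) (a′ ∷ l′) p q
  bwd z with proj₂ ins z
  ... | here     = here
  ... | there z′ = there (proj₂ ih z′)

infix 4 _<[_]_

-- Homogeneous sequences may increase or decrease and may lie to the left or to the right of others;
-- a Boolean direction treats mirror images at once.
_<[_]_ : ℕ → Bool → ℕ → Set
x <[ true  ] y = x < y
x <[ false ] y = y < x

sameOrder-dir : ∀ d {a a′ b b′} → a <[ d ] b → a′ <[ d ] b′ → SameOrder a a′ b b′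
sameOrder-dir true  x y = inj₁ (x , y)
sameOrder-dir false x y = inj₂ (x , y)

OrderIso-monotone : ∀ d {l l′} → length l ≡ length l′ →
  AllPairs _<[ d ]_ l → AllPairs _<[ d ]_ l′ → OrderIso l l′
OrderIso-monotone d {[]}    {[]}      _ _        _          = []
OrderIso-monotone d {a ∷ l} {a′ ∷ l′} e (a< ∷ s) (a′< ∷ s′) =
  (λ z → sameOrder-dir d (All.lookup a< (Zip-∈ˡ z)) (All.lookup a′< (Zip-∈ʳ z))) ∷
  OrderIso-monotone d (suc-injective e) s s′

-- Colorings induced on sublists

at-AllPairs : ∀ {A : Set} {R : A → A → Set} (d : A) {xs i j} → AllPairs R xs → i < j → j < length xs → R (at d xs i) (at d xs j)
at-AllPairs d {x ∷ xs} {zero}  {suc j} (r ∷ rs) _         (s≤s lt) = All.lookup r (at-∈ d xs lt)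
at-AllPairs d {x ∷ xs} {suc i} {suc j} (r ∷ rs) (s≤s i<j) (s≤s lt) = at-AllPairs d rs i<j lt

Zip-position : ∀ {A : Set} (d : A) {xs ys : List A} {a b} → Zip xs ys a b →
  ∃ λ i → i < length xs × at d xs i ≡ a × at d ys i ≡ b
Zip-position d here      = 0 , z<s , refl , refl
Zip-position d (there z) = let i , lt , e₁ , e₂ = Zip-position d z in suc i , s≤s lt , e₁ , e₂

Zip-injective : ∀ {s s′ : List ℕ} {p q r} → AllPairs _<_ s′ → Zip s s′ p r → Zip s s′ q r → p ≡ q
Zip-injective _        here       here       = refl
Zip-injective (r< ∷ _) here       (there z)  = contradiction refl (<⇒≢ (All.lookup r< (Zip-∈ʳ z)))
Zip-injective (r< ∷ _) (there z)  here       = contradiction refl (<⇒≢ (All.lookup r< (Zip-∈ʳ z)))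
Zip-injective (_ ∷ s)  (there z₁) (there z₂) = Zip-injective s z₁ z₂

module Colour (K : 𝒞₃) where

  N : ℕ
  N = size K

  colSorted : List ℕ → Fin 2
  colSorted (x ∷ y ∷ z ∷ []) with x <? y | y <? z | z <? N
  ... | yes x<y | yes y<z | yes z<N = χ K (triple (fromℕ< x<N) (fromℕ< y<N) (fromℕ< z<N)
          (subst₂ _<_ (sym (Finₚ.toℕ-fromℕ< x<N)) (sym (Finₚ.toℕ-fromℕ< y<N)) x<y)
          (subst₂ _<_ (sym (Finₚ.toℕ-fromℕ< y<N)) (sym (Finₚ.toℕ-fromℕ< z<N)) y<z))
    where
    y<N = <-trans y<z z<N
    x<N = <-trans x<y y<N
  ... | _ | _ | _ = 0F
  colSorted _ = 0F

  triple-cong : ∀ {n} {x x′ y y′ z z′ : Fin n} .{p : x Fin.< y} .{q : y Fin.< z} .{p′ : x′ Fin.< y′} .{q′ : y′ Fin.< z′} →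
    x ≡ x′ → y ≡ y′ → z ≡ z′ → triple x y z p q ≡ triple x′ y′ z′ p′ q′
  triple-cong refl refl refl = refl

  colSorted-triple : ∀ {x y z : Fin N} (p : x Fin.< y) (q : y Fin.< z) →
    colSorted (toℕ x ∷ toℕ y ∷ toℕ z ∷ []) ≡ χ K (triple x y z p q)
  colSorted-triple {x} {y} {z} p q with toℕ x <? toℕ y | toℕ y <? toℕ z | toℕ z <? N
  ... | yes _   | yes _   | yes z<N = cong (χ K) (triple-cong (Finₚ.fromℕ<-toℕ x _) (Finₚ.fromℕ<-toℕ y _) (Finₚ.fromℕ<-toℕ z _))
  ... | yes _   | yes _   | no z≮N  = contradiction (Finₚ.toℕ<n z) z≮N
  ... | yes _   | no y≮z  | _       = contradiction q y≮z
  ... | no x≮y  | _       | _       = contradiction p x≮y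

  abstract
    -- A junk value unless x, y, z are distinct and less than N.
    col : ℕ → ℕ → ℕ → Fin 2
    col x y z = colSorted (sort (x ∷ y ∷ z ∷ []))

    col-swap₁ : ∀ x y z → col x y z ≡ col y x z
    col-swap₁ x y z = cong colSorted (insert-comm x y (z ∷ []))

    col-swap₂ : ∀ x y z → col x y z ≡ col x z y
    col-swap₂ x y z = cong (colSorted ∘ insert x) (insert-comm y z [])

    col-triple : ∀ {x y z : Fin N} (p : x Fin.< y) (q : y Fin.< z) →
      col (toℕ x) (toℕ y) (toℕ z) ≡ χ K (triple x y z p q)
    col-triple {x} {y} {z} p q = trans (cong colSorted sorted) (colSorted-triple p q)
      where
      sorted : sort (toℕ x ∷ toℕ y ∷ toℕ z ∷ []) ≡ toℕ x ∷ toℕ y ∷ toℕ z ∷ []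
      sorted = trans (cong (insert (toℕ x)) (insert-≤ (<⇒≤ q))) (insert-≤ (<⇒≤ p))

  col-rot : ∀ x y z → col x y z ≡ col y z x
  col-rot x y z = trans (col-swap₁ x y z) (col-swap₂ y x z)

  col-swap₃ : ∀ x y z → col x y z ≡ col z y x
  col-swap₃ x y z = trans (col-rot x y z) (col-swap₁ y z x)

  col-cong : ∀ {x x′ y y′ z z′} → x ≡ x′ → y ≡ y′ → z ≡ z′ → col x y z ≡ col x′ y′ z′
  col-cong refl refl refl = refl

  -- Two lists of points induce the same colouring when listed increasingly.
  Compatible : List ℕ → List ℕ → Set
  Compatible l l′ = ∀ {p p′ q q′ r r′} →
    Zip (sort l) (sort l′) p p′ → Zip (sort l) (sort l′) q q′ → Zip (sort l) (sort l′) r r′ →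
    p ≢ q → q ≢ r → p ≢ r → col p q r ≡ col p′ q′ r′

  -- `col` is symmetric, so the six orders of three distinct points reduce to the increasing one.
  compatible-anyOrder : (R : ℕ → ℕ → Set) →
    (∀ {p p′ q q′ r r′} → R p p′ → R q q′ → R r r′ → p < q → q < r → col p q r ≡ col p′ q′ r′) →
    ∀ {p p′ q q′ r r′} → R p p′ → R q q′ → R r r′ → p ≢ q → q ≢ r → p ≢ r → col p q r ≡ col p′ q′ r′
  compatible-anyOrder R h {p} {p′} {q} {q′} {r} {r′} P Q S p≢q q≢r p≢r
    with <-cmp p q | <-cmp q r | <-cmp p r
  ... | tri≈ _ e _ | _ | _ = contradiction e p≢q
  ... | _ | tri≈ _ e _ | _ = contradiction e q≢r
  ... | _ | _ | tri≈ _ e _ = contradiction e p≢r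
  ... | tri< p<q _ _ | tri< q<r _ _ | _ = h P Q S p<q q<r
  ... | tri< p<q _ _ | tri> _ _ r<q | tri< p<r _ _ =
    trans (col-swap₂ p q r) (trans (h P S Q p<r r<q) (col-swap₂ p′ r′ q′))
  ... | tri< p<q _ _ | tri> _ _ r<q | tri> _ _ r<p =
    trans (sym (col-rot r p q)) (trans (h S P Q r<p p<q) (col-rot r′ p′ q′))
  ... | tri> _ _ q<p | tri< q<r _ _ | tri< p<r _ _ =
    trans (col-swap₁ p q r) (trans (h Q P S q<p p<r) (col-swap₁ q′ p′ r′))
  ... | tri> _ _ q<p | tri< q<r _ _ | tri> _ _ r<p =
    trans (col-rot p q r) (trans (h Q S P q<r r<p) (sym (col-rot p′ q′ r′)))
  ... | tri> _ _ q<p | tri> _ _ r<q | _ =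
    trans (col-swap₃ p q r) (trans (h S Q P r<q q<p) (col-swap₃ r′ q′ p′))

record Points (N n : ℕ) (l : List ℕ) : Set where
  field
    size-n   : length l ≡ n
    bounded  : ∀ {a} → a ∈ l → a < N
    distinct : AllPairs _≢_ l

Members : ∀ {ℓ} → Pred 𝒞₃ ℓ → (n : ℕ) → .{{NonZero n}} → Set ℓ
Members X n = Σ (ColoringOn n) λ φ → X (coloring n φ)

-- This expresses |X_n| ≥ G_n without a cardinality. Its negation is the form in which the smallness
-- of X_n enters the combinatorial arguments.
Many : ∀ {ℓ} → Pred 𝒞₃ ℓ → (n : ℕ) → .{{NonZero n}} → Set ℓ
Many X n = Σ (Fin (G n) → Members X n) λ f → ∀ {i j} → proj₁ (f i) ≗ proj₁ (f j) → i ≡ j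

module Induced {ℓ} (X : Pred 𝒞₃ ℓ) (ideal : IsIdeal X) (K : 𝒞₃) (K∈X : X K) (n : ℕ) .{{n≢0 : NonZero n}} where
  open Colour K

  module _ {l : List ℕ} (pts : Points N n l) where
    open Points pts

    private
      s : List ℕ
      s = sort l

      <len : ∀ (i : Fin n) → toℕ i < length s
      <len i = subst (toℕ i <_) (sym (trans (length-sort l) size-n)) (Finₚ.toℕ<n i)

      <N : ∀ (i : Fin n) → at 0 s (toℕ i) < N
      <N i = bounded (∈-sort⁻ l (at-∈ 0 s (<len i)))

    embed : Fin n → Fin N
    embed i = fromℕ< (<N i)

    toℕ-embed : ∀ i → toℕ (embed i) ≡ at 0 s (toℕ i)
    toℕ-embed i = Finₚ.toℕ-fromℕ< (<N i)

    embed-mono : ∀ {i j} → i Fin.< j → embed i Fin.< embed j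
    embed-mono {i} {j} i<j = subst₂ _<_ (sym (toℕ-embed i)) (sym (toℕ-embed j))
      (at-AllPairs 0 (sort-sorted l distinct) i<j (<len j))

    induced : Members X n
    induced = χ K ∘ image embed embed-mono , ideal (embed , embed-mono , λ _ → refl) K∈X

    induced-col : ∀ {i j k} (p : i Fin.< j) (q : j Fin.< k) →
      proj₁ induced (triple i j k p q) ≡ col (at 0 s (toℕ i)) (at 0 s (toℕ j)) (at 0 s (toℕ k))
    induced-col {i} {j} {k} p q =
      trans (sym (col-triple (embed-mono p) (embed-mono q))) (col-cong (toℕ-embed i) (toℕ-embed j) (toℕ-embed k))

  induced-compatible : ∀ {l l′} (pts : Points N n l) (pts′ : Points N n l′) →
    proj₁ (induced pts) ≗ proj₁ (induced pts′) → Compatible l l′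
  induced-compatible {l} {l′} pts pts′ eq = compatible-anyOrder (Zip (sort l) (sort l′)) increasing
    where
    open Points pts
    increasing : ∀ {p p′ q q′ r r′} →
      Zip (sort l) (sort l′) p p′ → Zip (sort l) (sort l′) q q′ → Zip (sort l) (sort l′) r r′ →
      p < q → q < r → col p q r ≡ col p′ q′ r′
    increasing zp zq zr p<q q<r with Zip-position 0 zp | Zip-position 0 zq | Zip-position 0 zr
    ... | i , i< , refl , refl | j , j< , refl , refl | k , k< , refl , refl = result
      where
      <n : ∀ {i} → i < length (sort l) → i < n
      <n = subst (_ <_) (trans (length-sort l) size-n)
      reflect : ∀ {i j} → i < length (sort l) → at 0 (sort l) i < at 0 (sort l) j → i < j
      reflect {i} {j} i< lt with <-cmp i j
      ... | tri< i<j _ _  = i<j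
      ... | tri≈ _ refl _ = contradiction refl (<⇒≢ lt)
      ... | tri> _ _ j<i  = contradiction (at-AllPairs 0 (sort-sorted l distinct) j<i i<) (ℕₚ.<-asym lt)
      f : ∀ {i} → i < length (sort l) → Fin n
      f i< = fromℕ< (<n i<)
      toℕ-f : ∀ {i} (i< : i < length (sort l)) → toℕ (f i<) ≡ i
      toℕ-f i< = Finₚ.toℕ-fromℕ< (<n i<)
      fp : f i< Fin.< f j<
      fp = subst₂ _<_ (sym (toℕ-f i<)) (sym (toℕ-f j<)) (reflect i< p<q)
      fq : f j< Fin.< f k<
      fq = subst₂ _<_ (sym (toℕ-f j<)) (sym (toℕ-f k<)) (reflect j< q<r)
      result : col (at 0 (sort l) i) (at 0 (sort l) j) (at 0 (sort l) k) ≡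
               col (at 0 (sort l′) i) (at 0 (sort l′) j) (at 0 (sort l′) k)
      result = subst₂ _≡_ (position pts) (position pts′) (eq (triple (f i<) (f j<) (f k<) fp fq))
        where
        position : ∀ {l″} (pts″ : Points N n l″) → proj₁ (induced pts″) (triple (f i<) (f j<) (f k<) fp fq) ≡
          col (at 0 (sort l″) i) (at 0 (sort l″) j) (at 0 (sort l″) k)
        position {l″} pts″ = trans (induced-col pts″ fp fq)
          (col-cong (cong (at 0 (sort l″)) (toℕ-f i<)) (cong (at 0 (sort l″)) (toℕ-f j<)) (cong (at 0 (sort l″)) (toℕ-f k<)))

  -- The common scheme of the lower bounds: a list of n points for each word, and a proof that the
  -- induced coloring determines the word.
  manyFromLists : {W : Set} (enum : Fin (G n) → W) → (∀ {i j} → enum i ≡ enum j → i ≡ j) →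
    (l : W → List ℕ) → (∀ w → Points N n (l w)) → (∀ {w w′} → Compatible (l w) (l w′) → w ≡ w′) → Many X n
  manyFromLists enum enum-inj l pts decode =
    (λ i → induced (pts (enum i))) ,
    λ {i} {j} eq → enum-inj (decode (induced-compatible (pts (enum i)) (pts (enum j)) eq))

-- Words counted by the sequence G

weight : ℕ → List Bool → ℕ
weight d []          = 0
weight d (false ∷ w) = suc (weight d w)
weight d (true  ∷ w) = d + weight d w

splitAt-injective : ∀ m {n} {i j : Fin (m + n)} → Fin.splitAt m i ≡ Fin.splitAt m j → i ≡ j
splitAt-injective m {n} {i} {j} eq =
  trans (sym (Finₚ.join-splitAt m n i)) (trans (cong (Fin.join m n) eq) (Finₚ.join-splitAt m n j))

-- Words of short (false) and long (true) letters, counted by G.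
module Words (c l : List Bool) where

  words : ∀ n → Fin (G (suc n)) → List Bool
  words 0 _  = l
  words 1 _  = false ∷ l
  words 2 0F = false ∷ false ∷ l
  words 2 1F = true ∷ []
  words (suc (suc (suc n))) i with Fin.splitAt (G (3 + n)) i
  ... | inj₁ j = false ∷ words (suc (suc n)) j
  ... | inj₂ j = true ∷ (c ++ words n j)

  words-injective : ∀ n {i j} → words n i ≡ words n j → i ≡ j
  words-injective 0 {0F} {0F} _ = refl
  words-injective 1 {0F} {0F} _ = refl
  words-injective 2 {0F} {0F} _ = refl
  words-injective 2 {1F} {1F} _ = refl
  words-injective 2 {0F} {1F} ()
  words-injective 2 {1F} {0F} ()
  words-injective (suc (suc (suc n))) {i} {j} eq = splitAt-injective (G (3 + n)) (same i j eq)
    where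
    same : ∀ i j → words (3 + n) i ≡ words (3 + n) j → Fin.splitAt (G (3 + n)) i ≡ Fin.splitAt (G (3 + n)) j
    same i j eq with Fin.splitAt (G (3 + n)) i | Fin.splitAt (G (3 + n)) j
    ... | inj₁ a | inj₁ b = cong inj₁ (words-injective (suc (suc n)) (Listₚ.∷-injectiveʳ eq))
    ... | inj₂ a | inj₂ b = cong inj₂ (words-injective n (Listₚ.++-cancelˡ c _ _ (Listₚ.∷-injectiveʳ eq)))
    ... | inj₁ a | inj₂ b = contradiction (Listₚ.∷-injectiveˡ eq) λ ()
    ... | inj₂ a | inj₁ b = contradiction (Listₚ.∷-injectiveˡ eq) λ ()

-- All words with letters of length 1 and 2 are counted by the Fibonacci numbers. Here a long letter
-- is followed by a short one unless it ends the word: together they have length 3, which fits the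
-- recursion of G. The parameter `l` shifts the total length: `words₃ n` fills n + 1 places,
-- `words₂ n` only n, leaving one for a fixed point.
open Words (false ∷ []) [] renaming (words to words₂; words-injective to words₂-injective)
open Words [] (false ∷ []) renaming (words to words₃; words-injective to words₃-injective)

words₃-weight : ∀ n i → weight 3 (words₃ n i) ≡ suc n
words₃-weight 0 _  = refl
words₃-weight 1 _  = refl
words₃-weight 2 0F = refl
words₃-weight 2 1F = refl
words₃-weight (suc (suc (suc n))) i with Fin.splitAt (G (3 + n)) i
... | inj₁ j = cong suc (words₃-weight (suc (suc n)) j)
... | inj₂ j = cong (3 +_) (words₃-weight n j)

words₂-weight : ∀ n i → weight 2 (words₂ n i) ≡ n
words₂-weight 0 _  = refl
words₂-weight 1 _  = refl
words₂-weight 2 0F = refl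
words₂-weight 2 1F = refl
words₂-weight (suc (suc (suc n))) i with Fin.splitAt (G (3 + n)) i
... | inj₁ j = cong suc (words₂-weight (suc (suc n)) j)
... | inj₂ j = cong (3 +_) (words₂-weight n j)

-- Strings over a finite alphabet and the growth of G

funToFin-cong : ∀ {m n} {f g : Fin m → Fin n} → f ≗ g → funToFin f ≡ funToFin g
funToFin-cong {zero}  _  = refl
funToFin-cong {suc m} eq = cong₂ Fin.combine (eq 0F) (funToFin-cong (eq ∘ fs))

finToFun-injective : ∀ {m n} {i j : Fin (m ^ n)} → finToFun {m} {n} i ≗ finToFun j → i ≡ j
finToFun-injective {m} {n} {i} {j} eq =
  trans (sym (Finₚ.funToFin-finToFin {n} {m} i)) (trans (funToFin-cong eq) (Finₚ.funToFin-finToFin {n} {m} j))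

funToFin-injective : ∀ {m n} {f g : Fin m → Fin n} → funToFin f ≡ funToFin g → f ≗ g
funToFin-injective {f = f} {g} eq i =
  trans (sym (Finₚ.finToFun-funToFin f i)) (trans (cong (λ k → finToFun k i) eq) (Finₚ.finToFun-funToFin g i))

strings : ∀ {m} k t → m ≤ k ^ t → Fin m → Vec (Fin k) t
strings k t le i = Vec.tabulate (finToFun (Fin.inject≤ i le))

strings-injective : ∀ {m} k t (le : m ≤ k ^ t) {i j} → strings k t le i ≡ strings k t le j → i ≡ j
strings-injective k t le {i} {j} eq = Finₚ.inject≤-injective le le i j (finToFun-injective λ x →
  trans (sym (Vecₚ.lookup∘tabulate _ x)) (trans (cong (λ v → Vec.lookup v x) eq) (Vecₚ.lookup∘tabulate _ x)))

G-mono : ∀ n → G n ≤ G (suc n)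
G-mono 0 = z≤n
G-mono 1 = ≤-refl
G-mono 2 = s≤s z≤n
G-mono (suc (suc (suc n))) = m≤m+n _ _

-- For lists made of two fixed points and k binary choices.
G≤2^ : ∀ k → G (2 + k) ≤ 2 ^ k
G≤2^ 0 = s≤s z≤n
G≤2^ 1 = ≤-refl
G≤2^ 2 = m≤m+n 3 1
G≤2^ (suc (suc (suc k))) = begin
  G (4 + k) + G (2 + k)     ≤⟨ ℕₚ.+-mono-≤ (G≤2^ (suc (suc k))) (≤-trans (G-mono (2 + k)) (≤-trans (G-mono (3 + k)) (G≤2^ (suc (suc k))))) ⟩
  2 ^ (2 + k) + 2 ^ (2 + k) ≡⟨ cong (2 ^ (2 + k) +_) (sym (ℕₚ.+-identityʳ _)) ⟩
  2 ^ (3 + k)               ∎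
  where open ℕₚ.≤-Reasoning

-- The recursion unfolds the left side into six terms, none of which exceeds `G (3 + k)`.
G-step₄ : ∀ k → G (7 + k) ≤ 6 * G (3 + k)
G-step₄ k = begin
  (((g + G (1 + k)) + G (2 + k)) + g) + (g + G (1 + k))
    ≤⟨ ℕₚ.+-mono-≤ (ℕₚ.+-monoˡ-≤ g (ℕₚ.+-mono-≤ (ℕₚ.+-monoʳ-≤ g l₁) (G-mono (2 + k)))) (ℕₚ.+-monoʳ-≤ g l₁) ⟩
  (((g + g) + g) + g) + (g + g)
    ≡⟨ solve 1 (λ x → (((x :+ x) :+ x) :+ x) :+ (x :+ x) := con 6 :* x) refl g ⟩
  6 * g ∎
  where
  open ℕₚ.≤-Reasoning
  open +-*-Solver
  g  = G (3 + k)
  l₁ = ≤-trans (G-mono (1 + k)) (G-mono (2 + k))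

-- One point is fixed; the other n - 1 form t groups of four and r single points. Four base cases
-- cover the residues modulo 4, the first being G_23 = 4023 ≤ 7776 = 6^5.
G≤6^ : ∀ k → ∃₂ λ t r → 23 + k ≡ suc (4 * t + r) × G (23 + k) ≤ 6 ^ t
G≤6^ 0 = 5 , 2 , refl , ℕₚ.≤ᵇ⇒≤ _ _ _
G≤6^ 1 = 5 , 3 , refl , ℕₚ.≤ᵇ⇒≤ _ _ _
G≤6^ 2 = 6 , 0 , refl , ℕₚ.≤ᵇ⇒≤ _ _ _
G≤6^ 3 = 6 , 1 , refl , ℕₚ.≤ᵇ⇒≤ _ _ _
G≤6^ (suc (suc (suc (suc k)))) with G≤6^ k
... | t , r , e , le = suc t , r ,
  trans (cong (4 +_) e) (cong (λ x → suc (x + r)) (sym (ℕₚ.*-suc 4 t))) ,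
  ≤-trans (G-step₄ (20 + k)) (ℕₚ.*-monoʳ-≤ 6 le)

-- Large families of induced colorings

-- The order of `p i` and `q i` is left open; it is recorded separately where it matters.
Interleaved : Bool → (ℕ → ℕ) → (ℕ → ℕ) → ℕ → Set
Interleaved d p q w = ∀ {i j} → i < j → j < w → (p i <[ d ] p j × p i <[ d ] q j) × (q i <[ d ] p j × q i <[ d ] q j)

Monotone : Bool → (ℕ → ℕ) → ℕ → Set
Monotone d p w = ∀ {i j} → i < j → j < w → p i <[ d ] p j

Side : Bool → ℕ → (ℕ → ℕ) → ℕ → Set
Side β z p w = ∀ {i} → i < w → z <[ β ] p i

Bounded : ℕ → (ℕ → ℕ) → ℕ → Set
Bounded N p w = ∀ {i} → i < w → p i < N

<[]⇒≢ : ∀ d {a b} → a <[ d ] b → a ≢ b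
<[]⇒≢ true  lt = <⇒≢ lt
<[]⇒≢ false lt = >⇒≢ lt

enum₃ : ∀ n → .{{NonZero n}} → ∃ λ (e : Fin (G n) → List Bool) →
  (∀ {i j} → e i ≡ e j → i ≡ j) × (∀ i → weight 3 (e i) ≡ n)
enum₃ (suc n) = words₃ n , words₃-injective n , words₃-weight n

enum₂ : ∀ n → .{{NonZero n}} → ∃ λ (e : Fin (G n) → List Bool) →
  (∀ {i j} → e i ≡ e j → i ≡ j) × (∀ i → suc (weight 2 (e i)) ≡ n)
enum₂ (suc n) = words₂ n , words₂-injective n , λ i → cong suc (words₂-weight n i)

-- Digits: six colour patterns from two pairs of indices

κ : Fin 2 → Fin 2 → Fin 2 → ℕ → ℕ → Fin 2
κ L E R i j = if i <ᵇ j then L else if j <ᵇ i then R else E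

κ-shift : ∀ L E R b i j → κ L E R (b + i) (b + j) ≡ κ L E R i j
κ-shift L E R zero    i j = refl
κ-shift L E R (suc b) i j = κ-shift L E R b i j

-- Two points from each of two separated tracks, all within four consecutive
-- indices, realise six different colour patterns.
record Digits (L E R : Fin 2) : Set where
  field
    x₁ x₂ y₁ y₂ : Fin 6 → ℕ
    x₁<x₂ : ∀ d → x₁ d < x₂ d
    x₂<4  : ∀ d → x₂ d < 4
    y₁<y₂ : ∀ d → y₁ d < y₂ d
    y₂<4  : ∀ d → y₂ d < 4
    decode : ∀ d d′ → κ L E R (x₁ d) (y₁ d) ≡ κ L E R (x₁ d′) (y₁ d′) → κ L E R (x₁ d) (y₂ d) ≡ κ L E R (x₁ d′) (y₂ d′) →
                      κ L E R (x₂ d) (y₁ d) ≡ κ L E R (x₂ d′) (y₁ d′) → κ L E R (x₂ d) (y₂ d) ≡ κ L E R (x₂ d′) (y₂ d′) → d ≡ d′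

-- The implicit arguments let evaluation check the bounds of the six columns and the distinctness of
-- their patterns.
tableDigits : (L E R : Fin 2) (x₁ x₂ y₁ y₂ : Vec ℕ 6) →
  {True (Finₚ.all? λ d → (Vec.lookup x₁ d <? Vec.lookup x₂ d) ×-dec (Vec.lookup x₂ d <? 4) ×-dec
                         (Vec.lookup y₁ d <? Vec.lookup y₂ d) ×-dec (Vec.lookup y₂ d <? 4))} →
  {True (Finₚ.all? λ d → Finₚ.all? λ d′ →
    (κ L E R (Vec.lookup x₁ d) (Vec.lookup y₁ d) Finₚ.≟ κ L E R (Vec.lookup x₁ d′) (Vec.lookup y₁ d′)) →-dec
    ((κ L E R (Vec.lookup x₁ d) (Vec.lookup y₂ d) Finₚ.≟ κ L E R (Vec.lookup x₁ d′) (Vec.lookup y₂ d′)) →-dec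
    ((κ L E R (Vec.lookup x₂ d) (Vec.lookup y₁ d) Finₚ.≟ κ L E R (Vec.lookup x₂ d′) (Vec.lookup y₁ d′)) →-dec
    ((κ L E R (Vec.lookup x₂ d) (Vec.lookup y₂ d) Finₚ.≟ κ L E R (Vec.lookup x₂ d′) (Vec.lookup y₂ d′)) →-dec
    (d Finₚ.≟ d′)))))} → Digits L E R
tableDigits L E R x₁ x₂ y₁ y₂ {ok} {sep} = record
  { x₁ = Vec.lookup x₁ ; x₂ = Vec.lookup x₂ ; y₁ = Vec.lookup y₁ ; y₂ = Vec.lookup y₂
  ; x₁<x₂ = λ d → proj₁ (toWitness ok d) ; x₂<4 = λ d → proj₁ (proj₂ (toWitness ok d))
  ; y₁<y₂ = λ d → proj₁ (proj₂ (proj₂ (toWitness ok d))) ; y₂<4 = λ d → proj₂ (proj₂ (proj₂ (toWitness ok d)))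
  ; decode = toWitness sep
  }

module Interleavings where
  x₁ x₂ y₁ y₂ : Vec ℕ 6
  -- Each column divides 0, 1, 2, 3 into two x's and two y's. No indices coincide, so a colour tells
  -- which of two indices is smaller.
  x₁ = 0 ∷ 0 ∷ 0 ∷ 1 ∷ 1 ∷ 2 ∷ []
  x₂ = 1 ∷ 2 ∷ 3 ∷ 2 ∷ 3 ∷ 3 ∷ []
  y₁ = 2 ∷ 1 ∷ 1 ∷ 0 ∷ 0 ∷ 0 ∷ []
  y₂ = 3 ∷ 3 ∷ 2 ∷ 3 ∷ 2 ∷ 1 ∷ []

  -- If L ≢ R, all six interleavings xxyy, xyxy, … have different patterns.
  interleavings : (L E R : Fin 2) → L ≢ R → Digits L E R
  interleavings 0F 0F 0F ne = contradiction refl ne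
  interleavings 0F 1F 0F ne = contradiction refl ne
  interleavings 1F 0F 1F ne = contradiction refl ne
  interleavings 1F 1F 1F ne = contradiction refl ne
  interleavings 0F 0F 1F ne = tableDigits _ _ _ x₁ x₂ y₁ y₂
  interleavings 0F 1F 1F ne = tableDigits _ _ _ x₁ x₂ y₁ y₂
  interleavings 1F 0F 0F ne = tableDigits _ _ _ x₁ x₂ y₁ y₂
  interleavings 1F 1F 0F ne = tableDigits _ _ _ x₁ x₂ y₁ y₂

module Matchings where
  x₁ x₂ y₁ y₂ : Vec ℕ 6
  -- The columns realise in turn: no coincidence, x₁ = y₁, x₁ = y₂, x₂ = y₁, x₂ = y₂, and x₁ = y₁
  -- with x₂ = y₂. These are all order-preserving partial matchings of two pairs.
  x₁ = 0 ∷ 0 ∷ 1 ∷ 0 ∷ 0 ∷ 0 ∷ []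
  x₂ = 1 ∷ 1 ∷ 2 ∷ 1 ∷ 2 ∷ 1 ∷ []
  y₁ = 2 ∷ 0 ∷ 0 ∷ 1 ∷ 1 ∷ 0 ∷ []
  y₂ = 3 ∷ 2 ∷ 1 ∷ 2 ∷ 2 ∷ 1 ∷ []

  -- If L ≡ R ≢ E, the pattern shows which indices coincide.
  matchings : (L E R : Fin 2) → L ≡ R → L ≢ E → Digits L E R
  matchings 0F 0F 0F _ ne = contradiction refl ne
  matchings 1F 1F 1F _ ne = contradiction refl ne
  matchings 0F 1F 0F _ ne = tableDigits _ _ _ x₁ x₂ y₁ y₂
  matchings 1F 0F 1F _ ne = tableDigits _ _ _ x₁ x₂ y₁ y₂

digits : (L E R : Fin 2) → ¬ (L ≡ E × E ≡ R) → Digits L E R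
digits L E R ne with L Finₚ.≟ R
... | no  L≢R = Interleavings.interleavings L E R L≢R
... | yes L≡R = Matchings.matchings L E R L≡R (λ L≡E → ne (L≡E , trans (sym L≡E) L≡R))

upFrom : ℕ → ℕ → List ℕ
upFrom b zero    = []
upFrom b (suc r) = b ∷ upFrom (suc b) r

-- Each digit takes two of four consecutive indices. The r indices at the end carry no information;
-- they bring the number of points up to n.
indices : ∀ {t} → (Fin 6 → ℕ) → (Fin 6 → ℕ) → ℕ → ℕ → Vec (Fin 6) t → List ℕ
indices f g r b []      = upFrom b r
indices f g r b (d ∷ v) = b + f d ∷ b + g d ∷ indices f g r (4 + b) v

length-indices : ∀ {t} f g r b (v : Vec (Fin 6) t) → length (indices f g r b v) ≡ t * 2 + r
length-indices f g r b [] = go b r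
  where
  go : ∀ b r → length (upFrom b r) ≡ r
  go b zero    = refl
  go b (suc r) = cong suc (go (suc b) r)
length-indices f g r b (d ∷ v) = cong (2 +_) (length-indices f g r (4 + b) v)

upFrom-∈ : ∀ b r {i} → i ∈ upFrom b r → b ≤ i × i < b + r
upFrom-∈ b (suc r) (here refl) = ≤-refl , ℕₚ.m<m+n b z<s
upFrom-∈ b (suc r) {i} (there i∈) with upFrom-∈ (suc b) r i∈
... | lo , hi = <⇒≤ lo , subst (i <_) (sym (+-suc b r)) hi

module _ {f g : Fin 6 → ℕ} (f<g : ∀ d → f d < g d) (g<4 : ∀ d → g d < 4) where

  indices-∈ : ∀ {t} r b (v : Vec (Fin 6) t) {i} → i ∈ indices f g r b v → b ≤ i × i < b + (t * 4 + r)
  indices-∈ r b [] i∈ = upFrom-∈ b r i∈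
  indices-∈ {suc t} r b (d ∷ v) (here refl) =
    m≤m+n b _ , ℕₚ.+-monoʳ-< b (≤-trans (<-trans (f<g d) (g<4 d)) (m≤m+n 4 (t * 4 + r)))
  indices-∈ {suc t} r b (d ∷ v) (there (here refl)) =
    m≤m+n b _ , ℕₚ.+-monoʳ-< b (≤-trans (g<4 d) (m≤m+n 4 (t * 4 + r)))
  indices-∈ {suc t} r b (d ∷ v) {i} (there (there i∈)) with indices-∈ r (4 + b) v i∈
  ... | lo , hi = ≤-trans (m≤n+m b 4) lo ,
    subst (i <_) (trans (cong (_+ (t * 4 + r)) (ℕₚ.+-comm 4 b)) (ℕₚ.+-assoc b 4 _)) hi

  indices-mono : ∀ {t} r b (v : Vec (Fin 6) t) → AllPairs _<_ (indices f g r b v)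
  indices-mono r b [] = upFrom-mono b r
    where
    upFrom-mono : ∀ b r → AllPairs _<_ (upFrom b r)
    upFrom-mono b zero    = []
    upFrom-mono b (suc r) = All.tabulate (λ i∈ → proj₁ (upFrom-∈ (suc b) r i∈)) ∷ upFrom-mono (suc b) r
  indices-mono r b (d ∷ v) =
    (ℕₚ.+-monoʳ-< b (f<g d) ∷ All.tabulate (λ i∈ → below (<-trans (f<g d) (g<4 d)) i∈)) ∷
    All.tabulate (λ i∈ → below (g<4 d) i∈) ∷ indices-mono r (4 + b) v
    where
    below : ∀ {x i} → x < 4 → i ∈ indices f g r (4 + b) v → b + x < i
    below x<4 i∈ = ≤-trans (ℕₚ.+-monoʳ-< b x<4) (≤-trans (≤-reflexive (ℕₚ.+-comm b 4)) (proj₁ (indices-∈ r (4 + b) v i∈)))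

Zip-map : ∀ {A B : Set} (f : A → B) {xs ys a b} → Zip xs ys a b → Zip (map f xs) (map f ys) (f a) (f b)
Zip-map f here      = here
Zip-map f (there z) = there (Zip-map f z)

-- Counting from two fixed points and from one

module Families {ℓ} (X : Pred 𝒞₃ ℓ) (ideal : IsIdeal X) (n : ℕ) .{{n≢0 : NonZero n}} (23≤n : 23 ≤ n)
  (few : ¬ Many X n) (K : 𝒞₃) (K∈X : X K) where

  open Colour K
  open Induced X ideal K K∈X n

  ¬injective : {W : Set} (enum : Fin (G n) → W) → (∀ {i j} → enum i ≡ enum j → i ≡ j) →
    (l : W → List ℕ) → (∀ w → Points N n (l w)) → ¬ (∀ {w w′} → Compatible (l w) (l w′) → w ≡ w′)
  ¬injective enum inj l pts decode = few (manyFromLists enum inj l pts decode)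

  -- `Compatible` refers to sorted lists; between order isomorphic lists the colours may be compared
  -- position by position before sorting.
  compatible-zip : ∀ {l l′} → OrderIso l l′ → Compatible l l′ → ∀ {p p′ q q′ r r′} →
    Zip l l′ p p′ → Zip l l′ q q′ → Zip l l′ r r′ → p ≢ q → q ≢ r → p ≢ r → col p q r ≡ col p′ q′ r′
  compatible-zip o c zp zq zr = c (proj₁ (sort-zip o) zp) (proj₁ (sort-zip o) zq) (proj₁ (sort-zip o) zr)

  -- At each index a bit selects the point of `p` or of `q`. As z₁ and z₂ see both sequences on the
  -- same side, all selections are order isomorphic, and if c₁ ≢ c₂ the colours seen from z₁ and z₂
  -- spell out the bits.
  module TwoFixed (z₁ z₂ : ℕ) (p q : ℕ → ℕ) (d β₁ β₂ : Bool) (w : ℕ) (n≤w : n ≤ 2 + w)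
    (z₁<N : z₁ < N) (z₂<N : z₂ < N) (z₁≢z₂ : z₁ ≢ z₂)
    (inter : Interleaved d p q w) (p<N : Bounded N p w) (q<N : Bounded N q w)
    (z₁p : Side β₁ z₁ p w) (z₁q : Side β₁ z₁ q w) (z₂p : Side β₂ z₂ p w) (z₂q : Side β₂ z₂ q w)
    (c₁ c₂ : Fin 2) (colp : ∀ {i} → i < w → col z₁ z₂ (p i) ≡ c₁) (colq : ∀ {i} → i < w → col z₁ z₂ (q i) ≡ c₂)
    where

    private
      pick : Fin 2 → ℕ → ℕ
      pick 0F = p
      pick 1F = q

      c : Fin 2 → Fin 2
      c 0F = c₁
      c 1F = c₂

      pick<N : ∀ b {i} → i < w → pick b i < N
      pick<N 0F = p<N
      pick<N 1F = q<N

      pick-side₁ : ∀ b → Side β₁ z₁ (pick b) w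
      pick-side₁ 0F = z₁p
      pick-side₁ 1F = z₁q

      pick-side₂ : ∀ b → Side β₂ z₂ (pick b) w
      pick-side₂ 0F = z₂p
      pick-side₂ 1F = z₂q

      pick-col : ∀ b {i} → i < w → col z₁ z₂ (pick b i) ≡ c b
      pick-col 0F = colp
      pick-col 1F = colq

      pick-mono : ∀ b b′ {i j} → i < j → j < w → pick b i <[ d ] pick b′ j
      pick-mono 0F 0F i<j j<w = proj₁ (proj₁ (inter i<j j<w))
      pick-mono 0F 1F i<j j<w = proj₂ (proj₁ (inter i<j j<w))
      pick-mono 1F 0F i<j j<w = proj₁ (proj₂ (inter i<j j<w))
      pick-mono 1F 1F i<j j<w = proj₂ (proj₂ (inter i<j j<w))

      chain : ∀ {k} → ℕ → Vec (Fin 2) k → List ℕ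
      chain i []      = []
      chain i (b ∷ v) = pick b i ∷ chain (suc i) v

      length-chain : ∀ {k} i (v : Vec (Fin 2) k) → length (chain i v) ≡ k
      length-chain i []      = refl
      length-chain i (b ∷ v) = cong suc (length-chain (suc i) v)

      chain-∈ : ∀ {k} i (v : Vec (Fin 2) k) {a} → a ∈ chain i v → ∃₂ λ b j → a ≡ pick b j × i ≤ j × j < i + k
      chain-∈ {suc k} i (b ∷ v) (here refl) = b , i , refl , ≤-refl , ℕₚ.m<m+n i z<s
      chain-∈ {suc k} i (b ∷ v) (there a∈) with chain-∈ (suc i) v a∈
      ... | b′ , j , e , lo , hi = b′ , j , e , <⇒≤ lo , subst (j <_) (sym (+-suc i k)) hi

      chain-mono : ∀ {k} i (v : Vec (Fin 2) k) → i + k ≤ w → AllPairs _<[ d ]_ (chain i v)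
      chain-mono i [] _ = []
      chain-mono {suc k} i (b ∷ v) le = All.tabulate above ∷ chain-mono (suc i) v le′
        where
        le′ = subst (_≤ w) (+-suc i k) le
        above : ∀ {a} → a ∈ chain (suc i) v → pick b i <[ d ] a
        above a∈ with chain-∈ (suc i) v a∈
        ... | b′ , j , refl , lo , hi = pick-mono b b′ lo (≤-trans hi le′)

      chain-decode : c₁ ≢ c₂ → ∀ {k} i (v v′ : Vec (Fin 2) k) → i + k ≤ w →
        (∀ {a a′} → Zip (chain i v) (chain i v′) a a′ → col z₁ z₂ a ≡ col z₁ z₂ a′) → v ≡ v′
      chain-decode ne i [] [] _ _ = refl
      chain-decode ne {suc k} i (b ∷ v) (b′ ∷ v′) le h =
        cong₂ _∷_ (c-inj b b′ (trans (sym (pick-col b i<w)) (trans (h here) (pick-col b′ i<w))))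
                  (chain-decode ne (suc i) v v′ le′ (λ z → h (there z)))
        where
        le′ = subst (_≤ w) (+-suc i k) le
        i<w = ≤-trans (s≤s (m≤m+n i k)) le′
        c-inj : ∀ b b′ → c b ≡ c b′ → b ≡ b′
        c-inj 0F 0F _ = refl
        c-inj 1F 1F _ = refl
        c-inj 0F 1F e = contradiction e ne
        c-inj 1F 0F e = contradiction (sym e) ne

      points : ∀ {k} → Vec (Fin 2) k → List ℕ
      points v = z₁ ∷ z₂ ∷ chain 0 v

      orderIso : ∀ {k} → k ≤ w → (v v′ : Vec (Fin 2) k) → OrderIso (points v) (points v′)
      orderIso {k} k≤w v v′ = first ∷ second ∷
        OrderIso-monotone d (trans (length-chain 0 v) (sym (length-chain 0 v′))) (chain-mono 0 v k≤w) (chain-mono 0 v′ k≤w)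
        where
        onSide : ∀ β z → (∀ b → Side β z (pick b) w) → ∀ v {a} → a ∈ chain {k} 0 v → z <[ β ] a
        onSide β z s v a∈ with chain-∈ 0 v a∈
        ... | b , j , refl , _ , hi = s b (≤-trans hi k≤w)
        second : ∀ {b b′} → Zip (chain 0 v) (chain 0 v′) b b′ → SameOrder z₂ z₂ b b′
        second z = sameOrder-dir β₂ (onSide β₂ z₂ pick-side₂ v (Zip-∈ˡ z)) (onSide β₂ z₂ pick-side₂ v′ (Zip-∈ʳ z))
        first : ∀ {b b′} → Zip (z₂ ∷ chain 0 v) (z₂ ∷ chain 0 v′) b b′ → SameOrder z₁ z₁ b b′
        first here with <-cmp z₁ z₂
        ... | tri< lt _ _ = inj₁ (lt , lt)
        ... | tri≈ _ e _  = contradiction e z₁≢z₂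
        ... | tri> _ _ lt = inj₂ (lt , lt)
        first (there z) = sameOrder-dir β₁ (onSide β₁ z₁ pick-side₁ v (Zip-∈ˡ z)) (onSide β₁ z₁ pick-side₁ v′ (Zip-∈ʳ z))

      isPoints : ∀ {k} → k ≤ w → n ≡ 2 + k → (v : Vec (Fin 2) k) → Points N n (points v)
      isPoints k≤w e v = record
        { size-n   = trans (cong (2 +_) (length-chain 0 v)) (sym e)
        ; bounded  = λ { (here refl) → z₁<N ; (there (here refl)) → z₂<N ; (there (there a∈)) → chain<N a∈ }
        ; distinct = OrderIso-distinct (orderIso k≤w v v)
        }
        where
        chain<N : ∀ {a} → a ∈ chain 0 v → a < N
        chain<N a∈ with chain-∈ 0 v a∈
        ... | b , j , refl , _ , hi = pick<N b (≤-trans hi k≤w)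

    sameColour : c₁ ≡ c₂
    sameColour with c₁ Finₚ.≟ c₂
    ... | yes e  = e
    ... | no  ne = ⊥-elim (¬injective (strings 2 k G≤) (strings-injective 2 k G≤) points (isPoints k≤w n≡) decode)
      where
      k = n ∸ 2
      n≡ : n ≡ 2 + k
      n≡ = sym (ℕₚ.m+[n∸m]≡n (≤-trans (s≤s (s≤s z≤n)) 23≤n))
      k≤w : k ≤ w
      k≤w = ℕₚ.+-cancelˡ-≤ 2 k w (subst (_≤ 2 + w) n≡ n≤w)
      G≤ : G n ≤ 2 ^ k
      G≤ = subst (λ m → G m ≤ 2 ^ k) (sym n≡) (G≤2^ k)
      decode : ∀ {v v′ : Vec (Fin 2) k} → Compatible (points v) (points v′) → v ≡ v′
      decode {v} {v′} compat = chain-decode ne 0 v v′ k≤w λ z →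
        compatible-zip (orderIso k≤w v v′) compat here (there here) (there (there z))
          z₁≢z₂ (away z₂ β₂ pick-side₂ z) (away z₁ β₁ pick-side₁ z)
        where
        away : ∀ z₀ β → (∀ b → Side β z₀ (pick b) w) → ∀ {a a′} → Zip (chain 0 v) (chain 0 v′) a a′ → z₀ ≢ a
        away z₀ β s z with chain-∈ 0 v (Zip-∈ˡ z)
        ... | b , j , refl , _ , hi = <[]⇒≢ β (s b (≤-trans hi k≤w))

  -- A short letter takes `p i`, a long one `p i` and `q i`. The colours of z, `q i`, `p j` with i <
  -- j stay free, because words are told apart by pairs that begin in `p`.
  module Pairs (z : ℕ) (p q : ℕ → ℕ) (d β : Bool) (z<N : z < N)
    (inter : Interleaved d p q n) (p<q : ∀ {i} → i < n → p i <[ d ] q i)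
    (p<N : Bounded N p n) (q<N : Bounded N q n) (zp : Side β z p n) (zq : Side β z q n) (c e : Fin 2)
    (cpp : ∀ {i j} → i < j → j < n → col z (p i) (p j) ≡ c) (cpq : ∀ {i j} → i < j → j < n → col z (p i) (q j) ≡ c)
    (cpq= : ∀ {i} → i < n → col z (p i) (q i) ≡ e) where

    private
      blocks : ℕ → List Bool → List ℕ
      blocks i []          = []
      blocks i (false ∷ w) = p i ∷ blocks (suc i) w
      blocks i (true  ∷ w) = p i ∷ q i ∷ blocks (suc i) w

      length-blocks : ∀ i w → length (blocks i w) ≡ weight 2 w
      length-blocks i []          = refl
      length-blocks i (false ∷ w) = cong suc (length-blocks (suc i) w)
      length-blocks i (true  ∷ w) = cong (2 +_) (length-blocks (suc i) w)

      tail-bound : ∀ i b w → i + weight 2 (b ∷ w) ≤ n → suc i + weight 2 w ≤ n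
      tail-bound i false w le = subst (_≤ n) (+-suc i _) le
      tail-bound i true  w le = <⇒≤ (subst (_≤ n) (trans (+-suc i _) (cong suc (+-suc i _))) le)

      head-bound : ∀ i b w → i + weight 2 (b ∷ w) ≤ n → i < n
      head-bound i b w le = ≤-trans (s≤s (m≤m+n i _)) (tail-bound i b w le)

      blocks-∈ : ∀ i w {a} → i + weight 2 w ≤ n → a ∈ blocks i w → ∃ λ j → i ≤ j × j < n × (a ≡ p j ⊎ a ≡ q j)
      blocks-∈ i (false ∷ w) le (here e)          = i , ≤-refl , head-bound i false w le , inj₁ e
      blocks-∈ i (true  ∷ w) le (here e)          = i , ≤-refl , head-bound i true w le , inj₁ e
      blocks-∈ i (true  ∷ w) le (there (here e))  = i , ≤-refl , head-bound i true w le , inj₂ e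
      blocks-∈ i (false ∷ w) le (there a∈)         with blocks-∈ (suc i) w (tail-bound i false w le) a∈
      ... | j , lo , hi , e = j , <⇒≤ lo , hi , e
      blocks-∈ i (true  ∷ w) le (there (there a∈)) with blocks-∈ (suc i) w (tail-bound i true w le) a∈
      ... | j , lo , hi , e = j , <⇒≤ lo , hi , e

      record Later (i a : ℕ) : Set where
        field
          p-before : p i <[ d ] a
          q-before : q i <[ d ] a
          p-col    : col z (p i) a ≡ c

      later : ∀ i w {a} → suc i + weight 2 w ≤ n → a ∈ blocks (suc i) w → Later i a
      later i w le a∈ with blocks-∈ (suc i) w le a∈
      ... | j , lo , hi , inj₁ refl = record
        { p-before = proj₁ (proj₁ (inter lo hi)) ; q-before = proj₁ (proj₂ (inter lo hi)) ; p-col = cpp lo hi }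
      ... | j , lo , hi , inj₂ refl = record
        { p-before = proj₂ (proj₁ (inter lo hi)) ; q-before = proj₂ (proj₂ (inter lo hi)) ; p-col = cpq lo hi }

      blocks-mono : ∀ i w → i + weight 2 w ≤ n → AllPairs _<[ d ]_ (blocks i w)
      blocks-mono i []          le = []
      blocks-mono i (false ∷ w) le =
        All.tabulate (λ a∈ → Later.p-before (later i w (tail-bound i false w le) a∈)) ∷
        blocks-mono (suc i) w (tail-bound i false w le)
      blocks-mono i (true  ∷ w) le =
        (p<q (head-bound i true w le) ∷ All.tabulate (λ a∈ → Later.p-before (later i w (tail-bound i true w le) a∈))) ∷
        All.tabulate (λ a∈ → Later.q-before (later i w (tail-bound i true w le) a∈)) ∷
        blocks-mono (suc i) w (tail-bound i true w le)

      Agree : List ℕ → List ℕ → Set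
      Agree l l′ = ∀ {a a′ b b′} → Zip l l′ a a′ → Zip l l′ b b′ → a ≢ b → a′ ≢ b′ → col z a b ≡ col z a′ b′

      -- After `p i` comes `q i` in one list and a point of greater index in the other; seen from z
      -- and `p i` they have the colours e and c.
      mismatch : c ≢ e → ∀ i w w′ → weight 2 (true ∷ w) ≡ weight 2 (false ∷ w′) → i + weight 2 (true ∷ w) ≤ n →
        ¬ Agree (blocks i (true ∷ w)) (blocks i (false ∷ w′))
      mismatch ne i w w′ eq le agree
        with Zip-image {xs = q i ∷ blocks (suc i) w} {ys = blocks (suc i) w′}
               (≤-reflexive (suc-injective (trans (cong (2 +_) (length-blocks (suc i) w))
                 (trans eq (cong suc (sym (length-blocks (suc i) w′))))))) (here refl)
      ... | a , zip = ne (trans (sym (Later.p-col lat)) (trans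
          (sym (agree here (there zip) (<[]⇒≢ d (p<q (head-bound i true w le))) (<[]⇒≢ d (Later.p-before lat))))
          (cpq= (head-bound i true w le))))
        where
        lat : Later i a
        lat = later i w′ (tail-bound i false w′ (subst (λ x → i + x ≤ n) eq le)) (Zip-∈ʳ zip)

      decode : c ≢ e → ∀ i w w′ → weight 2 w ≡ weight 2 w′ → i + weight 2 w ≤ n → Agree (blocks i w) (blocks i w′) → w ≡ w′
      decode ne i []          []           eq le agree = refl
      decode ne i []          (false ∷ w′) ()
      decode ne i []          (true  ∷ w′) ()
      decode ne i (false ∷ w) []           ()
      decode ne i (true  ∷ w) []           ()
      decode ne i (false ∷ w) (false ∷ w′) eq le agree = cong (false ∷_)
        (decode ne (suc i) w w′ (suc-injective eq) (tail-bound i false w le) (λ za zb → agree (there za) (there zb)))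
      decode ne i (true  ∷ w) (true  ∷ w′) eq le agree = cong (true ∷_)
        (decode ne (suc i) w w′ (ℕₚ.+-cancelˡ-≡ 2 _ _ eq) (tail-bound i true w le)
          (λ za zb → agree (there (there za)) (there (there zb))))
      decode ne i (true  ∷ w) (false ∷ w′) eq le agree = contradiction (λ {a a′ b b′} → agree {a} {a′} {b} {b′}) (mismatch ne i w w′ eq le)
      decode ne i (false ∷ w) (true  ∷ w′) eq le agree =
        contradiction (λ {a} {a′} {b} {b′} za zb a≢b a′≢b′ → sym (agree (Zip-sym za) (Zip-sym zb) a′≢b′ a≢b))
                      (mismatch ne i w′ w (sym eq) (subst (λ x → i + x ≤ n) eq le))

      Word : Set
      Word = ∃ λ w → suc (weight 2 w) ≡ n

      points : Word → List ℕ
      points (w , _) = z ∷ blocks 0 w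

      weight≤n : ((w , _) : Word) → weight 2 w ≤ n
      weight≤n (w , eq) = ≤-trans (n≤1+n _) (≤-reflexive eq)

      onSide : ∀ w {a} → weight 2 w ≤ n → a ∈ blocks 0 w → z <[ β ] a
      onSide w le a∈ with blocks-∈ 0 w le a∈
      ... | j , _ , hi , inj₁ refl = zp hi
      ... | j , _ , hi , inj₂ refl = zq hi

      orderIso : ∀ w w′ → OrderIso (points w) (points w′)
      orderIso W@(w , eq) W′@(w′ , eq′) =
        (λ zip → sameOrder-dir β (onSide w (weight≤n W) (Zip-∈ˡ zip)) (onSide w′ (weight≤n W′) (Zip-∈ʳ zip))) ∷
        OrderIso-monotone d (trans (length-blocks 0 w) (trans (suc-injective (trans eq (sym eq′))) (sym (length-blocks 0 w′))))
          (blocks-mono 0 w (weight≤n W)) (blocks-mono 0 w′ (weight≤n W′))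

      isPoints : ∀ w → Points N n (points w)
      isPoints W@(w , eq) = record
        { size-n = trans (cong suc (length-blocks 0 w)) eq
        ; bounded = λ { (here refl) → z<N ; (there a∈) → blocks<N a∈ }
        ; distinct = OrderIso-distinct (orderIso W W)
        }
        where
        blocks<N : ∀ {a} → a ∈ blocks 0 w → a < N
        blocks<N a∈ with blocks-∈ 0 w (weight≤n W) a∈
        ... | j , _ , hi , inj₁ refl = p<N hi
        ... | j , _ , hi , inj₂ refl = q<N hi

    sameColour : c ≡ e
    sameColour with c Finₚ.≟ e
    ... | yes eq = eq
    ... | no  ne with enum₂ n
    ...   | enum , inj , wt = ⊥-elim (¬injective (λ i → enum i , wt i) (λ eq → inj (cong proj₁ eq)) points isPoints
      λ {W} {W′} → decoded {W} {W′})
      where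
      decoded : ∀ {W W′} → Compatible (points W) (points W′) → W ≡ W′
      decoded {W@(w , eq)} {W′@(w′ , eq′)} compat = word-ext (decode ne 0 w w′ (suc-injective (trans eq (sym eq′))) (weight≤n W)
          λ za zb a≢b _ → compatible-zip (orderIso W W′) compat here (there za) (there zb)
            (<[]⇒≢ β (onSide w (weight≤n W) (Zip-∈ˡ za))) a≢b (<[]⇒≢ β (onSide w (weight≤n W) (Zip-∈ˡ zb))))
        where
        word-ext : ∀ {w w′} {eq : suc (weight 2 w) ≡ n} {eq′ : suc (weight 2 w′) ≡ n} → w ≡ w′ → _≡_ {A = Word} (w , eq) (w′ , eq′)
        word-ext {eq = eq} {eq′} refl = cong (_ ,_) (ℕₚ.≡-irrelevant eq eq′)

  -- Whatever indices are taken from separated sequences, the order type of the points is the same.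
  -- So the relative position of the two index sets is free to encode a word of digits.
  module SeparatedTracks (z : ℕ) (p q : ℕ → ℕ) (d₁ d₂ δ β₁ β₂ : Bool) (z<N : z < N)
    (pm : Monotone d₁ p n) (qm : Monotone d₂ q n) (p<q : ∀ {i j} → i < n → j < n → p i <[ δ ] q j)
    (p<N : Bounded N p n) (q<N : Bounded N q n) (zp : Side β₁ z p n) (zq : Side β₂ z q n)
    (L E R : Fin 2) (cpq : ∀ {i j} → i < n → j < n → col z (p i) (q j) ≡ κ L E R i j) where

    private
      module WithDigits (D : Digits L E R) (t r : ℕ) (n≡ : n ≡ suc (t * 4 + r)) where
        open Digits D

        from<n : ∀ {i} → i < t * 4 + r → i < n
        from<n lt = ≤-trans lt (subst (t * 4 + r ≤_) (sym n≡) (n≤1+n _))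

        pPoints qPoints : Vec (Fin 6) t → List ℕ
        pPoints v = map p (indices x₁ x₂ r 0 v)
        qPoints v = map q (indices y₁ y₂ 0 0 v)

        points : Vec (Fin 6) t → List ℕ
        points v = z ∷ pPoints v ++ qPoints v

        p-index : ∀ v {a} → a ∈ pPoints v → ∃ λ i → i < n × a ≡ p i
        p-index v a∈ with ∈-map⁻ p a∈
        ... | i , i∈ , eq = i , from<n (proj₂ (indices-∈ x₁<x₂ x₂<4 r 0 v i∈)) , eq

        q-index : ∀ v {a} → a ∈ qPoints v → ∃ λ i → i < n × a ≡ q i
        q-index v a∈ with ∈-map⁻ q a∈
        ... | i , i∈ , eq = i , from<n (≤-trans (proj₂ (indices-∈ y₁<y₂ y₂<4 0 0 v i∈)) (ℕₚ.+-monoʳ-≤ (t * 4) z≤n)) , eq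

        p-side : ∀ v {a} → a ∈ pPoints v → z <[ β₁ ] a
        p-side v a∈ with p-index v a∈
        ... | i , i<n , refl = zp i<n

        q-side : ∀ v {a} → a ∈ qPoints v → z <[ β₂ ] a
        q-side v a∈ with q-index v a∈
        ... | i , i<n , refl = zq i<n

        pq-side : ∀ v {a b} → a ∈ pPoints v → b ∈ qPoints v → a <[ δ ] b
        pq-side v a∈ b∈ with p-index v a∈ | q-index v b∈
        ... | i , i<n , refl | j , j<n , refl = p<q i<n j<n

        mono-points : ∀ {d s} I → Monotone d s n → (∀ {i} → i ∈ I → i < n) → AllPairs _<_ I → AllPairs _<[ d ]_ (map s I)
        mono-points []      m I<n []       = []
        mono-points (i ∷ I) m I<n (i< ∷ s) =
          Allₚ.map⁺ (All.tabulate (λ j∈ → m (All.lookup i< j∈) (I<n (there j∈)))) ∷ mono-points I m (I<n ∘ there) s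

        p-mono : ∀ v → AllPairs _<[ d₁ ]_ (pPoints v)
        p-mono v = mono-points _ pm (λ i∈ → from<n (proj₂ (indices-∈ x₁<x₂ x₂<4 r 0 v i∈))) (indices-mono x₁<x₂ x₂<4 r 0 v)

        q-mono : ∀ v → AllPairs _<[ d₂ ]_ (qPoints v)
        q-mono v = mono-points _ qm (λ i∈ → from<n (≤-trans (proj₂ (indices-∈ y₁<y₂ y₂<4 0 0 v i∈)) (ℕₚ.+-monoʳ-≤ (t * 4) z≤n)))
          (indices-mono y₁<y₂ y₂<4 0 0 v)

        p-length : ∀ v → length (pPoints v) ≡ t * 2 + r
        p-length v = trans (Listₚ.length-map p (indices x₁ x₂ r 0 v)) (length-indices x₁ x₂ r 0 v)

        q-length : ∀ v → length (qPoints v) ≡ t * 2 + 0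
        q-length v = trans (Listₚ.length-map q (indices y₁ y₂ 0 0 v)) (length-indices y₁ y₂ 0 0 v)

        orderIso : ∀ v v′ → OrderIso (points v) (points v′)
        orderIso v v′ = first ∷ OrderIso-++ {pPoints v} {pPoints v′}
          (OrderIso-monotone d₁ eqp (p-mono v) (p-mono v′))
          (OrderIso-monotone d₂ (trans (q-length v) (sym (q-length v′))) (q-mono v) (q-mono v′))
          (λ a b → sameOrder-dir δ (pq-side v (Zip-∈ˡ a) (Zip-∈ˡ b)) (pq-side v′ (Zip-∈ʳ a) (Zip-∈ʳ b)))
          where
          eqp = trans (p-length v) (sym (p-length v′))
          first : ∀ {b b′} → Zip (pPoints v ++ qPoints v) (pPoints v′ ++ qPoints v′) b b′ → SameOrder z z b b′
          first zip with Zip-++⁻ (pPoints v) (pPoints v′) eqp zip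
          ... | inj₁ b = sameOrder-dir β₁ (p-side v (Zip-∈ˡ b)) (p-side v′ (Zip-∈ʳ b))
          ... | inj₂ b = sameOrder-dir β₂ (q-side v (Zip-∈ˡ b)) (q-side v′ (Zip-∈ʳ b))

        isPoints : ∀ v → Points N n (points v)
        isPoints v = record
          { size-n   = trans (cong suc (trans (Listₚ.length-++ (pPoints v)) (trans (cong₂ _+_ (p-length v) (q-length v))
              (solve 2 (λ t r → (t :* con 2 :+ r) :+ (t :* con 2 :+ con 0) := t :* con 4 :+ r) refl t r)))) (sym n≡)
          ; bounded  = λ { (here refl) → z<N ; (there a∈) → [ p-bound , q-bound ]′ (∈-++⁻ (pPoints v) a∈) }
          ; distinct = OrderIso-distinct (orderIso v v)
          }
          where
          open +-*-Solver
          p-bound : ∀ {a} → a ∈ pPoints v → a < N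
          p-bound a∈ with p-index v a∈
          ... | i , i<n , refl = p<N i<n
          q-bound : ∀ {a} → a ∈ qPoints v → a < N
          q-bound a∈ with q-index v a∈
          ... | i , i<n , refl = q<N i<n

        decode-digits : ∀ {m} r b (v v′ : Vec (Fin 6) m) →
          (∀ {i i′ j j′} → Zip (indices x₁ x₂ r b v) (indices x₁ x₂ r b v′) i i′ →
             Zip (indices y₁ y₂ 0 b v) (indices y₁ y₂ 0 b v′) j j′ → κ L E R i j ≡ κ L E R i′ j′) → v ≡ v′
        decode-digits r b []      []        h = refl
        decode-digits r b (d ∷ v) (d′ ∷ v′) h = cong₂ _∷_
          (decode d d′ (unshift (h here here)) (unshift (h here (there here)))
                       (unshift (h (there here) here)) (unshift (h (there here) (there here))))
          (decode-digits r (4 + b) v v′ (λ zx zy → h (there (there zx)) (there (there zy))))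
          where
          unshift : ∀ {i j i′ j′} → κ L E R (b + i) (b + j) ≡ κ L E R (b + i′) (b + j′) → κ L E R i j ≡ κ L E R i′ j′
          unshift {i} {j} {i′} {j′} eq = trans (sym (κ-shift L E R b i j)) (trans eq (κ-shift L E R b i′ j′))

        decoded : ∀ {v v′} → Compatible (points v) (points v′) → v ≡ v′
        decoded {v} {v′} compat = decode-digits r 0 v v′ agree
          where
          agree : ∀ {i i′ j j′} → Zip (indices x₁ x₂ r 0 v) (indices x₁ x₂ r 0 v′) i i′ →
             Zip (indices y₁ y₂ 0 0 v) (indices y₁ y₂ 0 0 v′) j j′ → κ L E R i j ≡ κ L E R i′ j′
          agree {i} {i′} {j} {j′} zx zy = trans (sym (cpq (x<n v (Zip-∈ˡ zx)) (y<n v (Zip-∈ˡ zy)))) (trans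
            (compatible-zip (orderIso v v′) compat here (there (Zip-++ˡ (Zip-map p zx)))
              (there (Zip-++ʳ (pPoints v) (pPoints v′) (trans (p-length v) (sym (p-length v′))) (Zip-map q zy)))
              (<[]⇒≢ β₁ (zp (x<n v (Zip-∈ˡ zx)))) (<[]⇒≢ δ (p<q (x<n v (Zip-∈ˡ zx)) (y<n v (Zip-∈ˡ zy))))
              (<[]⇒≢ β₂ (zq (y<n v (Zip-∈ˡ zy)))))
            (cpq (x<n v′ (Zip-∈ʳ zx)) (y<n v′ (Zip-∈ʳ zy))))
            where
            x<n : ∀ v {i} → i ∈ indices x₁ x₂ r 0 v → i < n
            x<n v i∈ = from<n (proj₂ (indices-∈ x₁<x₂ x₂<4 r 0 v i∈))
            y<n : ∀ v {i} → i ∈ indices y₁ y₂ 0 0 v → i < n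
            y<n v i∈ = from<n (≤-trans (proj₂ (indices-∈ y₁<y₂ y₂<4 0 0 v i∈)) (ℕₚ.+-monoʳ-≤ (t * 4) z≤n))

      varying-impossible : ¬ ¬ (L ≡ E × E ≡ R)
      varying-impossible varying with G≤6^ (n ∸ 23)
      ... | t , r , eq , G≤ = ¬injective (strings 6 t G≤′) (strings-injective 6 t G≤′) W.points W.isPoints W.decoded
        where
        n≡ : 23 + (n ∸ 23) ≡ n
        n≡ = ℕₚ.m+[n∸m]≡n 23≤n
        G≤′ : G n ≤ 6 ^ t
        G≤′ = subst (λ m → G m ≤ 6 ^ t) n≡ G≤
        module W = WithDigits (digits L E R varying) t r
          (trans (sym n≡) (trans eq (cong (λ x → suc (x + r)) (ℕₚ.*-comm 4 t))))

    constant : L ≡ E × E ≡ R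
    constant with L Finₚ.≟ E | E Finₚ.≟ R
    ... | yes L≡E | yes E≡R = L≡E , E≡R
    ... | no  L≢E | _       = ⊥-elim (varying-impossible (L≢E ∘ proj₁))
    ... | yes _   | no  E≢R = ⊥-elim (varying-impossible (E≢R ∘ proj₂))

-- The link of a point

κ-< : ∀ L E R {i j} → i < j → κ L E R i j ≡ L
κ-< L E R {zero}  {suc j} _         = refl
κ-< L E R {suc i} {suc j} (s≤s i<j) = κ-< L E R i<j

κ-> : ∀ L E R {i j} → i < j → κ L E R j i ≡ R
κ-> L E R {zero}  {suc j} _         = refl
κ-> L E R {suc i} {suc j} (s≤s i<j) = κ-> L E R i<j

κ-refl : ∀ L E R i → κ L E R i i ≡ E
κ-refl L E R zero    = refl
κ-refl L E R (suc i) = κ-refl L E R i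

<-pred⇒suc< : ∀ {i} n → i < pred n → suc i < n
<-pred⇒suc< (suc n) i<n = s≤s i<n

opposite : Bool → Bool
opposite true  = false
opposite false = true

<[]-opposite : ∀ d {a b} → a <[ d ] b → b <[ opposite d ] a
<[]-opposite true  lt = lt
<[]-opposite false lt = lt

<[]-trans : ∀ d {a b c} → a <[ d ] b → b <[ d ] c → a <[ d ] c
<[]-trans true  x y = <-trans x y
<[]-trans false x y = <-trans y x

<[]-asym : ∀ d {a b} → a <[ d ] b → ¬ b <[ d ] a
<[]-asym true  = ℕₚ.<-asym
<[]-asym false = ℕₚ.<-asym

data Tracks (w : ℕ) (p q : ℕ → ℕ) : Set where
  alternating : ∀ d → Interleaved d p q w →
    (∀ {i} → i < w → p i <[ d ] q i) ⊎ (∀ {i} → i < w → q i <[ d ] p i) → Tracks w p q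
  separated : ∀ d₁ d₂ δ → Monotone d₁ p w → Monotone d₂ q w →
    (∀ {i j} → i < w → j < w → p i <[ δ ] q j) → Tracks w p q

Interleaved-swap : ∀ {d p q w} → Interleaved d p q w → Interleaved d q p w
Interleaved-swap I i<j j<w = let (a , b) , (c , d) = I i<j j<w in (d , c) , (b , a)

-- Interleaved sequences reach past each other, which leaves no room for a point between them.
sides-agree : ∀ d β₁ β₂ {z p q w} → 2 ≤ w → Interleaved d p q w → Side β₁ z p w → Side β₂ z q w → β₁ ≡ β₂
sides-agree d true  true  _ _ _ _ = refl
sides-agree d false false _ _ _ _ = refl
sides-agree true  true  false le I zp zq =
  contradiction (<-trans (zp (≤-trans (s≤s z≤n) le)) (proj₂ (proj₁ (I {0} {1} (s≤s z≤n) le)))) (ℕₚ.<-asym (zq le))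
sides-agree true  false true  le I zp zq =
  contradiction (<-trans (zq (≤-trans (s≤s z≤n) le)) (proj₁ (proj₂ (I {0} {1} (s≤s z≤n) le)))) (ℕₚ.<-asym (zp le))
sides-agree false true  false le I zp zq =
  contradiction (<-trans (zp le) (proj₁ (proj₂ (I {0} {1} (s≤s z≤n) le)))) (ℕₚ.<-asym (zq (≤-trans (s≤s z≤n) le)))
sides-agree false false true  le I zp zq =
  contradiction (<-trans (zq le) (proj₂ (proj₁ (I {0} {1} (s≤s z≤n) le)))) (ℕₚ.<-asym (zp (≤-trans (s≤s z≤n) le)))

module Links {ℓ} (X : Pred 𝒞₃ ℓ) (ideal : IsIdeal X) (n : ℕ) .{{n≢0 : NonZero n}} (23≤n : 23 ≤ n)
  (few : ¬ Many X n) (K : 𝒞₃) (K∈X : X K) where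

  open Colour K
  open Families X ideal n 23≤n few K K∈X

  module _ (z : ℕ) (p q : ℕ → ℕ) (z<N : z < N) (p<N : Bounded N p n) (q<N : Bounded N q n) (cpp cqq L E R : Fin 2)
    (colpp : ∀ {i j} → i < j → j < n → col z (p i) (p j) ≡ cpp)
    (colqq : ∀ {i j} → i < j → j < n → col z (q i) (q j) ≡ cqq)
    (colpq : ∀ {i j} → i < n → j < n → col z (p i) (q j) ≡ κ L E R i j) where

    private
      m : ℕ
      m = pred n

      n≡1+m : n ≡ suc m
      n≡1+m = sym (ℕₚ.suc-pred n)

      m<n : m < n
      m<n = ≤-reflexive (sym n≡1+m)

      n≤2+m : n ≤ 2 + m
      n≤2+m = ≤-trans (≤-reflexive n≡1+m) (n≤1+n _)

      0<n : 0 < n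
      0<n = ≤-trans (s≤s z≤n) 23≤n

      2≤n : 2 ≤ n
      2≤n = ≤-trans (s≤s (s≤s z≤n)) 23≤n

      suc<n : ∀ {i} → i < m → suc i < n
      suc<n = <-pred⇒suc< n

      below<n : ∀ {i} → i < m → i < n
      below<n i<m = <-trans i<m m<n

    -- `TwoFixed`, with z and in turn `p 0`, `q 0` and the last `p`, yields cpp ≡ L, R ≡ cqq and cpp
    -- ≡ R. These equalities supply the hypotheses of `Pairs`, which settles E; the order of `p i`
    -- and `q i` decides which sequence comes first there.
    link-alternating : ∀ d β → Interleaved d p q n → Side β z p n → Side β z q n →
      (∀ {i} → i < n → p i <[ d ] q i) ⊎ (∀ {i} → i < n → q i <[ d ] p i) → L ≡ E × E ≡ R
    link-alternating d β I zp zq order = finish order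
      where
      I⁺ : Interleaved d (p ∘ suc) (q ∘ suc) m
      I⁺ i<j j<m = I (s≤s i<j) (suc<n j<m)
      I⁻ : Interleaved d p q m
      I⁻ i<j j<m = I i<j (below<n j<m)
      pp≡L : cpp ≡ L
      pp≡L = TwoFixed.sameColour z (p 0) (p ∘ suc) (q ∘ suc) d β d m n≤2+m z<N (p<N 0<n) (<[]⇒≢ β (zp 0<n))
        I⁺ (p<N ∘ suc<n) (q<N ∘ suc<n) (zp ∘ suc<n) (zq ∘ suc<n)
        (λ i<m → proj₁ (proj₁ (I (s≤s z≤n) (suc<n i<m)))) (λ i<m → proj₂ (proj₁ (I (s≤s z≤n) (suc<n i<m))))
        cpp L (λ i<m → colpp (s≤s z≤n) (suc<n i<m)) (λ i<m → colpq 0<n (suc<n i<m))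
      R≡qq : R ≡ cqq
      R≡qq = TwoFixed.sameColour z (q 0) (p ∘ suc) (q ∘ suc) d β d m n≤2+m z<N (q<N 0<n) (<[]⇒≢ β (zq 0<n))
        I⁺ (p<N ∘ suc<n) (q<N ∘ suc<n) (zp ∘ suc<n) (zq ∘ suc<n)
        (λ i<m → proj₁ (proj₂ (I (s≤s z≤n) (suc<n i<m)))) (λ i<m → proj₂ (proj₂ (I (s≤s z≤n) (suc<n i<m))))
        R cqq (λ i<m → trans (col-swap₂ z _ _) (colpq (suc<n i<m) 0<n)) (λ i<m → colqq (s≤s z≤n) (suc<n i<m))
      pp≡R : cpp ≡ R
      pp≡R = TwoFixed.sameColour z (p m) p q d β (opposite d) m n≤2+m z<N (p<N m<n) (<[]⇒≢ β (zp m<n))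
        I⁻ (p<N ∘ below<n) (q<N ∘ below<n) (zp ∘ below<n) (zq ∘ below<n)
        (λ i<m → <[]-opposite d (proj₁ (proj₁ (I i<m m<n)))) (λ i<m → <[]-opposite d (proj₁ (proj₂ (I i<m m<n))))
        cpp R (λ i<m → trans (col-swap₂ z _ _) (colpp i<m m<n)) (λ i<m → trans (colpq m<n (below<n i<m)) (κ-> L E R i<m))
      L≡R : L ≡ R
      L≡R = trans (sym pp≡L) pp≡R
      finish : (∀ {i} → i < n → p i <[ d ] q i) ⊎ (∀ {i} → i < n → q i <[ d ] p i) → L ≡ E × E ≡ R
      finish (inj₁ p<q) = L≡E , trans (sym L≡E) L≡R
        where
        L≡E : L ≡ E
        L≡E = Pairs.sameColour z p q d β z<N I p<q p<N q<N zp zq L E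
          (λ i<j j<n → trans (colpp i<j j<n) pp≡L)
          (λ i<j j<n → trans (colpq (<-trans i<j j<n) j<n) (κ-< L E R i<j))
          (λ {i} i<n → trans (colpq i<n i<n) (κ-refl L E R i))
      finish (inj₂ q<p) = trans L≡R R≡E , sym R≡E
        where
        R≡E : R ≡ E
        R≡E = Pairs.sameColour z q p d β z<N (Interleaved-swap {d} {p} {q} {n} I) q<p q<N p<N zq zp R E
          (λ i<j j<n → trans (colqq i<j j<n) (sym R≡qq))
          (λ i<j j<n → trans (col-swap₂ z _ _) (trans (colpq j<n (<-trans i<j j<n)) (κ-> L E R i<j)))
          (λ {i} i<n → trans (col-swap₂ z _ _) (trans (colpq i<n i<n) (κ-refl L E R i)))

    link-constant : Tracks n p q → ∀ β₁ β₂ → Side β₁ z p n → Side β₂ z q n → L ≡ E × E ≡ R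
    link-constant (alternating d I order) β₁ β₂ zp zq with sides-agree d β₁ β₂ 2≤n I zp zq
    ... | refl = link-alternating d β₁ I zp zq order
    link-constant (separated d₁ d₂ δ pm qm p<q) β₁ β₂ zp zq =
      SeparatedTracks.constant z p q d₁ d₂ δ β₁ β₂ z<N pm qm p<q p<N q<N zp zq L E R colpq

-- Transversal triples of an exceptional colour

true⊎false : ∀ b → b ≡ true ⊎ b ≡ false
true⊎false true  = inj₁ refl
true⊎false false = inj₂ refl

opt : Bool → ℕ → List ℕ
opt true  x = x ∷ []
opt false x = []

∈-opt⁺ : ∀ {b x} → b ≡ true → x ∈ opt b x
∈-opt⁺ refl = here refl

∈-opt⁻ : ∀ b {x y} → y ∈ opt b x → y ≡ x × b ≡ true
∈-opt⁻ true (here refl) = refl , refl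

length-opt : ∀ b {x y} → length (opt b x) + length (opt (opposite b) y) ≡ 1
length-opt true  = refl
length-opt false = refl

length-opt-const : ∀ b {x y} → length (opt b x) ≡ length (opt b y)
length-opt-const true  = refl
length-opt-const false = refl

AllPairs-opt : ∀ {R : ℕ → ℕ → Set} b {x l} → (∀ {y} → b ≡ true → y ∈ l → R x y) → AllPairs R l → AllPairs R (opt b x ++ l)
AllPairs-opt true  r rs = All.tabulate (r refl) ∷ rs
AllPairs-opt false r rs = rs

length-cancel : ∀ {A : Set} (xs : List A) {ys zs} → length (xs ++ ys) ≡ length (xs ++ zs) → length ys ≡ length zs
length-cancel []       e = e
length-cancel (x ∷ xs) e = length-cancel xs (suc-injective e)

-- The last argument is the index of a long letter when the letters of the word are numbered from
-- the first argument on.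
data Full : ℕ → List Bool → ℕ → Set where
  here  : ∀ {i w} → Full i (true ∷ w) i
  there : ∀ {i b w j} → Full (suc i) w j → Full i (b ∷ w) j

Full-bound : ∀ {i w j} → Full i w j → i ≤ j × j < i + length w
Full-bound {i} here = ≤-refl , ℕₚ.m<m+n i z<s
Full-bound {i} {b ∷ w} {j} (there f) with Full-bound f
... | lo , hi = <⇒≤ lo , subst (j <_) (sym (+-suc i (length w))) hi

ones : List Bool → ℕ
ones []          = 0
ones (true  ∷ w) = suc (ones w)
ones (false ∷ w) = ones w

length≤weight : ∀ w → length w ≤ weight 3 w
length≤weight []          = z≤n
length≤weight (false ∷ w) = s≤s (length≤weight w)
length≤weight (true  ∷ w) = s≤s (≤-trans (length≤weight w) (m≤n+m _ 2))

2≤length : ∀ w → 4 ≤ weight 3 w → 2 ≤ length w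
2≤length (false ∷ [])    (s≤s ())
2≤length (true  ∷ [])    (s≤s (s≤s (s≤s ())))
2≤length (_ ∷ _ ∷ _)     _ = s≤s (s≤s z≤n)

join : Bool → List ℕ → List ℕ → List ℕ
join true  A B = A ++ B
join false A B = B ++ A

length-join : ∀ γ A B → length (join γ A B) ≡ length A + length B
length-join true  A B = Listₚ.length-++ A
length-join false A B = trans (Listₚ.length-++ B) (ℕₚ.+-comm (length B) (length A))

∈-join⁻ : ∀ γ A B {x} → x ∈ join γ A B → x ∈ A ⊎ x ∈ B
∈-join⁻ true  A B x∈ = ∈-++⁻ A x∈
∈-join⁻ false A B x∈ with ∈-++⁻ B x∈
... | inj₁ x = inj₂ x
... | inj₂ x = inj₁ x

∈-join⁺ : ∀ γ A B {x} → x ∈ A ⊎ x ∈ B → x ∈ join γ A B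
∈-join⁺ true  A B (inj₁ x) = ∈-++⁺ˡ x
∈-join⁺ true  A B (inj₂ x) = ∈-++⁺ʳ A x
∈-join⁺ false A B (inj₁ x) = ∈-++⁺ʳ B x
∈-join⁺ false A B (inj₂ x) = ∈-++⁺ˡ x

Zip-join : ∀ γ {A A′ B B′ x y} → length A ≡ length A′ → length B ≡ length B′ →
  Zip A A′ x y ⊎ Zip B B′ x y → Zip (join γ A B) (join γ A′ B′) x y
Zip-join true  {A} {A′} eA eB (inj₁ z) = Zip-++ˡ z
Zip-join true  {A} {A′} eA eB (inj₂ z) = Zip-++ʳ A A′ eA z
Zip-join false {B = B} {B′} eA eB (inj₁ z) = Zip-++ʳ B B′ eB z
Zip-join false {B = B} {B′} eA eB (inj₂ z) = Zip-++ˡ z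

OrderIso-join : ∀ γ {A A′ B B′} → OrderIso A A′ → OrderIso B B′ →
  (∀ {a a′ b b′} → Zip A A′ a a′ → Zip B B′ b b′ → SameOrder a a′ b b′) → OrderIso (join γ A B) (join γ A′ B′)
OrderIso-join true  oA oB x = OrderIso-++ oA oB x
OrderIso-join false oA oB x = OrderIso-++ oB oA (λ zb za → SameOrder-sym (x za zb))

sort-join : ∀ γ A B → (∀ {a b} → a ∈ A → b ∈ B → a <[ γ ] b) → sort (join γ A B) ≡ join γ (sort A) (sort B)
sort-join true  A B lt = sort-++ A B lt
sort-join false A B lt = sort-++ B A (λ b∈ a∈ → lt a∈ b∈)

longerPart-join : ∀ γ S T S′ T′ → length (join γ S T) ≡ length (join γ S′ T′) →
  length S′ < length S → length T < length T′ → LongerPart S S′ T′ (join γ S T) (join γ S′ T′)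
longerPart-join true  S T S′ T′ e lS lT = longerPrefix S T S′ T′ e lS
longerPart-join false S T S′ T′ e lS lT = longerSuffix S T S′ T′ e lT

longerPart-sort : ∀ γ A B A′ B′ → (∀ {a b} → a ∈ A → b ∈ B → a <[ γ ] b) → (∀ {a b} → a ∈ A′ → b ∈ B′ → a <[ γ ] b) →
  length (join γ A B) ≡ length (join γ A′ B′) → length A′ < length A → length B < length B′ →
  LongerPart (sort A) (sort A′) (sort B′) (sort (join γ A B)) (sort (join γ A′ B′))
longerPart-sort γ A B A′ B′ lt lt′ e lA lB =
  subst₂ (LongerPart (sort A) (sort A′) (sort B′)) (sym (sort-join γ A B lt)) (sym (sort-join γ A′ B′ lt′))
    (longerPart-join γ (sort A) (sort B) (sort A′) (sort B′)
      (trans (cong length (sym (sort-join γ A B lt))) (trans (trans (length-sort (join γ A B)) (trans e (sym (length-sort (join γ A′ B′)))))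
        (cong length (sort-join γ A′ B′ lt′))))
      (subst₂ _<_ (sym (length-sort A′)) (sym (length-sort A)) lA)
      (subst₂ _<_ (sym (length-sort B)) (sym (length-sort B′)) lB))

inTrack : Bool → Bool → Fin 3 → Bool
inTrack in₁ in₂ 0F = true
inTrack in₁ in₂ 1F = in₁
inTrack in₁ in₂ 2F = in₂

-- Three sequences on which the colour depends only on the sequences the points
-- come from, except possibly at points of equal index.  The sequence P 0F and
-- those marked by in₁, in₂ are interleaved; the others lie on one side of them.
record TripleSystem (K : 𝒞₃) (n : ℕ) : Set where
  open Colour K
  field
    P : Fin 3 → ℕ → ℕ
    in₁ in₂ : Bool
    in₂⇒in₁ : in₂ ≡ true → in₁ ≡ true
    c : Fin 3 → Fin 3 → Fin 3 → Fin 2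
    e : Fin 2
  inA : Fin 3 → Bool
  inA = inTrack in₁ in₂
  field
    P<N     : ∀ s → Bounded N (P s) n
    P-inj   : ∀ {s t i j} → i < n → j < n → P s i ≡ P t j → s ≡ t × i ≡ j
    bg      : ∀ {s t r i j k} → i < n → j < n → k < n → ¬ (i ≡ j × j ≡ k) →
              P s i ≢ P t j → P t j ≢ P r k → P s i ≢ P r k → col (P s i) (P t j) (P r k) ≡ c s t r
    c-swap₁ : ∀ s t r → c s t r ≡ c t s r
    c-swap₂ : ∀ s t r → c s t r ≡ c s r t
    c-track : ∀ {s s′} → inA s ≡ true → inA s′ ≡ true → ∀ t r → c s t r ≡ c s′ t r
    special : ∀ {i} → i < n → col (P 0F i) (P 1F i) (P 2F i) ≡ e
    dA d₁ d₂ δ γ : Bool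
    A-mono  : ∀ {s t i j} → inA s ≡ true → inA t ≡ true → i < j → j < n → P s i <[ dA ] P t j
    order₁  : in₁ ≡ true → ∀ {i} → i < n → P 0F i <[ dA ] P 1F i
    order₂  : in₂ ≡ true → ∀ {i} → i < n → P 1F i <[ dA ] P 2F i
    mono₁   : Monotone d₁ (P 1F) n
    mono₂   : Monotone d₂ (P 2F) n
    U-V     : in₁ ≡ false → in₂ ≡ false → ∀ {i j} → i < n → j < n → P 1F i <[ δ ] P 2F j
    A-B     : ∀ {s t i j} → inA s ≡ true → inA t ≡ false → i < n → j < n → P s i <[ γ ] P t j

module TripleWords {K n} (S : TripleSystem K n) where
  open TripleSystem S public
  open Colour K

  -- A long letter takes all three points of its index, a short one that of `P 0F`. Points on the
  -- track of `P 0F` go to `A`, the others to `U` or `V`, so that each run is monotone.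
  A U V : ℕ → List Bool → List ℕ
  A i []          = []
  A i (false ∷ w) = P 0F i ∷ A (suc i) w
  A i (true  ∷ w) = P 0F i ∷ (opt in₁ (P 1F i) ++ (opt in₂ (P 2F i) ++ A (suc i) w))
  U i []          = []
  U i (false ∷ w) = U (suc i) w
  U i (true  ∷ w) = opt (opposite in₁) (P 1F i) ++ U (suc i) w
  V i []          = []
  V i (false ∷ w) = V (suc i) w
  V i (true  ∷ w) = opt (opposite in₂) (P 2F i) ++ V (suc i) w

  opposite-true : ∀ {b} → opposite b ≡ true → b ≡ false
  opposite-true {false} _ = refl

  Fits : ℕ → List Bool → Set
  Fits i w = i + length w ≤ n

  fits-tail : ∀ {i b w} → Fits i (b ∷ w) → Fits (suc i) w
  fits-tail {i} {b} {w} le = subst (_≤ n) (+-suc i (length w)) le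

  fits-head : ∀ {i b w} → Fits i (b ∷ w) → i < n
  fits-head {i} {b} {w} le = ≤-trans (s≤s (m≤m+n i (length w))) (fits-tail {i} {b} {w} le)

  A-∈ : ∀ i w → Fits i w → ∀ {a} → a ∈ A i w → ∃₂ λ s j → a ≡ P s j × inA s ≡ true × i ≤ j × j < n
  A-∈ i (false ∷ w) le (here eq) = 0F , i , eq , refl , ≤-refl , fits-head {i} {false} {w} le
  A-∈ i (true  ∷ w) le (here eq) = 0F , i , eq , refl , ≤-refl , fits-head {i} {true} {w} le
  A-∈ i (false ∷ w) le (there a∈) with A-∈ (suc i) w (fits-tail {i} {false} {w} le) a∈
  ... | s , j , eq , s∈ , lo , hi = s , j , eq , s∈ , <⇒≤ lo , hi
  A-∈ i (true ∷ w) le (there a∈) with ∈-++⁻ (opt in₁ (P 1F i)) a∈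
  ... | inj₁ a∈₁ = let eq , b = ∈-opt⁻ in₁ a∈₁ in 1F , i , eq , b , ≤-refl , fits-head {i} {true} {w} le
  ... | inj₂ a∈₂ with ∈-++⁻ (opt in₂ (P 2F i)) a∈₂
  ...   | inj₁ a∈₁ = let eq , b = ∈-opt⁻ in₂ a∈₁ in 2F , i , eq , b , ≤-refl , fits-head {i} {true} {w} le
  ...   | inj₂ a∈₃ with A-∈ (suc i) w (fits-tail {i} {true} {w} le) a∈₃
  ...     | s , j , eq , s∈ , lo , hi = s , j , eq , s∈ , <⇒≤ lo , hi

  U-∈ : ∀ i w {a} → a ∈ U i w → ∃ λ j → a ≡ P 1F j × in₁ ≡ false × Full i w j
  U-∈ i (false ∷ w) a∈ with U-∈ (suc i) w a∈
  ... | j , eq , b , f = j , eq , b , there f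
  U-∈ i (true ∷ w) a∈ with ∈-++⁻ (opt (opposite in₁) (P 1F i)) a∈
  ... | inj₁ a∈₁ = let eq , b = ∈-opt⁻ (opposite in₁) a∈₁ in i , eq , opposite-true b , here
  ... | inj₂ a∈₂ with U-∈ (suc i) w a∈₂
  ...   | j , eq , b , f = j , eq , b , there f

  V-∈ : ∀ i w {a} → a ∈ V i w → ∃ λ j → a ≡ P 2F j × in₂ ≡ false × Full i w j
  V-∈ i (false ∷ w) a∈ with V-∈ (suc i) w a∈
  ... | j , eq , b , f = j , eq , b , there f
  V-∈ i (true ∷ w) a∈ with ∈-++⁻ (opt (opposite in₂) (P 2F i)) a∈
  ... | inj₁ a∈₁ = let eq , b = ∈-opt⁻ (opposite in₂) a∈₁ in i , eq , opposite-true b , here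
  ... | inj₂ a∈₂ with V-∈ (suc i) w a∈₂
  ...   | j , eq , b , f = j , eq , b , there f

  Full-A₁ : in₁ ≡ true → ∀ {i w j} → Full i w j → P 1F j ∈ A i w
  Full-A₁ b here = there (∈-++⁺ˡ (∈-opt⁺ b))
  Full-A₁ b {i} {true  ∷ w} (there f) = there (∈-++⁺ʳ (opt in₁ (P 1F i)) (∈-++⁺ʳ (opt in₂ (P 2F i)) (Full-A₁ b f)))
  Full-A₁ b {i} {false ∷ w} (there f) = there (Full-A₁ b f)

  Full-U : in₁ ≡ false → ∀ {i w j} → Full i w j → P 1F j ∈ U i w
  Full-U b here = ∈-++⁺ˡ (∈-opt⁺ (cong opposite b))
  Full-U b {i} {true  ∷ w} (there f) = ∈-++⁺ʳ (opt (opposite in₁) (P 1F i)) (Full-U b f)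
  Full-U b {i} {false ∷ w} (there f) = Full-U b f

  Full-V : in₂ ≡ false → ∀ {i w j} → Full i w j → P 2F j ∈ V i w
  Full-V b here = ∈-++⁺ˡ (∈-opt⁺ (cong opposite b))
  Full-V b {i} {true  ∷ w} (there f) = ∈-++⁺ʳ (opt (opposite in₂) (P 2F i)) (Full-V b f)
  Full-V b {i} {false ∷ w} (there f) = Full-V b f

  P₀-∈ : ∀ i w {j} → j < length w → P 0F (i + j) ∈ A i w
  P₀-∈ i (b ∷ w) {zero} _ rewrite ℕₚ.+-identityʳ i = first b
    where
    first : ∀ b → P 0F i ∈ A i (b ∷ w)
    first false = here refl
    first true  = here refl
  P₀-∈ i (false ∷ w) {suc j} (s≤s lt) rewrite +-suc i j = there (P₀-∈ (suc i) w lt)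
  P₀-∈ i (true  ∷ w) {suc j} (s≤s lt) rewrite +-suc i j =
    there (∈-++⁺ʳ (opt in₁ (P 1F i)) (∈-++⁺ʳ (opt in₂ (P 2F i)) (P₀-∈ (suc i) w lt)))

  A-sorted : ∀ i w → Fits i w → AllPairs _<[ dA ]_ (A i w)
  A-sorted i [] le = []
  A-sorted i (false ∷ w) le = All.tabulate after ∷ A-sorted (suc i) w (fits-tail {i} {false} {w} le)
    where
    after : ∀ {a} → a ∈ A (suc i) w → P 0F i <[ dA ] a
    after a∈ with A-∈ (suc i) w (fits-tail {i} {false} {w} le) a∈
    ... | s , j , refl , s∈ , lo , hi = A-mono refl s∈ lo hi
  A-sorted i (true ∷ w) le = All.tabulate first ∷ AllPairs-opt in₁ second (AllPairs-opt in₂ third (A-sorted (suc i) w le′))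
    where
    le′ = fits-tail {i} {true} {w} le
    i<n = fits-head {i} {true} {w} le
    after : ∀ {s} → inA s ≡ true → ∀ {a} → a ∈ A (suc i) w → P s i <[ dA ] a
    after s∈ a∈ with A-∈ (suc i) w le′ a∈
    ... | t , j , refl , t∈ , lo , hi = A-mono s∈ t∈ lo hi
    third : ∀ {y} → in₂ ≡ true → y ∈ A (suc i) w → P 2F i <[ dA ] y
    third b y∈ = after {2F} b y∈
    second : ∀ {y} → in₁ ≡ true → y ∈ opt in₂ (P 2F i) ++ A (suc i) w → P 1F i <[ dA ] y
    second b y∈ with ∈-++⁻ (opt in₂ (P 2F i)) y∈
    ... | inj₂ y∈₂ = after {1F} b y∈₂
    ... | inj₁ y∈₁ with ∈-opt⁻ in₂ y∈₁
    ...   | refl , b₂ = order₂ b₂ i<n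
    first : ∀ {y} → y ∈ opt in₁ (P 1F i) ++ (opt in₂ (P 2F i) ++ A (suc i) w) → P 0F i <[ dA ] y
    first y∈ with ∈-++⁻ (opt in₁ (P 1F i)) y∈
    ... | inj₁ y∈₁ = let eq , b = ∈-opt⁻ in₁ y∈₁ in subst (P 0F i <[ dA ]_) (sym eq) (order₁ b i<n)
    ... | inj₂ y∈₂ with ∈-++⁻ (opt in₂ (P 2F i)) y∈₂
    ...   | inj₁ y∈₃ = let eq , b = ∈-opt⁻ in₂ y∈₃ in
            subst (P 0F i <[ dA ]_) (sym eq) (<[]-trans dA (order₁ (in₂⇒in₁ b) i<n) (order₂ b i<n))
    ...   | inj₂ y∈₄ = after {0F} refl y∈₄

  U-sorted : ∀ i w → Fits i w → AllPairs _<[ d₁ ]_ (U i w)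
  U-sorted i [] le = []
  U-sorted i (false ∷ w) le = U-sorted (suc i) w (fits-tail {i} {false} {w} le)
  U-sorted i (true  ∷ w) le = AllPairs-opt (opposite in₁) after (U-sorted (suc i) w le′)
    where
    le′ = fits-tail {i} {true} {w} le
    after : ∀ {y} → opposite in₁ ≡ true → y ∈ U (suc i) w → P 1F i <[ d₁ ] y
    after _ y∈ with U-∈ (suc i) w y∈
    ... | j , refl , _ , f = mono₁ (proj₁ (Full-bound f)) (≤-trans (proj₂ (Full-bound f)) le′)

  V-sorted : ∀ i w → Fits i w → AllPairs _<[ d₂ ]_ (V i w)
  V-sorted i [] le = []
  V-sorted i (false ∷ w) le = V-sorted (suc i) w (fits-tail {i} {false} {w} le)
  V-sorted i (true  ∷ w) le = AllPairs-opt (opposite in₂) after (V-sorted (suc i) w le′)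
    where
    le′ = fits-tail {i} {true} {w} le
    after : ∀ {y} → opposite in₂ ≡ true → y ∈ V (suc i) w → P 2F i <[ d₂ ] y
    after _ y∈ with V-∈ (suc i) w y∈
    ... | j , refl , _ , f = mono₂ (proj₁ (Full-bound f)) (≤-trans (proj₂ (Full-bound f)) le′)

  length-U : ∀ i w → length (U i w) ≡ ones w * length (opt (opposite in₁) 0)
  length-U i []          = refl
  length-U i (false ∷ w) = length-U (suc i) w
  length-U i (true  ∷ w) = trans (Listₚ.length-++ (opt (opposite in₁) (P 1F i)))
    (cong₂ _+_ (length-opt-const (opposite in₁)) (length-U (suc i) w))

  length-V : ∀ i w → length (V i w) ≡ ones w * length (opt (opposite in₂) 0)
  length-V i []          = refl
  length-V i (false ∷ w) = length-V (suc i) w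
  length-V i (true  ∷ w) = trans (Listₚ.length-++ (opt (opposite in₂) (P 2F i)))
    (cong₂ _+_ (length-opt-const (opposite in₂)) (length-V (suc i) w))

  length-total : ∀ i w → length (A i w) + length (U i w ++ V i w) ≡ weight 3 w
  length-total i w = trans (cong (length (A i w) +_) (Listₚ.length-++ (U i w))) (total i w)
    where
    open +-*-Solver
    total : ∀ i w → length (A i w) + (length (U i w) + length (V i w)) ≡ weight 3 w
    total i []          = refl
    total i (false ∷ w) = cong suc (total (suc i) w)
    total i (true  ∷ w)
      rewrite Listₚ.length-++ (opt in₁ (P 1F i)) {opt in₂ (P 2F i) ++ A (suc i) w}
            | Listₚ.length-++ (opt in₂ (P 2F i)) {A (suc i) w}
            | Listₚ.length-++ (opt (opposite in₁) (P 1F i)) {U (suc i) w}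
            | Listₚ.length-++ (opt (opposite in₂) (P 2F i)) {V (suc i) w} =
      trans (solve 7 (λ x₁ x₂ y₁ y₂ a u v → con 1 :+ (x₁ :+ (x₂ :+ a)) :+ ((y₁ :+ u) :+ (y₂ :+ v)) :=
               con 1 :+ ((x₁ :+ y₁) :+ ((x₂ :+ y₂) :+ (a :+ (u :+ v))))) refl
               (length (opt in₁ (P 1F i))) (length (opt in₂ (P 2F i)))
               (length (opt (opposite in₁) (P 1F i))) (length (opt (opposite in₂) (P 2F i)))
               (length (A (suc i) w)) (length (U (suc i) w)) (length (V (suc i) w)))
            (cong suc (cong₂ _+_ (length-opt in₁) (cong₂ _+_ (length-opt in₂) (total (suc i) w))))

module Triples {ℓ} (X : Pred 𝒞₃ ℓ) (ideal : IsIdeal X) (n : ℕ) .{{n≢0 : NonZero n}} (23≤n : 23 ≤ n)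
  (few : ¬ Many X n) (K : 𝒞₃) (K∈X : X K) (S : TripleSystem K n) where

  open TripleWords S
  open Colour K
  open Families X ideal n 23≤n few K K∈X

  private
    -- The three runs are compared separately, so that a common first letter can be removed from all
    -- of them.
    Rel : ℕ → List Bool → List Bool → ℕ → ℕ → Set
    Rel i w w′ p p′ = Zip (A i w) (A i w′) p p′ ⊎ (Zip (U i w) (U i w′) p p′ ⊎ Zip (V i w) (V i w′) p p′)

    record SameSize (i : ℕ) (w w′ : List Bool) : Set where
      constructor sameSize
      field
        sizeA : length (A i w) ≡ length (A i w′)
        sizeU : length (U i w) ≡ length (U i w′)
        sizeV : length (V i w) ≡ length (V i w′)

    sameSize-sym : ∀ {i w w′} → SameSize i w w′ → SameSize i w′ w
    sameSize-sym (sameSize a u v) = sameSize (sym a) (sym u) (sym v)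

    -- The inequality in the conclusion is there because `bg` applies to distinct points.
    Agree : (ℕ → ℕ → Set) → Set
    Agree R = ∀ {p p′ q q′ r r′} → R p p′ → R q q′ → R r r′ → p ≢ q → q ≢ r → p ≢ r →
      q′ ≢ r′ × col p q r ≡ col p′ q′ r′

    P≢ : ∀ {s t i j} → i < n → j < n → s ≢ t ⊎ i ≢ j → P s i ≢ P t j
    P≢ i<n j<n (inj₁ s≢t) eq = s≢t (proj₁ (P-inj i<n j<n eq))
    P≢ i<n j<n (inj₂ i≢j) eq = i≢j (proj₂ (P-inj i<n j<n eq))

    -- A substitute for `P t i` in a colour: its index is greater than i, and its sequence has the
    -- same background colours as t.
    Mate : Fin 3 → ℕ → ℕ → Set
    Mate t i a = ∃₂ λ s j → a ≡ P s j × i < j × j < n × (∀ r r′ → c s r r′ ≡ c t r r′)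

    mate-A : ∀ {t i w a} → inA t ≡ true → Fits (suc i) w → a ∈ A (suc i) w → Mate t i a
    mate-A {t} {i} {w} t∈ le a∈ with A-∈ (suc i) w le a∈
    ... | s , j , eq , s∈ , lo , hi = s , j , eq , lo , hi , c-track s∈ t∈

    mate-U : ∀ {i w a} → Fits (suc i) w → a ∈ U (suc i) w → Mate 1F i a
    mate-U {i} {w} le a∈ with U-∈ (suc i) w a∈
    ... | j , eq , _ , f = 1F , j , eq , proj₁ (Full-bound f) , ≤-trans (proj₂ (Full-bound f)) le , λ r r′ → refl

    mate-V : ∀ {i w a} → Fits (suc i) w → a ∈ V (suc i) w → Mate 2F i a
    mate-V {i} {w} le a∈ with V-∈ (suc i) w a∈
    ... | j , eq , _ , f = 2F , j , eq , proj₁ (Full-bound f) , ≤-trans (proj₂ (Full-bound f)) le , λ r r′ → refl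

    c-mates : ∀ {s s′} → (∀ r r′ → c s r r′ ≡ c 1F r r′) → (∀ r r′ → c s′ r r′ ≡ c 2F r r′) → c 0F s s′ ≡ c 0F 1F 2F
    c-mates {s} {s′} h₁ h₂ =
      trans (c-swap₁ 0F s s′) (trans (h₁ 0F s′) (trans (c-swap₂ 1F 0F s′) (trans (c-swap₁ 1F s′ 0F)
      (trans (h₂ 1F 0F) (trans (c-swap₂ 2F 1F 0F) (trans (c-swap₁ 2F 0F 1F) (c-swap₂ 0F 2F 1F)))))))

    module _ (ne : c 0F 1F 2F ≢ e) where

      -- `P 0F i` faces itself, while `P 1F i` and `P 2F i` face mates. The triple at equal indices
      -- has colour e; the one with mates has the background colour `c 0F 1F 2F`.
      mismatch : ∀ i w w′ → Fits i (true ∷ w) → Fits i (false ∷ w′) → SameSize i (true ∷ w) (false ∷ w′) →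
        ¬ Agree (Rel i (true ∷ w) (false ∷ w′))
      mismatch i w w′ le le′ (sameSize eA eU eV) agree = conclude mate₁ mate₂
        where
        i<n   = fits-head {i} {true} {w} le
        le″   = fits-tail {i} {false} {w′} le′
        inTail : ∀ {x} → x ∈ opt in₁ (P 1F i) ++ (opt in₂ (P 2F i) ++ A (suc i) w) →
          ∃ λ a → a ∈ A (suc i) w′ × Rel i (true ∷ w) (false ∷ w′) x a
        inTail x∈ with Zip-image {ys = A (suc i) w′} (≤-reflexive (suc-injective eA)) x∈
        ... | a , z = a , Zip-∈ʳ z , inj₁ (there z)
        mate₁ : ∃ λ a → Rel i (true ∷ w) (false ∷ w′) (P 1F i) a × Mate 1F i a
        mate₁ with true⊎false in₁
        ... | inj₁ b = let a , a∈ , z = inTail (∈-++⁺ˡ (∈-opt⁺ b)) in a , z , mate-A {1F} {i} {w′} b le″ a∈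
        ... | inj₂ b with Zip-image {ys = U (suc i) w′} (≤-reflexive eU) (Full-U b {i} {true ∷ w} here)
        ...   | a , z = a , inj₂ (inj₁ z) , mate-U {i} {w′} le″ (Zip-∈ʳ z)
        mate₂ : ∃ λ a → Rel i (true ∷ w) (false ∷ w′) (P 2F i) a × Mate 2F i a
        mate₂ with true⊎false in₂
        ... | inj₁ b = let a , a∈ , z = inTail (∈-++⁺ʳ (opt in₁ (P 1F i)) (∈-++⁺ˡ (∈-opt⁺ b))) in
                       a , z , mate-A {2F} {i} {w′} b le″ a∈
        ... | inj₂ b with Zip-image {ys = V (suc i) w′} (≤-reflexive eV) (Full-V b {i} {true ∷ w} here)
        ...   | a , z = a , inj₂ (inj₂ z) , mate-V {i} {w′} le″ (Zip-∈ʳ z)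
        conclude : (∃ λ a → Rel i (true ∷ w) (false ∷ w′) (P 1F i) a × Mate 1F i a) →
                   (∃ λ a → Rel i (true ∷ w) (false ∷ w′) (P 2F i) a × Mate 2F i a) → ⊥
        conclude (_ , z₁ , s , j , refl , i<j , j<n , h₁) (_ , z₂ , s′ , j′ , refl , i<j′ , j′<n , h₂)
          with agree (inj₁ here) z₁ z₂ (P≢ i<n i<n (inj₁ λ ())) (P≢ i<n i<n (inj₁ λ ())) (P≢ i<n i<n (inj₁ λ ()))
        ... | q≢r , same = ne (trans (sym (c-mates h₁ h₂)) (trans (sym (bg i<n j<n j′<n (λ (x , _) → <⇒≢ i<j x)
              (P≢ i<n j<n (inj₂ (<⇒≢ i<j))) q≢r (P≢ i<n j′<n (inj₂ (<⇒≢ i<j′)))))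
              (trans (sym same) (special i<n))))

      firstDifference : ∀ i w w′ → Fits i w → Fits i w′ → SameSize i w w′ →
        Agree (Rel i w w′) → Agree (Rel i w′ w) → w ≡ w′
      firstDifference i [] [] le le′ size ag ag′ = refl
      firstDifference i [] (false ∷ w′) le le′ (sameSize () _ _)
      firstDifference i [] (true  ∷ w′) le le′ (sameSize () _ _)
      firstDifference i (false ∷ w) []  le le′ (sameSize () _ _)
      firstDifference i (true  ∷ w) []  le le′ (sameSize () _ _)
      firstDifference i (true  ∷ w) (false ∷ w′) le le′ size ag ag′ =
        contradiction (λ {p} {p′} {q} {q′} {r} {r′} → ag {p} {p′} {q} {q′} {r} {r′}) (mismatch i w w′ le le′ size)
      firstDifference i (false ∷ w) (true  ∷ w′) le le′ size ag ag′ =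
        contradiction (λ {p} {p′} {q} {q′} {r} {r′} → ag′ {p} {p′} {q} {q′} {r} {r′}) (mismatch i w′ w le′ le (sameSize-sym size))
      firstDifference i (false ∷ w) (false ∷ w′) le le′ (sameSize eA eU eV) ag ag′ =
        cong (false ∷_) (firstDifference (suc i) w w′ (fits-tail {i} {false} {w} le) (fits-tail {i} {false} {w′} le′)
          (sameSize (suc-injective eA) eU eV)
          (λ x y z → ag (lift₀ w w′ x) (lift₀ w w′ y) (lift₀ w w′ z)) (λ x y z → ag′ (lift₀ w′ w x) (lift₀ w′ w y) (lift₀ w′ w z)))
        where
        lift₀ : ∀ w w′ {p p′} → Rel (suc i) w w′ p p′ → Rel i (false ∷ w) (false ∷ w′) p p′
        lift₀ w w′ (inj₁ z) = inj₁ (there z)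
        lift₀ w w′ (inj₂ z) = inj₂ z
      firstDifference i (true ∷ w) (true ∷ w′) le le′ (sameSize eA eU eV) ag ag′ =
        cong (true ∷_) (firstDifference (suc i) w w′ (fits-tail {i} {true} {w} le) (fits-tail {i} {true} {w′} le′)
          (sameSize (length-cancel (opt in₂ (P 2F i)) (length-cancel (opt in₁ (P 1F i)) (suc-injective eA)))
                    (length-cancel (opt (opposite in₁) (P 1F i)) eU) (length-cancel (opt (opposite in₂) (P 2F i)) eV))
          (λ x y z → ag (lift₁ w w′ x) (lift₁ w w′ y) (lift₁ w w′ z)) (λ x y z → ag′ (lift₁ w′ w x) (lift₁ w′ w y) (lift₁ w′ w z)))
        where
        lift₁ : ∀ w w′ {p p′} → Rel (suc i) w w′ p p′ → Rel i (true ∷ w) (true ∷ w′) p p′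
        lift₁ w w′ (inj₁ z) = inj₁ (there (Zip-++ʳ (opt in₁ (P 1F i)) (opt in₁ (P 1F i)) refl
          (Zip-++ʳ (opt in₂ (P 2F i)) (opt in₂ (P 2F i)) refl z)))
        lift₁ w w′ (inj₂ (inj₁ z)) = inj₂ (inj₁ (Zip-++ʳ (opt (opposite in₁) (P 1F i)) (opt (opposite in₁) (P 1F i)) refl z))
        lift₁ w w′ (inj₂ (inj₂ z)) = inj₂ (inj₂ (Zip-++ʳ (opt (opposite in₂) (P 2F i)) (opt (opposite in₂) (P 2F i)) refl z))

    Word : Set
    Word = ∃ λ w → weight 3 w ≡ n

    fits : ((w , _) : Word) → Fits 0 w
    fits (w , eq) = ≤-trans (length≤weight w) (≤-reflexive eq)

    B : List Bool → List ℕ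
    B w = U 0 w ++ V 0 w

    points : List Bool → List ℕ
    points w = join γ (A 0 w) (B w)

    B-∈ : (W : Word) → ∀ {a} → a ∈ B (proj₁ W) → ∃₂ λ s j → a ≡ P s j × inA s ≡ false × j < n
    B-∈ W@(w , _) a∈ with ∈-++⁻ (U 0 w) a∈
    ... | inj₁ a∈₁ = let j , eq , b , f = U-∈ 0 w a∈₁ in 1F , j , eq , b , ≤-trans (proj₂ (Full-bound f)) (fits W)
    ... | inj₂ a∈₂ = let j , eq , b , f = V-∈ 0 w a∈₂ in 2F , j , eq , b , ≤-trans (proj₂ (Full-bound f)) (fits W)

    points-∈ : (W : Word) → ∀ {a} → a ∈ points (proj₁ W) → ∃₂ λ s j → a ≡ P s j × j < n
    points-∈ W@(w , _) a∈ with ∈-join⁻ γ (A 0 w) (B w) a∈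
    ... | inj₁ a∈₁ = let s , j , eq , _ , _ , hi = A-∈ 0 w (fits W) a∈₁ in s , j , eq , hi
    ... | inj₂ a∈₂ = let s , j , eq , _ , hi = B-∈ W a∈₂ in s , j , eq , hi

    AB-side : (W : Word) → ∀ {a b} → a ∈ A 0 (proj₁ W) → b ∈ B (proj₁ W) → a <[ γ ] b
    AB-side W@(w , _) a∈ b∈ with A-∈ 0 w (fits W) a∈ | B-∈ W b∈
    ... | s , i , refl , s∈ , _ , i<n | t , j , refl , t∉ , j<n = A-B s∈ t∉ i<n j<n

    UV-side : (W : Word) → ∀ {a b} → a ∈ U 0 (proj₁ W) → b ∈ V 0 (proj₁ W) → a <[ δ ] b
    UV-side W@(w , _) a∈ b∈ with U-∈ 0 w a∈ | V-∈ 0 w b∈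
    ... | i , refl , b₁ , f | j , refl , b₂ , g =
      U-V b₁ b₂ (≤-trans (proj₂ (Full-bound f)) (fits W)) (≤-trans (proj₂ (Full-bound g)) (fits W))

    orderIso : (W W′ : Word) → SameSize 0 (proj₁ W) (proj₁ W′) → OrderIso (points (proj₁ W)) (points (proj₁ W′))
    orderIso W@(w , _) W′@(w′ , _) (sameSize eA eU eV) = OrderIso-join γ
      (OrderIso-monotone dA eA (A-sorted 0 w (fits W)) (A-sorted 0 w′ (fits W′)))
      (OrderIso-++ (OrderIso-monotone d₁ eU (U-sorted 0 w (fits W)) (U-sorted 0 w′ (fits W′)))
                   (OrderIso-monotone d₂ eV (V-sorted 0 w (fits W)) (V-sorted 0 w′ (fits W′)))
                   (λ u v → sameOrder-dir δ (UV-side W (Zip-∈ˡ u) (Zip-∈ˡ v)) (UV-side W′ (Zip-∈ʳ u) (Zip-∈ʳ v))))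
      (λ a b → sameOrder-dir γ (AB-side W (Zip-∈ˡ a) (Zip-∈ˡ b)) (AB-side W′ (Zip-∈ʳ a) (Zip-∈ʳ b)))

    length-points : (W : Word) → length (points (proj₁ W)) ≡ n
    length-points (w , eq) = trans (length-join γ (A 0 w) (B w)) (trans (length-total 0 w) eq)

    distinct : (W : Word) → AllPairs _≢_ (points (proj₁ W))
    distinct W = OrderIso-distinct (orderIso W W (sameSize refl refl refl))

    isPoints : (W : Word) → Points N n (points (proj₁ W))
    isPoints W = record
      { size-n = length-points W
      ; bounded = λ a∈ → let s , j , eq , j<n = points-∈ W a∈ in subst (_< N) (sym eq) (P<N s j<n)
      ; distinct = distinct W
      }

    Sorted : Word → Word → ℕ → ℕ → Set
    Sorted (w , _) (w′ , _) = Zip (sort (points w)) (sort (points w′))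

    sorted-injʳ : ∀ (W W′ : Word) {p p′ q q′} → Sorted W W′ p p′ → Sorted W W′ q q′ → p ≢ q → p′ ≢ q′
    sorted-injʳ W W′ z₁ z₂ ne refl = ne (Zip-injective (sort-sorted _ (distinct W′)) z₁ z₂)

    sorted-injˡ : ∀ (W W′ : Word) {p p′ q q′} → Sorted W W′ p p′ → Sorted W W′ q q′ → p′ ≢ q′ → p ≢ q
    sorted-injˡ W W′ z₁ z₂ ne refl = ne (Zip-injective (sort-sorted _ (distinct W)) (Zip-sym z₁) (Zip-sym z₂))

    compatible-sym : ∀ (W W′ : Word) → Compatible (points (proj₁ W)) (points (proj₁ W′)) → Compatible (points (proj₁ W′)) (points (proj₁ W))
    compatible-sym W W′ compat zp zq zr p≢q q≢r p≢r =
      sym (compat (Zip-sym zp) (Zip-sym zq) (Zip-sym zr)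
        (sorted-injʳ W′ W zp zq p≢q) (sorted-injʳ W′ W zq zr q≢r) (sorted-injʳ W′ W zp zr p≢r))

    agree : ∀ (W W′ : Word) → SameSize 0 (proj₁ W) (proj₁ W′) → Compatible (points (proj₁ W)) (points (proj₁ W′)) →
      Agree (Rel 0 (proj₁ W) (proj₁ W′))
    agree W@(w , _) W′@(w′ , _) size@(sameSize eA eU eV) compat zp zq zr p≢q q≢r p≢r =
      sorted-injʳ W W′ (sorted zq) (sorted zr) q≢r , compat (sorted zp) (sorted zq) (sorted zr) p≢q q≢r p≢r
      where
      eB : length (B w) ≡ length (B w′)
      eB = trans (Listₚ.length-++ (U 0 w)) (trans (cong₂ _+_ eU eV) (sym (Listₚ.length-++ (U 0 w′))))
      sorted : ∀ {p p′} → Rel 0 w w′ p p′ → Sorted W W′ p p′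
      sorted r = proj₁ (sort-zip (orderIso W W′ size)) (Zip-join γ eA eB (inB r))
        where
        inB : ∀ {p p′} → Rel 0 w w′ p p′ → Zip (A 0 w) (A 0 w′) p p′ ⊎ Zip (B w) (B w′) p p′
        inB (inj₁ z)        = inj₁ z
        inB (inj₂ (inj₁ z)) = inj₂ (Zip-++ˡ z)
        inB (inj₂ (inj₂ z)) = inj₂ (Zip-++ʳ (U 0 w) (U 0 w′) eU z)

    -- If W′ has more triples than W, then some b ∈ B W′ faces an a ∈ A W.  The
    -- points facing the mates of b and P 0F j have a colour which in W does not
    -- depend on j, but in W′ it does.
    module Unequal (in₂≡false : in₂ ≡ false) (W W′ : Word) (fewer : ones (proj₁ W) < ones (proj₁ W′))
      (compat : Compatible (points (proj₁ W)) (points (proj₁ W′))) where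

      w  = proj₁ W
      w′ = proj₁ W′

      lengthB : ∀ w → length (B w) ≡ ones w * length (opt (opposite in₁) 0) + ones w
      lengthB w = trans (Listₚ.length-++ (U 0 w)) (cong₂ _+_ (length-U 0 w)
        (trans (length-V 0 w) (trans (cong (λ b → ones w * length (opt (opposite b) 0)) in₂≡false) (ℕₚ.*-identityʳ (ones w)))))

      B< : length (B w) < length (B w′)
      B< = subst₂ _<_ (sym (lengthB w)) (sym (lengthB w′))
        (ℕₚ.+-mono-≤-< (ℕₚ.*-monoˡ-≤ (length (opt (opposite in₁) 0)) (<⇒≤ fewer)) fewer)

      A> : length (A 0 w′) < length (A 0 w)
      A> = ℕₚ.≰⇒> λ le → <⇒≢ (ℕₚ.+-mono-≤-< le B<)
        (trans (length-total 0 w) (trans (proj₂ W) (trans (sym (proj₂ W′)) (sym (length-total 0 w′)))))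

      open LongerPart (longerPart-sort γ (A 0 w) (B w) (A 0 w′) (B w′) (AB-side W) (AB-side W′)
        (trans (length-points W) (sym (length-points W′))) A> B<)

      facing : ∀ {b} → b ∈ A 0 w′ → ∃ λ a → a ∈ A 0 w × Sorted W W′ a b
      facing b∈ = let a , a∈ , z = within (∈-sort⁺ _ b∈) in a , ∈-sort⁻ _ a∈ , z

      facing-any : ∀ {b} → b ∈ points w′ → ∃ λ a → a ∈ points w × Sorted W W′ a b
      facing-any b∈ with Zip-preimage (≤-reflexive (trans (trans (length-sort (points w′)) (length-points W′))
        (sym (trans (length-sort (points w)) (length-points W))))) (∈-sort⁺ (points w′) b∈)
      ... | a , z = a , ∈-sort⁻ (points w) (Zip-∈ˡ z) , z

      -- If the track consists of `P 0F` alone, then p and q share a sequence. If the third point is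
      -- on the track too, three points come from at most two sequences. Either way two of them
      -- share a sequence, so their indices differ and `bg` applies.
      constant : ∀ {p q r k} → p ∈ A 0 w → q ∈ A 0 w → k < n → in₁ ≡ false ⊎ inA r ≡ true →
        q ≢ p → p ≢ P r k → q ≢ P r k → col q p (P r k) ≡ c 0F 0F r
      constant {r = r} {k} p∈ q∈ k<n track q≢p p≢r q≢r with A-∈ 0 w (fits W) p∈ | A-∈ 0 w (fits W) q∈
      ... | s , i , refl , s∈ , _ , i<n | t , j , refl , t∈ , _ , j<n =
        trans (bg j<n i<n k<n notAll q≢p p≢r q≢r)
          (trans (c-track t∈ refl s r) (trans (c-swap₁ 0F s r) (c-track s∈ refl 0F r)))
        where
        clash : ∀ s t r → inA s ≡ true → inA t ≡ true → in₁ ≡ false ⊎ inA r ≡ true → t ≡ s ⊎ (s ≡ r ⊎ t ≡ r)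
        clash 0F 0F r  _  _  _        = inj₁ refl
        clash 1F 1F r  _  _  _        = inj₁ refl
        clash s  t  2F s∈ t∈ (inj₂ r∈) = contradiction (trans (sym r∈) in₂≡false) λ ()
        clash 2F t  r  s∈ t∈ _         = contradiction (trans (sym s∈) in₂≡false) λ ()
        clash s  2F r  s∈ t∈ _         = contradiction (trans (sym t∈) in₂≡false) λ ()
        clash 0F 1F r  s∈ t∈ (inj₁ b)  = contradiction (trans (sym t∈) b) λ ()
        clash 1F 0F r  s∈ t∈ (inj₁ b)  = contradiction (trans (sym s∈) b) λ ()
        clash 0F 1F 0F s∈ t∈ _         = inj₂ (inj₁ refl)
        clash 0F 1F 1F s∈ t∈ _         = inj₂ (inj₂ refl)
        clash 1F 0F 0F s∈ t∈ _         = inj₂ (inj₂ refl)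
        clash 1F 0F 1F s∈ t∈ _         = inj₂ (inj₁ refl)
        notAll : ¬ (j ≡ i × i ≡ k)
        notAll (j≡i , i≡k) = [ (λ eq → q≢p (cong₂ P eq j≡i)) , [ (λ eq → p≢r (cong₂ P eq i≡k)) , (λ eq → q≢r (cong₂ P eq (trans j≡i i≡k))) ]′ ]′
          (clash s t r s∈ t∈ track)

      0F-distinct : ∀ {t t′} → t ≢ t′ → t ≢ 0F → t′ ≢ 0F → ∀ {i} → i < n → ∀ {j} → j < n →
        (P 0F j ≢ P t i × P t i ≢ P t′ i) × P 0F j ≢ P t′ i
      0F-distinct t≢t′ t≢0 t′≢0 i<n j<n =
        (P≢ j<n i<n (inj₁ (t≢0 ∘ sym)) , P≢ i<n i<n (inj₁ t≢t′)) , P≢ j<n i<n (inj₁ (t′≢0 ∘ sym))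

      clashing : ∀ t t′ → t ≢ t′ → t ≢ 0F → t′ ≢ 0F → ∀ {i p} → i < n → Full 0 w′ i → p ∈ A 0 w → Sorted W W′ p (P t i) →
        P t′ i ∈ points w′ → in₁ ≡ false ⊎ P t′ i ∈ A 0 w′ → c 0F t t′ ≡ col (P 0F i) (P t i) (P t′ i)
      clashing t t′ t≢t′ t≢0 t′≢0 {i} {p} i<n full p∈ zp mate∈ track = result other
        where
        2≤ : 2 ≤ length w′
        2≤ = 2≤length w′ (≤-trans (≤-trans (m≤m+n 4 19) 23≤n) (≤-reflexive (sym (proj₂ W′))))
        -- An index to compare with i exists because a word of total length at least 4 has at least
        -- two letters.
        other : ∃ λ j → j ≢ i × j < length w′
        other with i ≟ 0
        ... | yes refl = 1 , (λ ()) , 2≤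
        ... | no  i≢0  = 0 , i≢0 ∘ sym , <⇒≤ 2≤
        mate : ∃ λ a → (∃₂ λ r k → a ≡ P r k × k < n × (in₁ ≡ false ⊎ inA r ≡ true)) × Sorted W W′ a (P t′ i)
        mate = mate′ track
          where
          mate′ : in₁ ≡ false ⊎ P t′ i ∈ A 0 w′ →
            ∃ λ a → (∃₂ λ r k → a ≡ P r k × k < n × (in₁ ≡ false ⊎ inA r ≡ true)) × Sorted W W′ a (P t′ i)
          mate′ (inj₁ b)  = let a , a∈ , z = facing-any mate∈ in let r , k , eq , k<n = points-∈ W a∈ in a , (r , k , eq , k<n , inj₁ b) , z
          mate′ (inj₂ b∈) = let a , a∈ , z = facing b∈ in let r , k , eq , r∈ , _ , k<n = A-∈ 0 w (fits W) a∈ in a , (r , k , eq , k<n , inj₂ r∈) , z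
        faced : ∀ {j} → j < length w′ → c 0F 0F (proj₁ (proj₁ (proj₂ mate))) ≡ col (P 0F j) (P t i) (P t′ i)
        faced {j} j< with mate | facing (P₀-∈ 0 w′ j<) | 0F-distinct t≢t′ t≢0 t′≢0 i<n (≤-trans j< (fits W′))
        ... | _ , (r , k , refl , k<n , tr) , zm | q , q∈ , zq | (d₁ , d₂) , d₃ =
          trans (sym (constant p∈ q∈ k<n tr q≢p p≢m q≢m)) (compat zq zp zm q≢p p≢m q≢m)
          where
          q≢p = sorted-injˡ W W′ zq zp d₁
          p≢m = sorted-injˡ W W′ zp zm d₂
          q≢m = sorted-injˡ W W′ zq zm d₃
        result : (∃ λ j → j ≢ i × j < length w′) → c 0F t t′ ≡ col (P 0F i) (P t i) (P t′ i)
        result (j , j≢i , j<) with 0F-distinct t≢t′ t≢0 t′≢0 i<n (≤-trans j< (fits W′))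
        ... | (d₁ , d₂) , d₃ = trans (sym (bg j<n i<n i<n (λ (x , _) → j≢i x) d₁ d₂ d₃))
              (trans (sym (faced j<)) (faced (proj₂ (Full-bound full))))
          where j<n = ≤-trans j< (fits W′)

      noException : c 0F 1F 2F ≡ e
      noException with overhang
      ... | b , b∈ , p , p∈ , zp with ∈-++⁻ (U 0 w′) (∈-sort⁻ (B w′) b∈)
      ...   | inj₁ b∈U with U-∈ 0 w′ b∈U
      ...     | i , refl , in₁≡false , f =
        trans (clashing 1F 2F (λ ()) (λ ()) (λ ()) i<n f (∈-sort⁻ _ p∈) zp
                 (∈-join⁺ γ (A 0 w′) (B w′) (inj₂ (∈-++⁺ʳ (U 0 w′) (Full-V in₂≡false f)))) (inj₁ in₁≡false))
              (special i<n)
        where i<n = ≤-trans (proj₂ (Full-bound f)) (fits W′)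
      noException | b , b∈ , p , p∈ , zp | inj₂ b∈V with V-∈ 0 w′ b∈V
      ...     | i , refl , _ , f =
        trans (c-swap₂ 0F 1F 2F) (trans (clashing 2F 1F (λ ()) (λ ()) (λ ()) i<n f (∈-sort⁻ _ p∈) zp (proj₁ mate) (proj₂ mate))
          (trans (col-swap₂ _ _ _) (special i<n)))
        where
        i<n = ≤-trans (proj₂ (Full-bound f)) (fits W′)
        mate : P 1F i ∈ points w′ × (in₁ ≡ false ⊎ P 1F i ∈ A 0 w′)
        mate with true⊎false in₁
        ... | inj₁ b = ∈-join⁺ γ (A 0 w′) (B w′) (inj₁ (Full-A₁ b f)) , inj₂ (Full-A₁ b f)
        ... | inj₂ b = ∈-join⁺ γ (A 0 w′) (B w′) (inj₂ (∈-++⁺ˡ (Full-U b f))) , inj₁ b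

    sameSize-total : ∀ (W W′ : Word) → length (U 0 (proj₁ W)) ≡ length (U 0 (proj₁ W′)) → length (V 0 (proj₁ W)) ≡ length (V 0 (proj₁ W′)) →
      SameSize 0 (proj₁ W) (proj₁ W′)
    sameSize-total (w , eq) (w′ , eq′) eU eV = sameSize
      (ℕₚ.+-cancelʳ-≡ (length (B w′)) (length (A 0 w)) (length (A 0 w′)) (trans (cong (length (A 0 w) +_) (sym eB))
        (trans (length-total 0 w) (trans eq (trans (sym eq′) (sym (length-total 0 w′))))))) eU eV
      where
      eB : length (B w) ≡ length (B w′)
      eB = trans (Listₚ.length-++ (U 0 w)) (trans (cong₂ _+_ eU eV) (sym (Listₚ.length-++ (U 0 w′))))

    -- If all three sequences share the track, then `U` and `V` are empty. Otherwise the number of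
    -- long letters determines the sizes, and `Unequal` excludes different numbers.
    sizes : c 0F 1F 2F ≢ e → ∀ (W W′ : Word) → Compatible (points (proj₁ W)) (points (proj₁ W′)) → SameSize 0 (proj₁ W) (proj₁ W′)
    sizes ne W@(w , _) W′@(w′ , _) compat with true⊎false in₂
    ... | inj₁ b = sameSize-total W W′ (trans (empty-U w) (sym (empty-U w′))) (trans (empty-V w) (sym (empty-V w′)))
      where
      empty-U : ∀ w → length (U 0 w) ≡ 0
      empty-U w = trans (length-U 0 w) (trans (cong (λ b → ones w * length (opt (opposite b) 0)) (in₂⇒in₁ b)) (ℕₚ.*-zeroʳ (ones w)))
      empty-V : ∀ w → length (V 0 w) ≡ 0
      empty-V w = trans (length-V 0 w) (trans (cong (λ b → ones w * length (opt (opposite b) 0)) b) (ℕₚ.*-zeroʳ (ones w)))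
    ... | inj₂ b with <-cmp (ones w) (ones w′)
    ...   | tri< lt _ _ = contradiction (Unequal.noException b W W′ lt compat) ne
    ...   | tri> _ _ gt = contradiction (Unequal.noException b W′ W gt (compatible-sym W W′ compat)) ne
    ...   | tri≈ _ eq _ = sameSize-total W W′
      (trans (length-U 0 w) (trans (cong (_* length (opt (opposite in₁) 0)) eq) (sym (length-U 0 w′))))
      (trans (length-V 0 w) (trans (cong (_* length (opt (opposite in₂) 0)) eq) (sym (length-V 0 w′))))

  noException : c 0F 1F 2F ≡ e
  noException with c 0F 1F 2F Finₚ.≟ e
  ... | yes eq = eq
  ... | no  ne with enum₃ n
  ...   | enum , inj , wt = ⊥-elim (¬injective (λ i → enum i , wt i) (λ eq → inj (cong proj₁ eq))
      (points ∘ proj₁) isPoints (λ {W} {W′} → decode {W} {W′}))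
    where
    decode : ∀ {W W′ : Word} → Compatible (points (proj₁ W)) (points (proj₁ W′)) → W ≡ W′
    decode {W} {W′} compat = word-ext {W} {W′} (firstDifference ne 0 (proj₁ W) (proj₁ W′) (fits W) (fits W′) sz
        (agree W W′ sz compat) (agree W′ W (sameSize-sym sz) (compatible-sym W W′ compat)))
      where
      sz = sizes ne W W′ compat
      word-ext : ∀ {W W′ : Word} → proj₁ W ≡ proj₁ W′ → W ≡ W′
      word-ext {w , eq} {_ , eq′} refl = cong (w ,_) (ℕₚ.≡-irrelevant eq eq′)

-- Canonical sequences

dir-unique : ∀ {d d′ a b} → a <[ d ] b → a <[ d′ ] b → d ≡ d′
dir-unique {true}  {true}  _ _ = refl
dir-unique {false} {false} _ _ = refl
dir-unique {true}  {false} x y = contradiction x (ℕₚ.<-asym y)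
dir-unique {false} {true}  x y = contradiction x (ℕₚ.<-asym y)

≢⇒<[] : ∀ {a b} → a ≢ b → ∃ λ d → a <[ d ] b
≢⇒<[] {a} {b} a≢b with <-cmp a b
... | tri< lt _ _ = true , lt
... | tri≈ _ eq _ = contradiction eq a≢b
... | tri> _ _ gt = false , gt

same⊎opposite : ∀ d d′ → d ≡ d′ ⊎ opposite d ≡ d′
same⊎opposite true  true  = inj₁ refl
same⊎opposite true  false = inj₂ refl
same⊎opposite false true  = inj₂ refl
same⊎opposite false false = inj₁ refl

opposite-involutive : ∀ d → opposite (opposite d) ≡ d
opposite-involutive true  = refl
opposite-involutive false = refl

Tracks-window : ∀ {w p q} o n → o + n ≤ w → Tracks w p q → Tracks n (p ∘ (o +_)) (q ∘ (o +_))
Tracks-window {w} {p} {q} o n le (alternating d I order) =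
  alternating d (λ i<j j<n → I (ℕₚ.+-monoʳ-< o i<j) (shift j<n)) (window order)
  where
  shift : ∀ {i} → i < n → o + i < w
  shift i<n = ≤-trans (ℕₚ.+-monoʳ-< o i<n) le
  window : (∀ {i} → i < w → p i <[ d ] q i) ⊎ (∀ {i} → i < w → q i <[ d ] p i) →
    (∀ {i} → i < n → p (o + i) <[ d ] q (o + i)) ⊎ (∀ {i} → i < n → q (o + i) <[ d ] p (o + i))
  window (inj₁ f) = inj₁ (f ∘ shift)
  window (inj₂ f) = inj₂ (f ∘ shift)
Tracks-window {w} o n le (separated d₁ d₂ δ m₁ m₂ s) =
  separated d₁ d₂ δ (λ i<j j<n → m₁ (ℕₚ.+-monoʳ-< o i<j) (shift j<n)) (λ i<j j<n → m₂ (ℕₚ.+-monoʳ-< o i<j) (shift j<n))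
    (λ i<n j<n → s (shift i<n) (shift j<n))
  where
  shift : ∀ {i} → i < n → o + i < w
  shift i<n = ≤-trans (ℕₚ.+-monoʳ-< o i<n) le

-- A choice of one of three indices and of one of four sequences.
Point : Set
Point = Fin 3 × Fin 4

choose : {A : Set} → A → A → A → Fin 3 → A
choose x y z 0F = x
choose x y z 1F = y
choose x y z 2F = z

-- The colours and the order of the points P s i, P s j, P s k with i < j < k
-- do not depend on i, j, k.
record Canonical (K : 𝒞₃) (m : ℕ) : Set where
  open Colour K
  field
    P : Fin 4 → ℕ → ℕ
  pt : ℕ → ℕ → ℕ → Point → ℕ
  pt i j k (x , s) = P s (choose i j k x)
  field
    -- The range `2 + m` allows padding: a statement about one or two indices below m becomes one
    -- about an increasing triple.
    hom-col : ∀ α β γ {i j k i′ j′ k′} → i < j → j < k → k < 2 + m → i′ < j′ → j′ < k′ → k′ < 2 + m →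
      col (pt i j k α) (pt i j k β) (pt i j k γ) ≡ col (pt i′ j′ k′ α) (pt i′ j′ k′ β) (pt i′ j′ k′ γ)
    hom-lt  : ∀ α β {i j k i′ j′ k′} → i < j → j < k → k < 2 + m → i′ < j′ → j′ < k′ → k′ < 2 + m →
      pt i j k α < pt i j k β → pt i′ j′ k′ α < pt i′ j′ k′ β
    P<N     : ∀ s {i} → i < m → P s i < N
    P-injˢ  : ∀ {s t i} → i < m → P s i ≡ P t i → s ≡ t
    -- The direction is `false` because the breaks will be listed from right to left.
    ab-track : Interleaved false (P 0F) (P 1F) m
    break   : ∀ {i} → i < m → col (P 0F i) (P 2F i) (P 3F i) ≢ col (P 1F i) (P 2F i) (P 3F i)

module CanonicalOrder {K m} (S : Canonical K m) (3≤m : 3 ≤ m) where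
  open Canonical S
  open Colour K

  private
    next : ∀ {i} → i < m → suc i < 2 + m
    next lt = ≤-trans (s≤s lt) (n≤1+n _)

    next₂ : ∀ {i} → i < m → suc (suc i) < 2 + m
    next₂ lt = s≤s (s≤s lt)

    0<m : 0 < m
    0<m = ≤-trans (s≤s z≤n) 3≤m
    1<m : 1 < m
    1<m = ≤-trans (s≤s (s≤s z≤n)) 3≤m
    2<m : 2 < m
    2<m = 3≤m
    0<1 : 0 < 1
    0<1 = s≤s z≤n
    1<2 : 1 < 2
    1<2 = s≤s (s≤s z≤n)

  lt₂ : ∀ s t {i j i′ j′} → i < j → j < m → i′ < j′ → j′ < m → P s i < P t j → P s i′ < P t j′
  lt₂ s t i<j j<m i<j′ j<m′ = hom-lt (0F , s) (1F , t) i<j (≤-refl) (next j<m) i<j′ (≤-refl) (next j<m′)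

  gt₂ : ∀ s t {i j i′ j′} → i < j → j < m → i′ < j′ → j′ < m → P t j < P s i → P t j′ < P s i′
  gt₂ s t i<j j<m i<j′ j<m′ = hom-lt (1F , t) (0F , s) i<j (≤-refl) (next j<m) i<j′ (≤-refl) (next j<m′)

  lt₁ : ∀ s t {i i′} → i < m → i′ < m → P s i < P t i → P s i′ < P t i′
  lt₁ s t i<m i<m′ = hom-lt (0F , s) (0F , t) (≤-refl) (≤-refl) (next₂ i<m) (≤-refl) (≤-refl) (next₂ i<m′)

  dir₂ : ∀ d s t {i j i′ j′} → i < j → j < m → i′ < j′ → j′ < m → P s i <[ d ] P t j → P s i′ <[ d ] P t j′
  dir₂ true  s t = lt₂ s t
  dir₂ false s t = gt₂ s t

  dir₁ : ∀ d s t {i i′} → i < m → i′ < m → P s i <[ d ] P t i → P s i′ <[ d ] P t i′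
  dir₁ true  s t = lt₁ s t
  dir₁ false s t = lt₁ t s

  -- By homogeneity, small indices represent all: `C` stands for three increasing indices, `D₁` and
  -- `D₂` for a coincidence of the lower or of the upper two, `E` for three equal ones.
  C D₁ D₂ E : Fin 4 → Fin 4 → Fin 4 → Fin 2
  C  s t r = col (P s 0) (P t 1) (P r 2)
  D₁ s t r = col (P s 0) (P t 0) (P r 1)
  D₂ s t r = col (P s 0) (P t 1) (P r 1)
  E  s t r = col (P s 0) (P t 0) (P r 0)

  col-C : ∀ s t r {i j k} → i < j → j < k → k < m → col (P s i) (P t j) (P r k) ≡ C s t r
  col-C s t r i<j j<k k<m = hom-col (0F , s) (1F , t) (2F , r) i<j j<k (≤-trans k<m (m≤n+m m 2))
    0<1 1<2 (s≤s (s≤s 0<m))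

  col-D₁ : ∀ s t r {i k} → i < k → k < m → col (P s i) (P t i) (P r k) ≡ D₁ s t r
  col-D₁ s t r i<k k<m = hom-col (0F , s) (0F , t) (1F , r) i<k (≤-refl) (next k<m) 0<1 1<2 (s≤s (s≤s 0<m))

  col-D₂ : ∀ s t r {i j} → i < j → j < m → col (P s i) (P t j) (P r j) ≡ D₂ s t r
  col-D₂ s t r i<j j<m = hom-col (0F , s) (1F , t) (1F , r) i<j (≤-refl) (next j<m) 0<1 1<2 (s≤s (s≤s 0<m))

  col-E : ∀ s t r {i} → i < m → col (P s i) (P t i) (P r i) ≡ E s t r
  col-E s t r i<m = hom-col (0F , s) (0F , t) (0F , r) (≤-refl) (≤-refl) (next₂ i<m) 0<1 1<2 (s≤s (s≤s 0<m))

  -- One inequality decides: by homogeneity a sequence is either injective or constant on the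
  -- indices below m.
  Varying : Fin 4 → Set
  Varying s = P s 0 ≢ P s 1

  eq₂ : ∀ s t {i j i′ j′} → i < j → j < m → i′ < j′ → j′ < m → P s i ≡ P t j → P s i′ ≡ P t j′
  eq₂ s t {i} {j} {i′} {j′} i<j j<m i<j′ j<m′ eq with <-cmp (P s i′) (P t j′)
  ... | tri< lt _ _ = contradiction eq (<⇒≢ (lt₂ s t i<j′ j<m′ i<j j<m lt))
  ... | tri≈ _ e _  = e
  ... | tri> _ _ gt = contradiction eq (>⇒≢ (gt₂ s t i<j′ j<m′ i<j j<m gt))

  -- An equality at one pair i < j would hold at all such pairs; changing only one of the indices
  -- then makes a varying sequence repeat a value.
  distinct₂ : ∀ s t → Varying s ⊎ Varying t → ∀ {i j} → i < j → j < m → P s i ≢ P t j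
  distinct₂ s t (inj₁ vs) i<j j<m eq = vs (trans (eq₂ s t i<j j<m (s≤s z≤n) 2<m eq) (sym (eq₂ s t i<j j<m 1<2 2<m eq)))
  distinct₂ s t (inj₂ vt) i<j j<m eq = vt (eq₂ t t 1<2 2<m 0<1 1<m
    (trans (sym (eq₂ s t i<j j<m 0<1 1<m eq)) (eq₂ s t i<j j<m (s≤s z≤n) 2<m eq)))

  constant : ∀ s → P s 0 ≡ P s 1 → ∀ {i} → i < m → P s 0 ≡ P s i
  constant s eq {zero}  _   = refl
  constant s eq {suc i} i<m = eq₂ s s 0<1 1<m (s≤s z≤n) i<m eq

  P-inj : ∀ {s t i j} → Varying s → Varying t → i < m → j < m → P s i ≡ P t j → s ≡ t × i ≡ j
  P-inj {s} {t} {i} {j} vs vt i<m j<m eq with <-cmp i j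
  ... | tri< i<j _ _  = contradiction eq (distinct₂ s t (inj₁ vs) i<j j<m)
  ... | tri≈ _ refl _ = P-injˢ i<m eq , refl
  ... | tri> _ _ j<i  = contradiction (sym eq) (distinct₂ t s (inj₁ vt) j<i i<m)

  direction : ∀ s t → Varying s ⊎ Varying t → ∃ λ d → ∀ {i j} → i < j → j < m → P s i <[ d ] P t j
  direction s t v with ≢⇒<[] (distinct₂ s t v 0<1 1<m)
  ... | d , lt = d , λ i<j j<m → dir₂ d s t 0<1 1<m i<j j<m lt

  direction₀ : ∀ {s t} → s ≢ t → ∃ λ d → ∀ {i} → i < m → P s i <[ d ] P t i
  direction₀ {s} {t} s≢t with ≢⇒<[] {P s 0} {P t 0} (s≢t ∘ P-injˢ 0<m)
  ... | d , lt = d , λ i<m → dir₁ d s t 0<m i<m lt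

  Alt : Fin 4 → Fin 4 → Set
  Alt s t = ∃ λ d → Interleaved d (P s) (P t) m ×
    ((∀ {i} → i < m → P s i <[ d ] P t i) ⊎ (∀ {i} → i < m → P t i <[ d ] P s i))

  Sep : Bool → Fin 4 → Fin 4 → Set
  Sep d s t = ∀ {i j} → i < m → j < m → P s i <[ d ] P t j

  Sep-sym : ∀ {d s t} → Sep d s t → Sep (opposite d) t s
  Sep-sym {d} sep i<m j<m = <[]-opposite d (sep j<m i<m)

  -- For i < j compare the direction from `P s i` to `P t j` with that from `P t i` to `P s j`. If
  -- they agree, the sequences alternate. If they are opposite, s is on one side of t at different
  -- indices, and the monotonicity of t extends this to equal ones.
  relation : ∀ {s t} → s ≢ t → Varying s → Varying t → Alt s t ⊎ ∃ λ d → Sep d s t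
  relation {s} {t} s≢t vs vt
    with direction s t (inj₁ vs) | direction t s (inj₁ vt) | direction₀ s≢t | direction s s (inj₁ vs) | direction t t (inj₁ vt)
  ... | d , f | d′ , g | d₀ , h | dₛ , fₛ | dₜ , fₜ with same⊎opposite d d′
  ...   | inj₁ refl = inj₁ (d , inter , order)
    where
    dₛ≡d : d ≡ dₛ
    dₛ≡d = dir-unique {d} {dₛ} (<[]-trans d (f 0<1 1<m) (g 1<2 2<m)) (fₛ (s≤s z≤n) 2<m)
    dₜ≡d : d ≡ dₜ
    dₜ≡d = dir-unique {d} {dₜ} (<[]-trans d (g 0<1 1<m) (f 1<2 2<m)) (fₜ (s≤s z≤n) 2<m)
    inter : Interleaved d (P s) (P t) m
    inter {i} {j} i<j j<m =
      (subst (λ x → P s i <[ x ] P s j) (sym dₛ≡d) (fₛ i<j j<m) , f i<j j<m) ,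
      (g i<j j<m , subst (λ x → P t i <[ x ] P t j) (sym dₜ≡d) (fₜ i<j j<m))
    order : (∀ {i} → i < m → P s i <[ d ] P t i) ⊎ (∀ {i} → i < m → P t i <[ d ] P s i)
    order with same⊎opposite d₀ d
    ... | inj₁ refl = inj₁ h
    ... | inj₂ refl = inj₂ (λ i<m → <[]-opposite d₀ (h i<m))
  ...   | inj₂ refl = inj₂ (d , sep)
    where
    g′ : ∀ {i j} → j < i → i < m → P s i <[ d ] P t j
    g′ {i} {j} j<i i<m = subst (λ x → P s i <[ x ] P t j) (opposite-involutive d) (<[]-opposite (opposite d) (g j<i i<m))
    d₀≡d : d₀ ≡ d
    d₀≡d with same⊎opposite d₀ d | same⊎opposite d dₜ
    ... | inj₁ eq | _ = eq
    ... | inj₂ refl | inj₁ refl = contradiction (<[]-trans d (g′ 0<1 1<m) (fₜ 0<1 1<m)) (<[]-asym d (<[]-opposite d₀ (h 1<m)))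
    ... | inj₂ refl | inj₂ refl = contradiction
      (<[]-trans d (f 1<2 2<m) (subst (λ x → P t 2 <[ x ] P t 1) (opposite-involutive d) (<[]-opposite (opposite d) (fₜ 1<2 2<m))))
      (<[]-asym d (<[]-opposite d₀ (h 1<m)))
    sep : Sep d s t
    sep {i} {j} i<m j<m with <-cmp i j
    ... | tri< i<j _ _  = f i<j j<m
    ... | tri≈ _ refl _ = subst (λ x → P s i <[ x ] P t i) d₀≡d (h i<m)
    ... | tri> _ _ j<i  = g′ j<i i<m

  tracks : ∀ {s t} → s ≢ t → Varying s → Varying t → Tracks m (P s) (P t)
  tracks {s} {t} s≢t vs vt with relation s≢t vs vt | direction s s (inj₁ vs) | direction t t (inj₁ vt)
  ... | inj₁ (d , I , order) | _ | _ = alternating d I order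
  ... | inj₂ (d , sep) | dₛ , fₛ | dₜ , fₜ = separated dₛ dₜ d fₛ fₜ sep

  -- Between `P t 1` and all of r there is a point of s, so r lies on one side of `P t 1`. A
  -- sequence alternating with t would pass it.
  Sep-Alt : ∀ {s t r d} → Varying s → Varying t → Varying r → t ≢ r → Alt s t → Sep d s r → Sep d t r
  Sep-Alt {s} {t} {r} {d} vs vt vr t≢r (d′ , I , _) sep = go (relation t≢r vt vr)
    where
    beyond : ∀ {j} → j < m → P t 1 <[ d ] P r j
    beyond {j} j<m with same⊎opposite d′ d
    ... | inj₁ refl = <[]-trans d (proj₁ (proj₂ (I 1<2 2<m))) (sep 2<m j<m)
    ... | inj₂ refl = <[]-trans d (<[]-opposite d′ (proj₂ (proj₁ (I 0<1 1<m)))) (sep 0<m j<m)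
    go : Alt t r ⊎ (∃ λ d → Sep d t r) → Sep d t r
    go (inj₂ (d″ , sep′)) = subst (λ d → Sep d t r) (dir-unique {d″} {d} (sep′ 1<m 0<m) (beyond 0<m)) sep′
    go (inj₁ (d″ , I′ , _)) with same⊎opposite d″ d
    ... | inj₁ refl = contradiction (beyond 0<m) (<[]-asym d (proj₁ (proj₂ (I′ 0<1 1<m))))
    ... | inj₂ refl = contradiction (beyond 2<m) (<[]-asym d (<[]-opposite d″ (proj₂ (proj₁ (I′ 1<2 2<m)))))

κ-intro : ∀ {w L E R} (f : ℕ → ℕ → Fin 2) → (∀ {i j} → i < j → j < w → f i j ≡ L) → (∀ {i} → i < w → f i i ≡ E) →
  (∀ {i j} → j < i → i < w → f i j ≡ R) → ∀ {i j} → i < w → j < w → f i j ≡ κ L E R i j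
κ-intro {w} {L} {E} {R} f f< f≡ f> {i} {j} i<w j<w with <-cmp i j
... | tri< i<j _ _  = trans (f< i<j j<w) (sym (κ-< L E R i<j))
... | tri≈ _ refl _ = trans (f≡ i<w) (sym (κ-refl L E R i))
... | tri> _ _ j<i  = trans (f> j<i i<w) (sym (κ-> L E R j<i))

-- Background colours of canonical sequences

module CanonicalColour {ℓ} (X : Pred 𝒞₃ ℓ) (ideal : IsIdeal X) (n : ℕ) .{{n≢0 : NonZero n}} (23≤n : 23 ≤ n)
  (few : ¬ Many X n) (K : 𝒞₃) (K∈X : X K) (S : Canonical K (4 + n)) where

  private
    m : ℕ
    m = 4 + n

    3≤m : 3 ≤ m
    3≤m = s≤s (s≤s (s≤s z≤n))

    2≤n : 2 ≤ n
    2≤n = ≤-trans (s≤s (s≤s z≤n)) 23≤n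

  open Canonical S
  open CanonicalOrder S 3≤m
  open Colour K
  open Families X ideal n 23≤n few K K∈X
  open Links X ideal n 23≤n few K K∈X

  private
    low : ∀ {i} → i < n → i < m
    low lt = ≤-trans lt (m≤n+m n 4)

    low₁ : ∀ {i} → i < n → suc i < m
    low₁ lt = ≤-trans (s≤s lt) (m≤n+m (1 + n) 3)

    n<m : n < m
    n<m = m≤n+m (1 + n) 3

    1+n<m : suc n < m
    1+n<m = m≤n+m (2 + n) 2

    0<m : 0 < m
    0<m = s≤s z≤n

  -- The fixed point has index 0, and the other two range over the indices 1 to n. The three colours
  -- are L, E and R in the link of the fixed point.
  link-low : ∀ r {s t} → s ≢ t → Varying s → Varying t → C r s t ≡ D₂ r s t × D₂ r s t ≡ C r t s
  link-low r {s} {t} s≢t vs vt with direction r s (inj₂ vs) | direction r t (inj₂ vt)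
  ... | β₁ , f | β₂ , g = link-constant (P r 0) (P s ∘ (1 +_)) (P t ∘ (1 +_))
    (P<N r 0<m) (P<N s ∘ low₁) (P<N t ∘ low₁) (C r s s) (C r t t) (C r s t) (D₂ r s t) (C r t s)
    (λ i<j j<n → col-C r s s (s≤s z≤n) (s≤s i<j) (low₁ j<n))
    (λ i<j j<n → col-C r t t (s≤s z≤n) (s≤s i<j) (low₁ j<n))
    (κ-intro (λ i j → col (P r 0) (P s (suc i)) (P t (suc j)))
      (λ i<j j<n → col-C r s t (s≤s z≤n) (s≤s i<j) (low₁ j<n))
      (λ i<n → col-D₂ r s t (s≤s z≤n) (low₁ i<n))
      (λ j<i i<n → trans (col-swap₂ _ _ _) (col-C r t s (s≤s z≤n) (s≤s j<i) (low₁ i<n))))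
    (Tracks-window 1 n (m≤n+m (1 + n) 3) (tracks s≢t vs vt)) β₁ β₂
    (λ i<n → f (s≤s z≤n) (low₁ i<n)) (λ i<n → g (s≤s z≤n) (low₁ i<n))

  link-high : ∀ r {s t} → s ≢ t → Varying s → Varying t → C s t r ≡ D₁ s t r × D₁ s t r ≡ C t s r
  link-high r {s} {t} s≢t vs vt with direction s r (inj₁ vs) | direction t r (inj₁ vt)
  ... | β₁ , f | β₂ , g = link-constant (P r n) (P s ∘ (0 +_)) (P t ∘ (0 +_))
    (P<N r n<m) (P<N s ∘ low) (P<N t ∘ low) (C s s r) (C t t r) (C s t r) (D₁ s t r) (C t s r)
    (λ i<j j<n → trans (col-rot _ _ _) (col-C s s r i<j j<n n<m))
    (λ i<j j<n → trans (col-rot _ _ _) (col-C t t r i<j j<n n<m))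
    (κ-intro (λ i j → col (P r n) (P s i) (P t j))
      (λ i<j j<n → trans (col-rot _ _ _) (col-C s t r i<j j<n n<m))
      (λ i<n → trans (col-rot _ _ _) (col-D₁ s t r i<n n<m))
      (λ j<i i<n → trans (col-swap₃ _ _ _) (col-C t s r j<i i<n n<m)))
    (Tracks-window 0 n (m≤n+m n 4) (tracks s≢t vs vt)) (opposite β₁) (opposite β₂)
    (λ i<n → <[]-opposite β₁ (f i<n n<m)) (λ i<n → <[]-opposite β₂ (g i<n n<m))

  fixedPair : ∀ {s t d z₁ z₂ β₁ β₂ β₃ β₄ c₁ c₂} → Interleaved d (P s) (P t) m → z₁ < N → z₂ < N → z₁ ≢ z₂ →
    Side β₁ z₁ (P s ∘ suc) n → Side β₂ z₁ (P t ∘ suc) n → Side β₃ z₂ (P s ∘ suc) n → Side β₄ z₂ (P t ∘ suc) n →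
    (∀ {i} → i < n → col z₁ z₂ (P s (suc i)) ≡ c₁) → (∀ {i} → i < n → col z₁ z₂ (P t (suc i)) ≡ c₂) → c₁ ≡ c₂
  fixedPair {s} {t} {d} {z₁} {z₂} {β₁} {β₂} {β₃} {β₄} {c₁} {c₂} I z₁<N z₂<N z₁≢z₂ S₁ S₂ S₃ S₄ col₁ col₂
    with sides-agree d β₁ β₂ {z₁} {P s ∘ suc} {P t ∘ suc} 2≤n (λ i<j j<n → I (s≤s i<j) (low₁ j<n)) S₁ S₂
       | sides-agree d β₃ β₄ {z₂} {P s ∘ suc} {P t ∘ suc} 2≤n (λ i<j j<n → I (s≤s i<j) (low₁ j<n)) S₃ S₄
  ... | refl | refl = TwoFixed.sameColour z₁ z₂ (P s ∘ suc) (P t ∘ suc) d β₁ β₃ n (m≤n+m n 2) z₁<N z₂<N z₁≢z₂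
    (λ i<j j<n → I (s≤s i<j) (low₁ j<n)) (P<N s ∘ low₁) (P<N t ∘ low₁) S₁ S₂ S₃ S₄ c₁ c₂ col₁ col₂

  left : ∀ r s → Varying s → ∃ λ β → Side β (P r 0) (P s ∘ suc) n
  left r s vs with direction r s (inj₂ vs)
  ... | β , f = β , λ i<n → f (s≤s z≤n) (low₁ i<n)

  right : ∀ s r → Varying s → ∃ λ β → Side β (P r (suc n)) (P s ∘ suc) n
  right s r vs with direction s r (inj₁ vs)
  ... | β , f = opposite β , λ i<n → <[]-opposite β (f (s≤s i<n) 1+n<m)

  -- The fixed points have the indices 0 and n + 1, with n indices of s and t between them. They are
  -- distinct as soon as one of r, r′ varies, even if r and r′ coincide.
  Alt-C : ∀ {r r′ s t} → Varying r ⊎ Varying r′ → Varying s → Varying t → Alt s t → C r s r′ ≡ C r t r′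
  Alt-C {r} {r′} {s} {t} vr vs vt (d , I , _) = fixedPair {s} {t} I
    (P<N r 0<m) (P<N r′ 1+n<m) (distinct₂ r r′ vr (s≤s z≤n) 1+n<m)
    (proj₂ (left r s vs)) (proj₂ (left r t vt)) (proj₂ (right s r′ vs)) (proj₂ (right t r′ vt))
    (λ i<n → trans (col-swap₂ _ _ _) (col-C r s r′ (s≤s z≤n) (s≤s i<n) 1+n<m))
    (λ i<n → trans (col-swap₂ _ _ _) (col-C r t r′ (s≤s z≤n) (s≤s i<n) 1+n<m))

  v₀ : Varying 0F
  v₀ = <[]⇒≢ false (proj₁ (proj₁ (ab-track (s≤s z≤n) (≤-trans (s≤s (s≤s z≤n)) 3≤m))))

  v₁ : Varying 1F
  v₁ = <[]⇒≢ false (proj₂ (proj₂ (ab-track (s≤s z≤n) (≤-trans (s≤s (s≤s z≤n)) 3≤m))))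

  alt₀₁ : Alt 0F 1F
  alt₀₁ with relation {0F} {1F} (λ ()) v₀ v₁
  ... | inj₁ alt = alt
  ... | inj₂ (true  , sep) = contradiction (sep 0<m (low₁ {0} (<⇒≤ 2≤n))) (ℕₚ.<-asym (proj₂ (proj₁ (ab-track (s≤s z≤n) (low₁ {0} (<⇒≤ 2≤n))))))
  ... | inj₂ (false , sep) = contradiction (sep (low₁ {0} (<⇒≤ 2≤n)) 0<m) (ℕₚ.<-asym (proj₁ (proj₂ (ab-track (s≤s z≤n) (low₁ {0} (<⇒≤ 2≤n))))))

  break-E : E 0F 2F 3F ≢ E 1F 2F 3F
  break-E = break 0<m

  -- The constant vertices u and v are themselves the two fixed points, and they cannot tell the a's
  -- from the b's.
  bothConstant : P 2F 0 ≡ P 2F 1 → P 3F 0 ≡ P 3F 1 → ⊥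
  bothConstant eq₂′ eq₃ = break-E (fixedPair {0F} {1F} {false} ab-track
    (P<N 2F 0<m) (P<N 3F 0<m) (λ eq → contradiction (P-injˢ 0<m eq) λ ())
    (proj₂ (left 2F 0F v₀)) (proj₂ (left 2F 1F v₁)) (proj₂ (left 3F 0F v₀)) (proj₂ (left 3F 1F v₁))
    (λ i<n → colour 0F (low₁ i<n)) (λ i<n → colour 1F (low₁ i<n)))
    where
    colour : ∀ s {i} → i < m → col (P 2F 0) (P 3F 0) (P s i) ≡ E s 2F 3F
    colour s {i} i<m = trans (col-cong (constant 2F eq₂′ i<m) (constant 3F eq₃ i<m) refl)
      (trans (sym (col-rot _ _ _)) (col-E s 2F 3F i<m))

  -- A constant vertex has every index, so `D₂ u a v` is also `E u a v`: its link reaches three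
  -- equal indices.
  oneConstant : ∀ u {v} → P u 0 ≡ P u 1 → Varying v → v ≢ 0F → v ≢ 1F → E u 0F v ≡ E u 1F v
  oneConstant u {v} eq vv v≢0 v≢1 = trans (sym (via v₀ (v≢0 ∘ sym))) (trans (Alt-C (inj₂ vv) v₀ v₁ alt₀₁) (via v₁ (v≢1 ∘ sym)))
    where
    via : ∀ {a} → Varying a → a ≢ v → C u a v ≡ E u a v
    via {a} va a≢v = trans (proj₁ (link-low u a≢v va vv))
      (trans (col-cong eq refl refl) (col-E u a v {1} (low₁ {0} (<⇒≤ 2≤n))))

  module AllVarying (v : ∀ s → Varying s) where

    C-swap₁ : ∀ s t r → C s t r ≡ C t s r
    C-swap₁ s t r with s Finₚ.≟ t
    ... | yes refl = refl
    ... | no  s≢t  = trans (proj₁ (link-high r s≢t (v s) (v t))) (proj₂ (link-high r s≢t (v s) (v t)))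

    C-swap₂ : ∀ s t r → C s t r ≡ C s r t
    C-swap₂ s t r with t Finₚ.≟ r
    ... | yes refl = refl
    ... | no  t≢r  = trans (proj₁ (link-low s t≢r (v t) (v r))) (proj₂ (link-low s t≢r (v t) (v r)))

    C-rot : ∀ s t r → C s t r ≡ C t r s
    C-rot s t r = trans (C-swap₁ s t r) (C-swap₂ t s r)

    C-swap₃ : ∀ s t r → C s t r ≡ C r t s
    C-swap₃ s t r = trans (C-rot s t r) (C-swap₁ t r s)

    C-Alt : ∀ {s t} → Alt s t → ∀ r r′ → C s r r′ ≡ C t r r′
    C-Alt {s} {t} alt r r′ = trans (C-swap₁ s r r′) (trans (Alt-C (inj₁ (v r)) (v s) (v t) alt) (C-swap₁ r t r′))

    -- Since `C` is symmetric the indices may be sorted; if two of them coincide, the link of the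
    -- third point turns `D₁` or `D₂` into `C`.
    background : ∀ {s t r i j k} → i < m → j < m → k < m → ¬ (i ≡ j × j ≡ k) →
      P s i ≢ P t j → P t j ≢ P r k → P s i ≢ P r k → col (P s i) (P t j) (P r k) ≡ C s t r
    background {s} {t} {r} {i} {j} {k} i<m j<m k<m notAll st tr sr
      with <-cmp i j | <-cmp j k | <-cmp i k
    ... | tri< i<j _ _ | tri< j<k _ _ | _ = col-C s t r i<j j<k k<m
    ... | tri< i<j _ _ | tri≈ _ refl _ | _ = trans (col-D₂ s t r i<j j<m) (sym (proj₁ (link-low s (tr ∘ λ eq → cong (λ x → P x j) eq) (v t) (v r))))
    ... | tri< i<j _ _ | tri> _ _ k<j | tri< i<k _ _ = trans (col-swap₂ _ _ _) (trans (col-C s r t i<k k<j j<m) (C-swap₂ s r t))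
    ... | tri< i<j _ _ | tri> _ _ k<j | tri≈ _ refl _ = trans (col-swap₂ _ _ _) (trans (col-D₁ s r t i<j j<m)
            (trans (sym (proj₁ (link-high t (sr ∘ λ eq → cong (λ x → P x i) eq) (v s) (v r)))) (C-swap₂ s r t)))
    ... | tri< i<j _ _ | tri> _ _ k<j | tri> _ _ k<i = trans (sym (col-rot _ _ _)) (trans (col-C r s t k<i i<j j<m) (C-rot r s t))
    ... | tri≈ _ refl _ | tri< j<k _ _ | _ = trans (col-D₁ s t r j<k k<m) (sym (proj₁ (link-high r (st ∘ λ eq → cong (λ x → P x i) eq) (v s) (v t))))
    ... | tri≈ _ refl _ | tri≈ _ refl _ | _ = contradiction (refl , refl) notAll
    ... | tri≈ _ refl _ | tri> _ _ k<j | _ = trans (sym (col-rot _ _ _)) (trans (col-D₂ r s t k<j j<m)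
            (trans (sym (proj₁ (link-low r (st ∘ λ eq → cong (λ x → P x i) eq) (v s) (v t)))) (C-rot r s t)))
    ... | tri> _ _ j<i | _ | tri< i<k _ _ = trans (col-swap₁ _ _ _) (trans (col-C t s r j<i i<k k<m) (C-swap₁ t s r))
    ... | tri> _ _ j<i | _ | tri≈ _ refl _ = trans (col-swap₁ _ _ _) (trans (col-D₂ t s r j<i i<m)
            (trans (sym (proj₁ (link-low t (sr ∘ λ eq → cong (λ x → P x i) eq) (v s) (v r)))) (C-swap₁ t s r)))
    ... | tri> _ _ j<i | tri< j<k _ _ | tri> _ _ k<i = trans (col-rot _ _ _) (trans (col-C t r s j<k k<i i<m) (sym (C-rot s t r)))
    ... | tri> _ _ j<i | tri≈ _ refl _ | tri> _ _ k<i = trans (col-rot _ _ _) (trans (col-D₁ t r s j<i i<m)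
            (trans (sym (proj₁ (link-high s (tr ∘ λ eq → cong (λ x → P x j) eq) (v t) (v r)))) (sym (C-rot s t r))))
    ... | tri> _ _ j<i | tri> _ _ k<j | tri> _ _ k<i = trans (col-swap₃ _ _ _) (trans (col-C r t s k<j j<i i<m) (C-swap₃ r t s))

-- No exceptional colour at three equal indices

choose-injective : ∀ {A : Set} {x y z : A} → x ≢ y → x ≢ z → y ≢ z → ∀ {s t} → choose x y z s ≡ choose x y z t → s ≡ t
choose-injective xy xz yz {0F} {0F} _ = refl
choose-injective xy xz yz {1F} {1F} _ = refl
choose-injective xy xz yz {2F} {2F} _ = refl
choose-injective xy xz yz {0F} {1F} e = contradiction e xy
choose-injective xy xz yz {0F} {2F} e = contradiction e xz
choose-injective xy xz yz {1F} {0F} e = contradiction (sym e) xy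
choose-injective xy xz yz {1F} {2F} e = contradiction e yz
choose-injective xy xz yz {2F} {0F} e = contradiction (sym e) xz
choose-injective xy xz yz {2F} {1F} e = contradiction (sym e) yz

module NoException {ℓ} (X : Pred 𝒞₃ ℓ) (ideal : IsIdeal X) (n : ℕ) .{{n≢0 : NonZero n}} (23≤n : 23 ≤ n)
  (few : ¬ Many X n) (K : 𝒞₃) (K∈X : X K) (S : Canonical K (4 + n)) where

  private
    m : ℕ
    m = 4 + n

    low : ∀ {i} → i < n → i < m
    low lt = ≤-trans lt (m≤n+m n 4)

    0<1 : 0 < 1
    0<1 = s≤s z≤n

    1<m : 1 < m
    1<m = s≤s (s≤s z≤n)

  open Canonical S
  open CanonicalOrder S (s≤s (s≤s (s≤s z≤n)))
  open CanonicalColour X ideal n 23≤n few K K∈X S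
  open Colour K

  module _ (v : ∀ s → Varying s) where
    open AllVarying v

    private
      Unexceptional : Fin 4 → Fin 4 → Fin 4 → Set
      Unexceptional x y z = C x y z ≡ E x y z

      swap₁ : ∀ {x y z} → Unexceptional x y z → Unexceptional y x z
      swap₁ {x} {y} {z} eq = trans (C-swap₁ y x z) (trans eq (col-swap₁ _ _ _))

      swap₂ : ∀ {x y z} → Unexceptional x y z → Unexceptional x z y
      swap₂ {x} {y} {z} eq = trans (C-swap₂ x z y) (trans eq (col-swap₂ _ _ _))

      mono : ∀ s → ∃ λ d → Monotone d (P s) n
      mono s with direction s s (inj₁ (v s))
      ... | d , f = d , λ i<j j<n → f i<j (low j<n)

      module _ {x y z : Fin 4} (x≢y : x ≢ y) (x≢z : x ≢ z) (y≢z : y ≢ z) where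

        σ : Fin 3 → Fin 4
        σ = choose x y z

        -- The systems built from this differ in how many sequences are on the track of x: all
        -- three, two, or x alone.
        viaSystem : (in₁ in₂ : Bool) (in₂⇒in₁ : in₂ ≡ true → in₁ ≡ true) (dA δ γ : Bool) →
          (∀ {s s′} → inTrack in₁ in₂ s ≡ true → inTrack in₁ in₂ s′ ≡ true → ∀ t r → C (σ s) t r ≡ C (σ s′) t r) →
          (∀ {s t i j} → inTrack in₁ in₂ s ≡ true → inTrack in₁ in₂ t ≡ true → i < j → j < n → P (σ s) i <[ dA ] P (σ t) j) →
          (in₁ ≡ true → ∀ {i} → i < n → P x i <[ dA ] P y i) → (in₂ ≡ true → ∀ {i} → i < n → P y i <[ dA ] P z i) →
          (in₁ ≡ false → in₂ ≡ false → ∀ {i j} → i < n → j < n → P y i <[ δ ] P z j) →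
          (∀ {s t i j} → inTrack in₁ in₂ s ≡ true → inTrack in₁ in₂ t ≡ false → i < n → j < n → P (σ s) i <[ γ ] P (σ t) j) →
          Unexceptional x y z
        viaSystem in₁ in₂ in₂⇒in₁ dA δ γ c-track A-mono order₁ order₂ U-V A-B =
          Triples.noException X ideal n 23≤n few K K∈X record
            { P = P ∘ σ ; in₁ = in₁ ; in₂ = in₂ ; in₂⇒in₁ = in₂⇒in₁
            ; c = λ s t r → C (σ s) (σ t) (σ r) ; e = E x y z
            ; P<N = λ s i<n → P<N (σ s) (low i<n)
            ; P-inj = λ {s} {t} i<n j<n eq → let e₁ , e₂ = P-inj (v (σ s)) (v (σ t)) (low i<n) (low j<n) eq in
                choose-injective x≢y x≢z y≢z e₁ , e₂
            ; bg = λ i<n j<n k<n → background (low i<n) (low j<n) (low k<n)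
            ; c-swap₁ = λ s t r → C-swap₁ (σ s) (σ t) (σ r)
            ; c-swap₂ = λ s t r → C-swap₂ (σ s) (σ t) (σ r)
            ; c-track = λ s∈ s′∈ t r → c-track s∈ s′∈ (σ t) (σ r)
            ; special = λ i<n → col-E x y z (low i<n)
            ; dA = dA ; d₁ = proj₁ (mono y) ; d₂ = proj₁ (mono z) ; δ = δ ; γ = γ
            ; A-mono = λ {s} {t} → A-mono {s} {t} ; order₁ = order₁ ; order₂ = order₂
            ; mono₁ = proj₂ (mono y) ; mono₂ = proj₂ (mono z) ; U-V = U-V ; A-B = λ {s} {t} → A-B {s} {t}
            }

        oneTrack : (a₁ : Alt x y) (a₂ : Alt y z) → Alt x z →
          (∀ {i} → i < m → P x i <[ proj₁ a₁ ] P y i) → (∀ {i} → i < m → P y i <[ proj₁ a₁ ] P z i) → Unexceptional x y z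
        oneTrack a₁@(d , I₁ , _) a₂@(d₂ , I₂ , _) a₃@(d₃ , I₃ , _) x<y y<z =
          viaSystem true true id d d d track mono′ (λ _ → x<y ∘ low) (λ _ → y<z ∘ low) (λ ()) (λ {s} {t} → absurd s t)
          where
          absurd : ∀ s t {i j} → inTrack true true s ≡ true → inTrack true true t ≡ false → i < n → j < n → P (σ s) i <[ d ] P (σ t) j
          absurd s 0F _ ()
          absurd s 1F _ ()
          absurd s 2F _ ()
          d≡d₂ : d ≡ d₂
          d≡d₂ = dir-unique {d} {d₂} (proj₂ (proj₂ (I₁ 0<1 1<m))) (proj₁ (proj₁ (I₂ 0<1 1<m)))
          d≡d₃ : d ≡ d₃
          d≡d₃ = dir-unique {d} {d₃} (proj₁ (proj₁ (I₁ 0<1 1<m))) (proj₁ (proj₁ (I₃ 0<1 1<m)))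
          track₀ : ∀ s t r → C (σ s) t r ≡ C x t r
          track₀ 0F t r = refl
          track₀ 1F t r = sym (C-Alt a₁ t r)
          track₀ 2F t r = sym (C-Alt a₃ t r)
          track : ∀ {s s′} → inTrack true true s ≡ true → inTrack true true s′ ≡ true → ∀ t r → C (σ s) t r ≡ C (σ s′) t r
          track {s} {s′} _ _ t r = trans (track₀ s t r) (sym (track₀ s′ t r))
          pairs : ∀ s t {i j} → i < j → j < m → P (σ s) i <[ d ] P (σ t) j
          pairs 0F 0F lt h = proj₁ (proj₁ (I₁ lt h))
          pairs 0F 1F lt h = proj₂ (proj₁ (I₁ lt h))
          pairs 1F 0F lt h = proj₁ (proj₂ (I₁ lt h))
          pairs 1F 1F lt h = proj₂ (proj₂ (I₁ lt h))
          pairs 0F 2F {i} {j} lt h = subst (λ d → P x i <[ d ] P z j) (sym d≡d₃) (proj₂ (proj₁ (I₃ lt h)))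
          pairs 2F 0F {i} {j} lt h = subst (λ d → P z i <[ d ] P x j) (sym d≡d₃) (proj₁ (proj₂ (I₃ lt h)))
          pairs 2F 2F {i} {j} lt h = subst (λ d → P z i <[ d ] P z j) (sym d≡d₃) (proj₂ (proj₂ (I₃ lt h)))
          pairs 1F 2F {i} {j} lt h = subst (λ d → P y i <[ d ] P z j) (sym d≡d₂) (proj₂ (proj₁ (I₂ lt h)))
          pairs 2F 1F {i} {j} lt h = subst (λ d → P z i <[ d ] P y j) (sym d≡d₂) (proj₁ (proj₂ (I₂ lt h)))
          mono′ : ∀ {s t i j} → inTrack true true s ≡ true → inTrack true true t ≡ true → i < j → j < n → P (σ s) i <[ d ] P (σ t) j
          mono′ {s} {t} _ _ lt h = pairs s t lt (low h)

        pairAndSingle : (a : Alt x y) → (∀ {i} → i < m → P x i <[ proj₁ a ] P y i) → ∀ {γ} → Sep γ x z → Unexceptional x y z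
        pairAndSingle a@(d , I , _) x<y {γ} sep =
          viaSystem true false (λ ()) d d γ (λ {s} {s′} → track s s′) (λ {s} {t} → mono′ s t) (λ _ → x<y ∘ low) (λ ()) (λ ()) (λ {s} {t} → aside s t)
          where
          sep′ : Sep γ y z
          sep′ = Sep-Alt (v x) (v y) (v z) y≢z a sep
          track : ∀ s s′ → inTrack true false s ≡ true → inTrack true false s′ ≡ true → ∀ t r → C (σ s) t r ≡ C (σ s′) t r
          track 0F 0F _ _ t r = refl
          track 0F 1F _ _ t r = C-Alt a t r
          track 1F 0F _ _ t r = sym (C-Alt a t r)
          track 1F 1F _ _ t r = refl
          track 2F _  () _ t r
          track 0F 2F _ () t r
          track 1F 2F _ () t r
          mono′ : ∀ s t {i j} → inTrack true false s ≡ true → inTrack true false t ≡ true → i < j → j < n → P (σ s) i <[ d ] P (σ t) j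
          mono′ 0F 0F _ _ lt h = proj₁ (proj₁ (I lt (low h)))
          mono′ 0F 1F _ _ lt h = proj₂ (proj₁ (I lt (low h)))
          mono′ 1F 0F _ _ lt h = proj₁ (proj₂ (I lt (low h)))
          mono′ 1F 1F _ _ lt h = proj₂ (proj₂ (I lt (low h)))
          mono′ 2F _  () _ lt h
          mono′ 0F 2F _ () lt h
          mono′ 1F 2F _ () lt h
          aside : ∀ s t {i j} → inTrack true false s ≡ true → inTrack true false t ≡ false → i < n → j < n → P (σ s) i <[ γ ] P (σ t) j
          aside 0F 2F _ _ i<n j<n = sep (low i<n) (low j<n)
          aside 1F 2F _ _ i<n j<n = sep′ (low i<n) (low j<n)
          aside 2F _  () _
          aside 0F 0F _ ()
          aside 0F 1F _ ()
          aside 1F 0F _ ()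
          aside 1F 1F _ ()

        threeTracks : ∀ {γ δ} → Sep γ x y → Sep γ x z → Sep δ y z → Unexceptional x y z
        threeTracks {γ} {δ} xy xz yz =
          viaSystem false false (λ ()) (proj₁ (mono x)) δ γ (λ {s} {s′} → track s s′) (λ {s} {t} → mono′ s t) (λ ()) (λ ())
            (λ _ _ i<n j<n → yz (low i<n) (low j<n)) (λ {s} {t} → aside s t)
          where
          track : ∀ s s′ → inTrack false false s ≡ true → inTrack false false s′ ≡ true → ∀ t r → C (σ s) t r ≡ C (σ s′) t r
          track 0F 0F _ _ t r = refl
          track 1F _  () _ t r
          track 2F _  () _ t r
          track 0F 1F _ () t r
          track 0F 2F _ () t r
          mono′ : ∀ s t {i j} → inTrack false false s ≡ true → inTrack false false t ≡ true → i < j → j < n → P (σ s) i <[ proj₁ (mono x) ] P (σ t) j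
          mono′ 0F 0F _ _ lt h = proj₂ (mono x) lt h
          mono′ 1F _  () _ lt h
          mono′ 2F _  () _ lt h
          mono′ 0F 1F _ () lt h
          mono′ 0F 2F _ () lt h
          aside : ∀ s t {i j} → inTrack false false s ≡ true → inTrack false false t ≡ false → i < n → j < n → P (σ s) i <[ γ ] P (σ t) j
          aside 0F 1F _ _ i<n j<n = xy (low i<n) (low j<n)
          aside 0F 2F _ _ i<n j<n = xz (low i<n) (low j<n)
          aside 1F _  () _
          aside 2F _  () _
          aside 0F 0F _ ()

      Alt-sym : ∀ {s t} → Alt s t → Alt t s
      Alt-sym {s} {t} (d , I , order) = d , Interleaved-swap {d} {P s} {P t} I , [ inj₂ , inj₁ ]′ order

      altAndSep : ∀ {x y z} → x ≢ y → x ≢ z → y ≢ z → Alt x y → ∀ {γ} → Sep γ x z → Unexceptional x y z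
      altAndSep x≢y x≢z y≢z a@(d , I , inj₁ x<y) sep = pairAndSingle x≢y x≢z y≢z a x<y sep
      altAndSep {x} {y} {z} x≢y x≢z y≢z a@(d , I , inj₂ y<x) sep =
        swap₁ (pairAndSingle (x≢y ∘ sym) y≢z x≢z (Alt-sym a) y<x (Sep-Alt (v x) (v y) (v z) y≢z a sep))

      -- The three points of one index occur in the same order at every index; the sequences are
      -- permuted into that order.
      allAlt : ∀ {x y z} → x ≢ y → x ≢ z → y ≢ z → Alt x y → Alt y z → Alt x z → Unexceptional x y z
      allAlt {x} {y} {z} xy xz yz a₁@(d , I₁ , o₁) a₂@(d₂ , I₂ , o₂) a₃@(d₃ , I₃ , o₃)
        with dir-unique {d} {d₂} (proj₂ (proj₂ (I₁ 0<1 1<m))) (proj₁ (proj₁ (I₂ 0<1 1<m)))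
           | dir-unique {d} {d₃} (proj₁ (proj₁ (I₁ 0<1 1<m))) (proj₁ (proj₁ (I₃ 0<1 1<m)))
      ... | refl | refl = go o₁ o₂ o₃
        where
        go : (∀ {i} → i < m → P x i <[ d ] P y i) ⊎ (∀ {i} → i < m → P y i <[ d ] P x i) →
             (∀ {i} → i < m → P y i <[ d ] P z i) ⊎ (∀ {i} → i < m → P z i <[ d ] P y i) →
             (∀ {i} → i < m → P x i <[ d ] P z i) ⊎ (∀ {i} → i < m → P z i <[ d ] P x i) → Unexceptional x y z
        go (inj₁ x<y) (inj₁ y<z) _          = oneTrack xy xz yz a₁ a₂ a₃ x<y y<z
        go (inj₁ x<y) (inj₂ z<y) (inj₁ x<z) = swap₂ (oneTrack xz xy (yz ∘ sym) a₃ (Alt-sym a₂) a₁ x<z z<y)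
        go (inj₁ x<y) (inj₂ z<y) (inj₂ z<x) = swap₂ (swap₁ (oneTrack (xz ∘ sym) (yz ∘ sym) xy (Alt-sym a₃) a₁ (Alt-sym a₂) z<x x<y))
        go (inj₂ y<x) (inj₁ y<z) (inj₁ x<z) = swap₁ (oneTrack (xy ∘ sym) yz xz (Alt-sym a₁) a₃ a₂ y<x x<z)
        go (inj₂ y<x) (inj₁ y<z) (inj₂ z<x) = swap₁ (swap₂ (oneTrack yz (xy ∘ sym) (xz ∘ sym) a₂ (Alt-sym a₃) (Alt-sym a₁) y<z z<x))
        go (inj₂ y<x) (inj₂ z<y) _          =
          swap₁ (swap₂ (swap₁ (oneTrack (yz ∘ sym) (xz ∘ sym) (xy ∘ sym) (Alt-sym a₂) (Alt-sym a₁) (Alt-sym a₃) z<y y<x)))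

      -- The first sequence of a system has the other two on one side. If x lies between y and z,
      -- then y is taken first.
      allSep : ∀ {x y z} → x ≢ y → x ≢ z → y ≢ z → ∀ {d₁ d₂ d₃} → Sep d₁ x y → Sep d₂ x z → Sep d₃ y z → Unexceptional x y z
      allSep {x} {y} {z} xy xz yz {d₁} {d₂} {d₃} s₁ s₂ s₃ with same⊎opposite d₁ d₂
      ... | inj₁ refl = threeTracks xy xz yz s₁ s₂ s₃
      ... | inj₂ refl = swap₁ (threeTracks (xy ∘ sym) yz xz (Sep-sym {d₁} {x} {y} s₁) y-z s₂)
        where
        y-z : Sep (opposite d₁) y z
        y-z i<m j<m = <[]-trans (opposite d₁) (<[]-opposite d₁ (s₁ 1<m i<m)) (s₂ 1<m j<m)

    unexceptional : ∀ {x y z} → x ≢ y → x ≢ z → y ≢ z → C x y z ≡ E x y z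
    unexceptional {x} {y} {z} xy xz yz with relation xy (v x) (v y) | relation xz (v x) (v z) | relation yz (v y) (v z)
    ... | inj₁ a₁ | inj₁ a₂ | inj₁ a₃ = allAlt xy xz yz a₁ a₃ a₂
    ... | inj₁ a₁ | inj₂ (γ , s₂) | _ = altAndSep xy xz yz a₁ s₂
    ... | inj₁ a₁ | inj₁ a₂ | inj₂ (γ , s₃) = swap₁ (altAndSep (xy ∘ sym) yz xz (Alt-sym a₁) s₃)
    ... | inj₂ (γ , s₁) | inj₁ a₂ | _ = swap₂ (altAndSep xz xy (yz ∘ sym) a₂ s₁)
    ... | inj₂ (γ , s₁) | inj₂ (γ′ , s₂) | inj₁ a₃ =
      swap₁ (swap₂ (altAndSep yz (xy ∘ sym) (xz ∘ sym) a₃ (Sep-sym {γ} {x} {y} s₁)))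
    ... | inj₂ (γ , s₁) | inj₂ (γ′ , s₂) | inj₂ (γ″ , s₃) = allSep xy xz yz s₁ s₂ s₃

    -- `E` agrees with `C` on distinct sequences, and `C` does not distinguish the alternating
    -- sequences of the a's and the b's.
    noBreak : ⊥
    noBreak = break-E (trans (sym (unexceptional {0F} {2F} {3F} (λ ()) (λ ()) (λ ())))
      (trans (C-Alt alt₀₁ 2F 3F) (unexceptional {1F} {2F} {3F} (λ ()) (λ ()) (λ ()))))

  impossible : ⊥
  impossible with P 2F 0 ≟ P 2F 1 | P 3F 0 ≟ P 3F 1
  ... | yes e₂ | yes e₃ = bothConstant e₂ e₃
  ... | yes e₂ | no  v₃ = break-E (trans (col-swap₁ _ _ _) (trans (oneConstant 2F e₂ v₃ (λ ()) (λ ())) (col-swap₁ _ _ _)))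
  ... | no  v₂ | yes e₃ = break-E (trans (sym (col-rot _ _ _)) (trans (oneConstant 3F e₃ v₂ (λ ()) (λ ())) (col-rot _ _ _)))
  ... | no  v₂ | no  v₃ = noBreak all
    where
    all : ∀ s → Varying s
    all 0F = v₀
    all 1F = v₁
    all 2F = v₂
    all 3F = v₃

-- Breaks and polynomial growth

Quad : Set
Quad = Fin 4 → ℕ

AllPairs-⊆ : ∀ {A : Set} {R : A → A → Set} {xs x y} → AllPairs R xs → (x ∷ y ∷ []) ⊆ xs → R x y
AllPairs-⊆ (_ ∷ rs) (_ ∷ʳ s)   = AllPairs-⊆ rs s
AllPairs-⊆ (r ∷ rs) (refl ∷ s) = All.lookup r (to∈ s)

-- The vertices a < b of the quad (a,b,u,v) are told apart by the pair {u,v}.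
record IsQuad (K : 𝒞₃) (q : Quad) : Set where
  open Colour K
  field
    q<N     : ∀ s → q s < N
    q-inj   : ∀ {s t} → q s ≡ q t → s ≡ t
    a<b     : q 0F < q 1F
    differ  : col (q 0F) (q 2F) (q 3F) ≢ col (q 1F) (q 2F) (q 3F)

record Quads (K : 𝒞₃) (xs : List Quad) : Set where
  field
    quads    : ∀ {q} → q ∈ xs → IsQuad K q
    -- Quads are listed from right to left.
    disjoint : AllPairs (λ q q′ → q′ 1F < q 0F) xs

bit : Fin 2 → Bool
bit 0F = false
bit 1F = true

bit-injective : ∀ {x y} → bit x ≡ bit y → x ≡ y
bit-injective {0F} {0F} _ = refl
bit-injective {1F} {1F} _ = refl
bit-injective {0F} {1F} ()
bit-injective {1F} {0F} ()

-- The flag selects between a test of colour and a test of order. There are 2 · 12³ tests, whatever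
-- the coloring.
Test : Set
Test = Bool × Point × Point × Point

abstract
  allTests : List Test
  allTests = List.cartesianProduct (true ∷ false ∷ []) (List.cartesianProduct allPoints (List.cartesianProduct allPoints allPoints))
    where
    allPoints : List Point
    allPoints = List.cartesianProduct (List.allFin 3) (List.allFin 4)

  ∈-allTests : ∀ t → t ∈ allTests
  ∈-allTests (b , α , β , γ) = ∈-cartesianProduct⁺ (∈-bools b) (∈-cartesianProduct⁺ (∈-points α) (∈-cartesianProduct⁺ (∈-points β) (∈-points γ)))
    where
    ∈-bools : ∀ b → b ∈ true ∷ false ∷ []
    ∈-bools true  = here refl
    ∈-bools false = there (here refl)
    ∈-points : ∀ (α : Point) → α ∈ List.cartesianProduct (List.allFin 3) (List.allFin 4)
    ∈-points (x , s) = ∈-cartesianProduct⁺ (∈-allFin x) (∈-allFin s)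

module Tests (K : 𝒞₃) where
  open Colour K

  vertex : Quad → Quad → Quad → Point → ℕ
  vertex q₁ q₂ q₃ (x , s) = choose q₁ q₂ q₃ x s

  test : Test → List Quad → Bool
  test (true  , α , β , γ) (q₁ ∷ q₂ ∷ q₃ ∷ []) = bit (col (vertex q₁ q₂ q₃ α) (vertex q₁ q₂ q₃ β) (vertex q₁ q₂ q₃ γ))
  test (false , α , β , γ) (q₁ ∷ q₂ ∷ q₃ ∷ []) = vertex q₁ q₂ q₃ α <ᵇ vertex q₁ q₂ q₃ β
  test _ _ = false

  choose-map : ∀ {A B : Set} (f : A → B) x y z a → f (choose x y z a) ≡ choose (f x) (f y) (f z) a
  choose-map f x y z 0F = refl
  choose-map f x y z 1F = refl
  choose-map f x y z 2F = refl

  canonical : ∀ {m xs ys} → Quads K xs → ys ⊆ xs → 2 + m ≤ length ys →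
    (∀ {t} → t ∈ allTests → ∃ λ c → Hom 3 (test t) c ys) → Canonical K m
  canonical {m} {xs} {ys} Q ys⊆ len hom = record
    { P = P
    ; hom-col = λ α β γ → hom-col α β γ
    ; hom-lt = λ α β → hom-lt α β
    ; P<N = λ s i<m → IsQuad.q<N (isQuad (short i<m)) s
    ; P-injˢ = λ i<m → IsQuad.q-inj (isQuad (short i<m))
    ; ab-track = λ i<j j<m → interleave i<j (short j<m)
    ; break = λ i<m → IsQuad.differ (isQuad (short i<m))
    }
    where
    open Quads Q
    f : ℕ → Quad
    f = at (λ _ → 0) ys
    P : Fin 4 → ℕ → ℕ
    P s i = f i s
    short : ∀ {i} → i < m → i < length ys
    short i<m = ≤-trans i<m (≤-trans (m≤n+m m 2) len)
    isQuad : ∀ {i} → i < length ys → IsQuad K (f i)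
    isQuad lt = quads (Sublist.lookup ys⊆ (at-∈ (λ _ → 0) ys lt))
    pt : ℕ → ℕ → ℕ → Point → ℕ
    pt i j k (x , s) = P s (choose i j k x)
    vertex-pt : ∀ i j k α → vertex (f i) (f j) (f k) α ≡ pt i j k α
    vertex-pt i j k (x , s) = cong (λ q → q s) (sym (choose-map f i j k x))
    same : ∀ t {i j k i′ j′ k′} → i < j → j < k → k < 2 + m → i′ < j′ → j′ < k′ → k′ < 2 + m →
      test t (f i ∷ f j ∷ f k ∷ []) ≡ test t (f i′ ∷ f j′ ∷ f k′ ∷ [])
    same t i<j j<k k< i<j′ j<k′ k<′ with hom (∈-allTests t)
    ... | c , h = trans (h (at-⊆₃ (λ _ → 0) ys i<j j<k (≤-trans k< len)) refl)
                        (sym (h (at-⊆₃ (λ _ → 0) ys i<j′ j<k′ (≤-trans k<′ len)) refl))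
    hom-col : ∀ α β γ {i j k i′ j′ k′} → i < j → j < k → k < 2 + m → i′ < j′ → j′ < k′ → k′ < 2 + m →
      col (pt i j k α) (pt i j k β) (pt i j k γ) ≡ col (pt i′ j′ k′ α) (pt i′ j′ k′ β) (pt i′ j′ k′ γ)
    hom-col α β γ {i} {j} {k} {i′} {j′} {k′} i<j j<k k< i<j′ j<k′ k<′ =
      trans (sym (col-cong (vertex-pt i j k α) (vertex-pt i j k β) (vertex-pt i j k γ)))
        (trans (bit-injective (same (true , α , β , γ) i<j j<k k< i<j′ j<k′ k<′))
          (col-cong (vertex-pt i′ j′ k′ α) (vertex-pt i′ j′ k′ β) (vertex-pt i′ j′ k′ γ)))
    hom-lt : ∀ α β {i j k i′ j′ k′} → i < j → j < k → k < 2 + m → i′ < j′ → j′ < k′ → k′ < 2 + m →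
      pt i j k α < pt i j k β → pt i′ j′ k′ α < pt i′ j′ k′ β
    hom-lt α β {i} {j} {k} {i′} {j′} {k′} i<j j<k k< i<j′ j<k′ k<′ lt =
      subst₂ _<_ (vertex-pt i′ j′ k′ α) (vertex-pt i′ j′ k′ β)
        (ℕₚ.<ᵇ⇒< _ _ (subst T (same (false , α , β , α) i<j j<k k< i<j′ j<k′ k<′)
          (ℕₚ.<⇒<ᵇ (subst₂ _<_ (sym (vertex-pt i j k α)) (sym (vertex-pt i j k β)) lt))))
    interleave : ∀ {i j} → i < j → j < length ys →
      (P 0F j < P 0F i × P 1F j < P 0F i) × (P 0F j < P 1F i × P 1F j < P 1F i)
    interleave {i} {j} i<j j< = (<-trans aⱼ<bⱼ bⱼ<aᵢ , bⱼ<aᵢ) , (<-trans aⱼ<bⱼ (<-trans bⱼ<aᵢ aᵢ<bᵢ) , <-trans bⱼ<aᵢ aᵢ<bᵢ)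
      where
      bⱼ<aᵢ = AllPairs-⊆ disjoint (⊆-trans (at-⊆₂ (λ _ → 0) ys i<j j<) ys⊆)
      aⱼ<bⱼ = IsQuad.a<b (isQuad j<)
      aᵢ<bᵢ = IsQuad.a<b (isQuad (<-trans i<j j<))

boundedQuads : ∀ {ℓ} (X : Pred 𝒞₃ ℓ) → IsIdeal X → ∀ n → .{{_ : NonZero n}} → 23 ≤ n → ¬ Many X n →
  ∃ λ M → ∀ K → X K → ∀ xs → Quads K xs → length xs < M
-- `6 + n` is `2 + (4 + n)`: canonical sequences of length 4 + n together with their two spare
-- indices.
boundedQuads X ideal n 23≤n few with ramsey-family {A = Quad} allTests 3 (6 + n)
... | M , r = M , λ K K∈X xs Q → ℕₚ.≰⇒> λ M≤ → absurd K K∈X Q (r (Tests.test K) xs M≤)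
  where
  absurd : ∀ K → X K → ∀ {xs} → Quads K xs →
    ¬ ∃ (λ ys → ys ⊆ xs × 6 + n ≤ length ys × (∀ {t} → t ∈ allTests → ∃ λ c → Hom 3 (Tests.test K t) c ys))
  absurd K K∈X Q (ys , ys⊆ , len , hom) =
    NoException.impossible X ideal n 23≤n few K K∈X (Tests.canonical K Q ys⊆ len hom)

module Breaks (K : 𝒞₃) where
  open Colour K

  Separates : ℕ → ℕ → ℕ → Set
  Separates i u v = (u ≢ i × u ≢ suc i) × (v ≢ i × v ≢ suc i) × u ≢ v × col i u v ≢ col (suc i) u v

  Break : ℕ → Set
  Break i = suc i < N × ∃ λ u → u < N × ∃ λ v → v < N × Separates i u v

  separates? : ∀ i u v → Dec (Separates i u v)
  separates? i u v = (¬? (u ≟ i) ×-dec ¬? (u ≟ suc i)) ×-dec (¬? (v ≟ i) ×-dec ¬? (v ≟ suc i)) ×-dec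
    ¬? (u ≟ v) ×-dec ¬? (col i u v Finₚ.≟ col (suc i) u v)

  break? : ∀ i → Dec (Break i)
  break? i = (suc i <? N) ×-dec ℕₚ.anyUpTo? (λ u → ℕₚ.anyUpTo? (λ v → separates? i u v) N) N

  cover : List Quad → List ℕ
  cover []       = []
  cover (q ∷ xs) = q 0F ∷ q 1F ∷ cover xs

  length-cover : ∀ xs → length (cover xs) ≡ length xs * 2
  length-cover []       = refl
  length-cover (q ∷ xs) = cong (2 +_) (length-cover xs)

  ∈-cover : ∀ {q xs} → q ∈ xs → q 1F ∈ cover xs
  ∈-cover (here refl) = there (here refl)
  ∈-cover (there q∈)  = there (there (∈-cover q∈))

  -- A greedy choice from left to right: a break gets a new quad unless its position is covered
  -- already, which keeps the intervals from a to b disjoint. Each chosen quad accounts for at most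
  -- two breaks, at its a and at its b.
  record Scan (t : ℕ) : Set where
    field
      xs      : List Quad
      isQuads : Quads K xs
      top     : ∀ {q} → q ∈ xs → q 1F ≤ t
      covered : ∀ {i} → i < t → Break i → i ∈ cover xs

  quad : ∀ {i} → Break i → ∃ λ q → IsQuad K q × q 0F ≡ i × q 1F ≡ suc i
  quad {i} (i<N , u , u<N , v , v<N , (u≢i , u≢1+i) , (v≢i , v≢1+i) , u≢v , ne) = q , record
    { q<N = λ { 0F → <-trans ≤-refl i<N ; 1F → i<N ; 2F → u<N ; 3F → v<N }
    ; q-inj = λ {s} {t} → inj s t
    ; a<b = ≤-refl
    ; differ = ne
    } , refl , refl
    where
    q : Quad
    q 0F = i
    q 1F = suc i
    q 2F = u
    q 3F = v
    inj : ∀ s t → q s ≡ q t → s ≡ t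
    inj 0F 0F _ = refl
    inj 1F 1F _ = refl
    inj 2F 2F _ = refl
    inj 3F 3F _ = refl
    inj 0F 1F e = contradiction e (<⇒≢ ≤-refl)
    inj 0F 2F e = contradiction (sym e) u≢i
    inj 0F 3F e = contradiction (sym e) v≢i
    inj 1F 0F e = contradiction e (>⇒≢ ≤-refl)
    inj 1F 2F e = contradiction (sym e) u≢1+i
    inj 1F 3F e = contradiction (sym e) v≢1+i
    inj 2F 0F e = contradiction e u≢i
    inj 2F 1F e = contradiction e u≢1+i
    inj 2F 3F e = contradiction e u≢v
    inj 3F 0F e = contradiction e v≢i
    inj 3F 1F e = contradiction e v≢1+i
    inj 3F 2F e = contradiction (sym e) u≢v

  scan : ∀ t → Scan t
  scan zero = record
    { xs = [] ; isQuads = record { quads = λ () ; disjoint = [] } ; top = λ () ; covered = λ () }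
  scan (suc t) with scan t
  ... | s = extend (break? t) (t ∈? cover xs)
    where
    open Scan s
    open Quads isQuads
    keep : (Break t → t ∈ cover xs) → Scan (suc t)
    keep h = record
      { xs = xs ; isQuads = isQuads ; top = λ q∈ → ≤-trans (top q∈) (n≤1+n t) ; covered = covered′ }
      where
      covered′ : ∀ {i} → i < suc t → Break i → i ∈ cover xs
      covered′ i<1+t b with ℕₚ.m<1+n⇒m<n∨m≡n i<1+t
      ... | inj₁ i<t  = covered i<t b
      ... | inj₂ refl = h b
    extend : Dec (Break t) → Dec (t ∈ cover xs) → Scan (suc t)
    extend (no ¬b) _        = keep (λ b → contradiction b ¬b)
    extend _       (yes t∈) = keep (λ _ → t∈)
    extend (yes b) (no t∉) with quad b
    ... | q , isQ , refl , q₁≡ = record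
      { xs = q ∷ xs
      ; isQuads = record
        { quads = λ { (here refl) → isQ ; (there q∈) → quads q∈ }
        ; disjoint = All.tabulate (λ q∈ → ℕₚ.≤∧≢⇒< (top q∈) (λ eq → t∉ (subst (_∈ cover xs) eq (∈-cover q∈)))) ∷ disjoint
        }
      ; top = λ { (here refl) → ≤-reflexive q₁≡ ; (there q∈) → ≤-trans (top q∈) (n≤1+n _) }
      ; covered = covered′
      }
      where
      covered′ : ∀ {i} → i < suc (q 0F) → Break i → i ∈ q 0F ∷ q 1F ∷ cover xs
      covered′ i<1+t b′ with ℕₚ.m<1+n⇒m<n∨m≡n i<1+t
      ... | inj₁ i<t  = there (there (covered i<t b′))
      ... | inj₂ refl = here refl

  breaks-covered : ∃ λ xs → Quads K xs × (∀ {i} → Break i → i ∈ cover xs)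
  breaks-covered = xs , isQuads , λ b → covered (<-trans ≤-refl (proj₁ b)) b
    where open Scan (scan N)

∈⇒at : ∀ {x : ℕ} {xs} → x ∈ xs → ∃ λ i → i < length xs × at 0 xs i ≡ x
∈⇒at (here refl) = 0 , z<s , refl
∈⇒at (there x∈)  = let i , lt , eq = ∈⇒at x∈ in suc i , s≤s lt , eq

indicator : Bool → Fin 2
indicator true  = 1F
indicator false = 0F

-- Coding a coloring with few breaks

module FewBreaks (n : ℕ) .{{n≢0 : NonZero n}} (r : ℕ) where

  Cuts : Set
  Cuts = Fin r → Fin n

  -- The interval containing x, given by the set of cuts before it. A cut at i separates i from i +
  -- 1, hence the strict inequality.
  key : Cuts → Fin n → Fin (2 ^ r)
  key t x = funToFin λ j → indicator (toℕ (t j) <ᵇ toℕ x)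

  key-cong : ∀ {t t′} → t ≗ t′ → ∀ x → key t x ≡ key t′ x
  key-cong eq x = funToFin-cong λ j → cong (λ c → indicator (toℕ c <ᵇ toℕ x)) (eq j)

  key-reflects : ∀ t {x y} → key t x ≡ key t y → ∀ j → toℕ (t j) < toℕ y → toℕ (t j) < toℕ x
  key-reflects t {x} {y} eq j lt = bits (toℕ (t j) <ᵇ toℕ x) refl (funToFin-injective eq j)
    where
    bits : ∀ b → (toℕ (t j) <ᵇ toℕ x) ≡ b →
      indicator b ≡ indicator (toℕ (t j) <ᵇ toℕ y) → toℕ (t j) < toℕ x
    bits true  e _ = ℕₚ.<ᵇ⇒< _ _ (Equivalence.from T-≡ e)
    bits false _ e with toℕ (t j) <ᵇ toℕ y | ℕₚ.<⇒<ᵇ lt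
    bits false _ () | true | _

  module _ (φ : ColoringOn n) where

    K : 𝒞₃
    K = coloring n φ

    open Colour K using (col; col-cong; col-swap₁; col-swap₂; col-rot; col-triple)
    open Breaks K

    ¬break⇒≡ : ∀ {i u v} → ¬ Break i → suc i < n → u < n → v < n → u ≢ i × u ≢ suc i → v ≢ i × v ≢ suc i → u ≢ v →
      col i u v ≡ col (suc i) u v
    ¬break⇒≡ {i} {u} {v} ¬b i<n u<n v<n u≢ v≢ u≢v with col i u v Finₚ.≟ col (suc i) u v
    ... | yes eq = eq
    ... | no  ne = contradiction (i<n , u , u<n , v , v<n , u≢ , v≢ , u≢v , ne) ¬b

    Outside : ℕ → ℕ → ℕ → Set
    Outside x y u = u < x ⊎ y < u

    -- The vertex moves by unit steps; none of them is a break, and u, v are never met.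
    move : ∀ x y {u v} → x ≤ y → (∀ {i} → x ≤ i → i < y → ¬ Break i) → y < n → u < n → v < n →
      Outside x y u → Outside x y v → u ≢ v → col x u v ≡ col y u v
    move x y x≤y none y<n u<n v<n ou ov u≢v with ℕₚ.m≤n⇒m<n∨m≡n x≤y
    ... | inj₂ refl = refl
    move x (suc y) x≤y none y<n u<n v<n ou ov u≢v | inj₁ (s≤s x≤y′) =
      trans (move x y x≤y′ (λ x≤i i<y → none x≤i (≤-trans i<y (n≤1+n y))) (<-trans ≤-refl y<n) u<n v<n (shrink ou) (shrink ov) u≢v)
        (¬break⇒≡ (none x≤y′ ≤-refl) y<n u<n v<n (avoid ou) (avoid ov) u≢v)
      where
      shrink : ∀ {u} → Outside x (suc y) u → Outside x y u
      shrink (inj₁ lt) = inj₁ lt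
      shrink (inj₂ gt) = inj₂ (<-trans ≤-refl gt)
      avoid : ∀ {u} → Outside x (suc y) u → u ≢ y × u ≢ suc y
      avoid (inj₁ lt) = <⇒≢ (≤-trans lt x≤y′) , <⇒≢ (≤-trans lt (≤-trans x≤y′ (n≤1+n y)))
      avoid (inj₂ gt) = >⇒≢ (<-trans ≤-refl gt) , >⇒≢ gt

    Covers : Cuts → Set
    Covers t = ∀ {i} → Break i → ∃ λ j → toℕ (t j) ≡ i

    module _ {t : Cuts} (covers : Covers t) where

      unbroken : ∀ {x y} → key t x ≡ key t y → ∀ {i} → toℕ x ≤ i → i < toℕ y → ¬ Break i
      unbroken eq x≤i i<y b with covers b
      ... | j , refl = ℕₚ.<⇒≱ (key-reflects t eq j i<y) x≤i

      unbroken-⊓ : ∀ {x y} → key t x ≡ key t y → ∀ {i} → toℕ x ⊓ toℕ y ≤ i → i < toℕ x → ¬ Break i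
      unbroken-⊓ {x} {y} eq {i} le lt with ≤-total (toℕ x) (toℕ y)
      ... | inj₁ x≤y = contradiction (subst (_≤ i) (ℕₚ.m≤n⇒m⊓n≡m x≤y) le) (ℕₚ.<⇒≱ lt)
      ... | inj₂ y≤x = unbroken (sym eq) (subst (_≤ i) (ℕₚ.m≥n⇒m⊓n≡n y≤x) le) lt

      -- Two triples of one type both move down to their componentwise minimum, which is increasing
      -- again. Moving x first, then y, then z, no vertex passes another.
      lower : ∀ {x y z x′ y′ z′ : Fin n} → x Fin.< y → y Fin.< z → x′ Fin.< y′ → y′ Fin.< z′ →
        key t x ≡ key t x′ → key t y ≡ key t y′ → key t z ≡ key t z′ →
        col (toℕ x ⊓ toℕ x′) (toℕ y ⊓ toℕ y′) (toℕ z ⊓ toℕ z′) ≡ col (toℕ x) (toℕ y) (toℕ z)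
      lower {x} {y} {z} {x′} {y′} {z′} x<y y<z x<y′ y<z′ kx ky kz = trans lower-z (trans lower-y lower-x)
        where
        a = toℕ x ⊓ toℕ x′
        b = toℕ y ⊓ toℕ y′
        c = toℕ z ⊓ toℕ z′
        a≤x = ℕₚ.m⊓n≤m (toℕ x) (toℕ x′)
        b≤y = ℕₚ.m⊓n≤m (toℕ y) (toℕ y′)
        c≤z = ℕₚ.m⊓n≤m (toℕ z) (toℕ z′)
        a<b : a < b
        a<b = ℕₚ.⊓-mono-< x<y x<y′
        b<c : b < c
        b<c = ℕₚ.⊓-mono-< y<z y<z′
        a<n = ℕₚ.≤-<-trans a≤x (Finₚ.toℕ<n x)
        b<n = ℕₚ.≤-<-trans b≤y (Finₚ.toℕ<n y)
        b<z = ℕₚ.≤-<-trans b≤y y<z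
        lower-x : col a (toℕ y) (toℕ z) ≡ col (toℕ x) (toℕ y) (toℕ z)
        lower-x = move a (toℕ x) a≤x (unbroken-⊓ {x} {x′} kx) (Finₚ.toℕ<n x) (Finₚ.toℕ<n y) (Finₚ.toℕ<n z)
          (inj₂ x<y) (inj₂ (<-trans x<y y<z)) (<⇒≢ y<z)
        lower-y : col a b (toℕ z) ≡ col a (toℕ y) (toℕ z)
        lower-y = trans (col-swap₁ _ _ _) (trans (move b (toℕ y) b≤y (unbroken-⊓ {y} {y′} ky) (Finₚ.toℕ<n y) a<n (Finₚ.toℕ<n z)
          (inj₁ a<b) (inj₂ y<z) (<⇒≢ (<-trans a<b b<z))) (col-swap₁ _ _ _))
        lower-z : col a b c ≡ col a b (toℕ z)
        lower-z = trans (sym (col-rot _ _ _)) (trans (move c (toℕ z) c≤z (unbroken-⊓ {z} {z′} kz) (Finₚ.toℕ<n z) a<n b<n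
          (inj₁ (<-trans a<b b<c)) (inj₁ b<c) (<⇒≢ a<b)) (col-rot _ _ _))

      sameKeys : ∀ {x y z x′ y′ z′ : Fin n} .(p : x Fin.< y) .(q : y Fin.< z) .(p′ : x′ Fin.< y′) .(q′ : y′ Fin.< z′) →
        key t x ≡ key t x′ → key t y ≡ key t y′ → key t z ≡ key t z′ → φ (triple x y z p q) ≡ φ (triple x′ y′ z′ p′ q′)
      sameKeys {x} {y} {z} {x′} {y′} {z′} p q p′ q′ kx ky kz = relevant (recompute< p) (recompute< q) (recompute< p′) (recompute< q′)
        where
        recompute< : ∀ {x y : Fin n} → .(x Fin.< y) → x Fin.< y
        recompute< {x} {y} p = recompute (toℕ x <? toℕ y) p
        relevant : (p : x Fin.< y) (q : y Fin.< z) (p′ : x′ Fin.< y′) (q′ : y′ Fin.< z′) → φ (triple x y z p q) ≡ φ (triple x′ y′ z′ p′ q′)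
        relevant p q p′ q′ = trans (sym (col-triple p q)) (trans (sym (lower {x} {y} {z} {x′} {y′} {z′} p q p′ q′ kx ky kz))
          (trans (col-cong (ℕₚ.⊓-comm (toℕ x) (toℕ x′)) (ℕₚ.⊓-comm (toℕ y) (toℕ y′)) (ℕₚ.⊓-comm (toℕ z) (toℕ z′)))
          (trans (lower {x′} {y′} {z′} {x} {y} {z} p′ q′ p q (sym kx) (sym ky) (sym kz)) (col-triple p′ q′))))

    Realised : Cuts → Fin (2 ^ r) → Fin (2 ^ r) → Fin (2 ^ r) → Set
    Realised t a b c = ∃ λ x → ∃ λ y → ∃ λ z → (x Fin.< y × y Fin.< z) × key t x ≡ a × key t y ≡ b × key t z ≡ c

    realised? : ∀ t a b c → Dec (Realised t a b c)
    realised? t a b c = Finₚ.any? λ x → Finₚ.any? λ y → Finₚ.any? λ z →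
      ((x Finₚ.<? y) ×-dec (y Finₚ.<? z)) ×-dec (key t x Finₚ.≟ a) ×-dec (key t y Finₚ.≟ b) ×-dec (key t z Finₚ.≟ c)

    -- A representative triple gives the colour; by `sameKeys` its choice is immaterial once the
    -- cuts cover all breaks. Types without a triple get the default `0F`.
    type : Cuts → Fin (2 ^ r) → Fin (2 ^ r) → Fin (2 ^ r) → Fin 2
    type t a b c with realised? t a b c
    ... | yes (x , y , z , (p , q) , _) = φ (triple x y z p q)
    ... | no  _                         = 0F

    type-key : ∀ {t} → Covers t → ∀ {x y z} .(p : x Fin.< y) .(q : y Fin.< z) →
      φ (triple x y z p q) ≡ type t (key t x) (key t y) (key t z)
    type-key {t} covers {x} {y} {z} p q with realised? t (key t x) (key t y) (key t z)
    ... | yes (_ , _ , _ , (p′ , q′) , kx , ky , kz) = sameKeys {t} covers p q p′ q′ (sym kx) (sym ky) (sym kz)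
    ... | no  none = contradiction (x , y , z , (recompute (x Finₚ.<? y) p , recompute (y Finₚ.<? z) q) , refl , refl , refl) none

    -- The factor `n ^ r` counts the cuts; the other one counts the tables of types and depends on r
    -- only. This is the source of polynomial growth.
    code : Cuts → Fin (n ^ r * ((2 ^ (2 ^ r)) ^ (2 ^ r)) ^ (2 ^ r))
    code t = Fin.combine (funToFin t) (funToFin λ a → funToFin λ b → funToFin λ c → type t a b c)

    clamp : ℕ → Fin n
    clamp i with i <? n
    ... | yes i<n = fromℕ< i<n
    ... | no  _   = fromℕ< (>-nonZero⁻¹ n)

    toℕ-clamp : ∀ {i} → i < n → toℕ (clamp i) ≡ i
    toℕ-clamp {i} i<n with i <? n
    ... | yes lt = Finₚ.toℕ-fromℕ< lt
    ... | no  ge = contradiction i<n ge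

    -- Positions beyond the end of the list become cuts at 0; additional cuts merely refine the
    -- intervals.
    cuts : List ℕ → Cuts
    cuts l j = clamp (at 0 l (toℕ j))

    cuts-covers : ∀ {l} → length l ≤ r → (∀ {i} → Break i → i ∈ l) → Covers (cuts l)
    cuts-covers {l} le cov b with ∈⇒at (cov b)
    ... | p , p< , refl = fromℕ< p<r , trans (cong (λ x → toℕ (clamp (at 0 l x))) (Finₚ.toℕ-fromℕ< p<r))
          (toℕ-clamp (<-trans ≤-refl (proj₁ b)))
      where p<r = ≤-trans p< le

  code-injective : ∀ {φ φ′ t t′} → Covers φ t → Covers φ′ t′ → code φ t ≡ code φ′ t′ → φ ≗ φ′
  code-injective {φ} {φ′} {t} {t′} cov cov′ eq (triple x y z p q) = trans (type-key φ cov p q) (trans same (sym (type-key φ′ cov′ p q)))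
    where
    splitted = Finₚ.combine-injective (funToFin t) _ (funToFin t′) _ eq
    t≗t′ : t ≗ t′
    t≗t′ = funToFin-injective (proj₁ splitted)
    types : ∀ a b c → type φ t a b c ≡ type φ′ t′ a b c
    types a b = funToFin-injective (funToFin-injective (funToFin-injective (proj₂ splitted) a) b)
    same : type φ t (key t x) (key t y) (key t z) ≡ type φ′ t′ (key t′ x) (key t′ y) (key t′ z)
    same rewrite key-cong t≗t′ x | key-cong t≗t′ y | key-cong t≗t′ z = types _ _ _

-- Cardinalities and the dichotomy

record Enumeration {a} {m : ℕ} (I : Fin m → Set a) : Set a where
  field
    count      : ℕ
    element   : Fin count → Fin m
    injective : ∀ {i j} → element i ≡ element j → i ≡ j
    sound     : ∀ i → I (element i)
    complete  : ∀ {j} → I j → ∃ λ i → element i ≡ j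

enumerate : ∀ {a m} (I : Fin m → Set a) → (∀ j → Dec (I j)) → Enumeration I
enumerate {m = zero} I I? = record
  { count = 0 ; element = λ () ; injective = λ { {()} } ; sound = λ () ; complete = λ { {()} } }
enumerate {m = suc m} I I? with I? 0F | enumerate (I ∘ fs) (I? ∘ fs)
... | no ¬I₀ | E = record
  { count = count ; element = fs ∘ element ; injective = injective ∘ Finₚ.suc-injective ; sound = sound
  ; complete = λ { {0F} I₀ → contradiction I₀ ¬I₀ ; {fs j} Iⱼ → let i , eq = complete Iⱼ in i , cong fs eq } }
  where open Enumeration E
... | yes I₀ | E = record
  { count = suc count ; element = element⁺ ; injective = λ {i} {j} → injective⁺ i j ; sound = λ { 0F → I₀ ; (fs i) → sound i }
  ; complete = λ { {0F} _ → 0F , refl ; {fs j} Iⱼ → let i , eq = complete Iⱼ in fs i , cong fs eq } }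
  where
  open Enumeration E
  element⁺ : Fin (suc count) → Fin (suc m)
  element⁺ 0F     = 0F
  element⁺ (fs i) = fs (element i)
  injective⁺ : ∀ i j → element⁺ i ≡ element⁺ j → i ≡ j
  injective⁺ 0F     0F     _  = refl
  injective⁺ (fs i) (fs j) eq = cong fs (injective (Finₚ.suc-injective eq))
  injective⁺ 0F     (fs j) ()
  injective⁺ (fs i) 0F     ()

module _ {a e} (em : ExcludedMiddle a) (S : Setoid a e) where
  open Setoid S using (Carrier; _≈_) renaming (refl to ≈-refl)

  -- Excluded middle decides which codes are attained; counting those gives an exact cardinality.
  finite : ∀ {m} (code : Carrier → Fin m) → (∀ {x y} → x ≈ y → code x ≡ code y) → (∀ {x y} → code x ≡ code y → x ≈ y) →
    ∃ λ k → S HasCardinality k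
  finite {m} code code-cong code-inj = count , record
    { to = to
    ; cong = λ { refl → ≈-refl }
    ; bijective =
        (λ {i} {j} eq → injective (trans (sym (proj₂ (sound i))) (trans (code-cong eq) (proj₂ (sound j))))) ,
        λ y → let i , eq = complete (y , refl) in i , λ { refl → code-inj (trans (proj₂ (sound i)) eq) }
    }
    where
    open Enumeration (enumerate (λ j → ∃ λ x → code x ≡ j) (λ j → em))
    to : Fin count → Carrier
    to i = proj₁ (sound i)

module _ {a e k} {S : Setoid a e} (card : S HasCardinality k) where
  open Setoid S using (Carrier; _≈_)
  private module B = Bijection card

  cardinality-≤ : ∀ {m} (code : Carrier → Fin m) → (∀ {x y} → code x ≡ code y → x ≈ y) → k ≤ m
  cardinality-≤ code code-inj = Finₚ.injective⇒≤ {f = code ∘ B.to} (B.injective ∘ code-inj)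

  cardinality-≥ : ∀ {m} (f : Fin m → Carrier) → (∀ {i j} → f i ≈ f j → i ≡ j) → m ≤ k
  cardinality-≥ f f-inj = Finₚ.injective⇒≤ {f = λ i → proj₁ (B.strictlySurjective (f i))} λ {i} {j} eq →
    f-inj (Setoid.trans S (Setoid.sym S (proj₂ (B.strictlySurjective (f i))))
      (Setoid.trans S (B.cong eq) (proj₂ (B.strictlySurjective (f j)))))

module _ {n : ℕ} where

  colourAt : ColoringOn n → Fin n → Fin n → Fin n → Fin 2
  colourAt φ x y z with x Finₚ.<? y | y Finₚ.<? z
  ... | yes p | yes q = φ (triple x y z p q)
  ... | _     | _     = 0F

  colourAt-triple : ∀ φ {x y z} .(p : x Fin.< y) .(q : y Fin.< z) → colourAt φ x y z ≡ φ (triple x y z p q)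
  colourAt-triple φ {x} {y} {z} p q with x Finₚ.<? y | y Finₚ.<? z
  ... | yes _ | yes _ = refl
  ... | yes _ | no ¬q = contradiction (recompute (y Finₚ.<? z) q) ¬q
  ... | no ¬p | _     = contradiction (recompute (x Finₚ.<? y) p) ¬p

  colourAt-cong : ∀ {φ φ′} → φ ≗ φ′ → ∀ x y z → colourAt φ x y z ≡ colourAt φ′ x y z
  colourAt-cong eq x y z with x Finₚ.<? y | y Finₚ.<? z
  ... | yes p | yes q = eq (triple x y z p q)
  ... | yes _ | no  _ = refl
  ... | no  _ | _     = refl

  -- A crude code whose purpose is that X_n is finite, and hence has a cardinality at all.
  fullCode : ColoringOn n → Fin (((2 ^ n) ^ n) ^ n)
  fullCode φ = funToFin λ x → funToFin λ y → funToFin λ z → colourAt φ x y z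

  fullCode-cong : ∀ {φ φ′} → φ ≗ φ′ → fullCode φ ≡ fullCode φ′
  fullCode-cong eq = funToFin-cong λ x → funToFin-cong λ y → funToFin-cong λ z → colourAt-cong eq x y z

  fullCode-injective : ∀ {φ φ′} → fullCode φ ≡ fullCode φ′ → φ ≗ φ′
  fullCode-injective {φ} {φ′} eq (triple x y z p q) = trans (sym (colourAt-triple φ p q))
    (trans (funToFin-injective (funToFin-injective (funToFin-injective eq x) y) z) (colourAt-triple φ′ p q))

m<2^m : ∀ m → m < 2 ^ m
m<2^m zero    = s≤s z≤n
m<2^m (suc m) = ℕₚ.+-mono-≤ (ℕₚ.m^n>0 2 m) (≤-trans (m<2^m m) (m≤m+n _ 0))

-- The factor q does not grow with n and moves into the exponent by q < 2^q ≤ n^q. The successor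
-- makes the exponent positive.
polynomial-bound : ∀ n r q → 2 ≤ n → n ^ r * q ≤ n ^ suc (r + q)
polynomial-bound n r q 2≤n = begin
  n ^ r * q       ≤⟨ ℕₚ.*-monoʳ-≤ (n ^ r) (≤-trans (<⇒≤ (m<2^m q)) (ℕₚ.^-monoˡ-≤ q 2≤n)) ⟩
  n ^ r * n ^ q   ≡⟨ sym (ℕₚ.^-distribˡ-+-* n r q) ⟩
  n ^ (r + q)     ≤⟨ ℕₚ.m≤n*m (n ^ (r + q)) n ⟩
  n * n ^ (r + q) ∎
  where
  open ℕₚ.≤-Reasoning
  instance _ = >-nonZero (≤-trans (s≤s z≤n) 2≤n)

module _ {ℓ} (em : ExcludedMiddle ℓ) (X : Pred 𝒞₃ ℓ) where

  cardinality : ∀ n → .{{_ : NonZero n}} → ∃ λ k → (X ↾ n) HasCardinality k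
  cardinality n = finite em (X ↾ n) (fullCode ∘ proj₁) fullCode-cong fullCode-injective

  exponent : ℕ → ℕ
  exponent r = suc (r + ((2 ^ (2 ^ r)) ^ (2 ^ r)) ^ (2 ^ r))

  fewBreaks⇒polynomial : ∀ r → (∀ K → X K → ∃ λ l → length l ≤ r × (∀ {i} → Breaks.Break K i → i ∈ l)) →
    ∀ n → .{{_ : NonZero n}} → ∃[ k ] (X ↾ n) HasCardinality k × k ≤ n ^ exponent r
  fewBreaks⇒polynomial r few n with cardinality n
  ... | k , card = k , card , bound n card (n ≤? 1)
    where
    bound : ∀ n .{{_ : NonZero n}} → (X ↾ n) HasCardinality k → Dec (n ≤ 1) → k ≤ n ^ exponent r
    -- Powers of 1 absorb no factor, but without triples there is at most one coloring.
    bound 1 card (yes _) = ≤-trans (cardinality-≤ {S = X ↾ 1} card {1} (λ _ → 0F) λ { {φ , _} {φ′ , _} _ → noTriples φ φ′ })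
      (≤-reflexive (sym (ℕₚ.^-zeroˡ (exponent r))))
      where
      noTriples : (φ φ′ : ColoringOn 1) → φ ≗ φ′
      noTriples φ φ′ (triple 0F 0F _ () _)
    bound (suc (suc _)) card (yes (s≤s ()))
    bound n card (no n≰1) = ≤-trans
      (cardinality-≤ {S = X ↾ n} card (λ (φ , φ∈) → code φ (cutsOf φ φ∈))
        λ { {φ , φ∈} {φ′ , φ∈′} → code-injective {φ} {φ′} (covers φ φ∈) (covers φ′ φ∈′) })
      (polynomial-bound n r (((2 ^ (2 ^ r)) ^ (2 ^ r)) ^ (2 ^ r)) (ℕₚ.≰⇒> n≰1))
      where
      open FewBreaks n r
      cutsOf : ∀ φ → X (coloring n φ) → Cuts
      cutsOf φ φ∈ = cuts φ (proj₁ (few (coloring n φ) φ∈))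
      covers : ∀ φ φ∈ → Covers φ (cutsOf φ φ∈)
      covers φ φ∈ = let l , le , cov = few (coloring n φ) φ∈ in cuts-covers φ {l} le cov

  coversOf : ∀ {M} → (∀ K → X K → ∀ xs → Quads K xs → length xs < M) →
    ∀ K → X K → ∃ λ l → length l ≤ M * 2 × (∀ {i} → Breaks.Break K i → i ∈ l)
  coversOf bounded K K∈X =
    let xs , Q , covered = Breaks.breaks-covered K in
    Breaks.cover K xs ,
    ≤-trans (≤-reflexive (Breaks.length-cover K xs)) (ℕₚ.*-monoˡ-≤ 2 (<⇒≤ (bounded K K∈X xs Q))) ,
    covered

theorem1p2 : ∀ {ℓ} → ExcludedMiddle ℓ → (X : Pred 𝒞₃ ℓ) → IsIdeal X →
    ∃[ c ] 0 < c ×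
    ( (∀ n → .{{_ : NonZero n}} → ∃[ k ] (X ↾ n) HasCardinality k × k ≤ n ^ c)
    ⊎ (∀ n → .{{_ : NonZero n}} → 23 ≤ n → ∃[ k ] (X ↾ n) HasCardinality k × G n ≤ k) )
theorem1p2 em X ideal
  with em {∃ λ n → Σ (NonZero n) λ n≢0 → 23 ≤ n × ¬ Many X n {{n≢0}}}
-- The second alternative does not mention c, so any positive value serves.
... | no never = 1 , s≤s z≤n , inj₂ λ n 23≤n → many n 23≤n (em {Many X n})
  where
  many : ∀ n .{{_ : NonZero n}} → 23 ≤ n → Dec (Many X n) → ∃[ k ] (X ↾ n) HasCardinality k × G n ≤ k
  many n 23≤n (no few) = contradiction (n , >-nonZero (≤-trans (s≤s z≤n) 23≤n) , 23≤n , few) never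
  many n 23≤n (yes (f , f-inj)) = let k , card = cardinality em X n in k , card , cardinality-≥ {S = X ↾ n} card f f-inj
-- This one n bounds the quads, and with them the breaks, in every coloring of X; the resulting
-- exponent serves all sizes.
... | yes (n , n≢0 , 23≤n , few) with boundedQuads X ideal n {{n≢0}} 23≤n few
...   | M , bounded = exponent em X (M * 2) , s≤s z≤n , inj₁ (fewBreaks⇒polynomial em X (M * 2) (coversOf em X bounded))
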